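{- OV indexing on $n$ random input vectors of length $c\log n$ can be solved in expected truly sublinear query time using $O(n^{c-1+\epsilon})$ space, for any $\epsilon>0$.
   Context: Orthogonal Vectors Indexing (OV indexing): given a set $S$ of $n$ boolean vectors of length $d$, preprocess $S$ to answer queries of the form: given a boolean vector $v$ of length $d$, is there a vector in $S$ orthogonal to $v$? Two boolean vectors are orthogonal if there is no coordinate in which both are 1. Here $d=c\log n$ for a constant $c>1$, and $\log$ is base 2. Random input vectors are chosen independently and uniformly at random from $\{0,1\}^{c\log n}$. "Truly sublinear" means $O(n^{1-\delta})$ for some constant $\delta>0$.
   Formalization: Space is counted in addition to the n words holding the input vectors; when c−1+ε < 1 the bound on total space would be below n and cannot hold for all inputs, while for c−1+ε ≥ 1 (in particular c ≥ 2) the two readings agree. -}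

module Defs where

import Algebra.Definitions.RawSemiring
open import Data.Bool.Base using (Bool; true; false; if_then_else_)
open import Data.Fin.Base using (Fin; toℕ)
open import Data.Integer.Base using (ℤ; +_; -[1+_])
open import Data.List.Base as List using (List; []; _∷_; _++_; length; cartesianProductWith)
open import Data.List.Relation.Binary.Permutation.Propositional using (_↭_)
open import Data.Nat.Base as ℕ using (ℕ; zero; suc; NonZero)
open import Data.Nat.DivMod using (_mod_)
open import Data.Nat.Logarithm using (⌊log₂_⌋)
open import Data.Nat.Properties using (m^n≢0)
open import Data.Product.Base using (_×_; ∃-syntax)
open import Data.Rational.Base as ℚ using (ℚ; 0ℚ; 1ℚ; ½; ∣_∣; ↥_; ↧ₙ_)
open import Data.Rational.Properties as ℚₚ using ()
open import Data.Rational.Solver using (module +-*-Solver)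
open import Data.Vec.Base as Vec using (Vec; []; _∷_; lookup; toList)
open import Data.Vec.Relation.Unary.Any using (Any)
open import Function.Bundles using (_⇔_)
open import Relation.Binary.PropositionalEquality
  using (_≡_; _≢_; refl; sym; trans; cong; cong₂; subst)
open import Relation.Nullary using (¬_)

open Algebra.Definitions.RawSemiring ℚ.+-*-rawSemiring using () renaming (_^_ to _^ℚ_)

-- Cauchy sequences of rationals; the k-th term is within 2^-k of the limit.
record ℝ : Set where
  constructor mkℝ
  field
    approx  : ℕ → ℚ
    regular : ∀ m n → ∣ approx m ℚ.- approx n ∣ ℚ.≤ ½ ^ℚ m ℚ.+ ½ ^ℚ n

open ℝ public

private
  ½^-nonNeg : ∀ m → 0ℚ ℚ.≤ ½ ^ℚ m
  ½^-nonNeg zero    = ℚₚ.nonNegative⁻¹ 1ℚ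
  ½^-nonNeg (suc m) = ℚₚ.≤-trans (ℚₚ.≤-reflexive (sym (ℚₚ.*-zeroʳ ½)))
                                 (ℚₚ.*-monoˡ-≤-nonNeg ½ (½^-nonNeg m))

  ½^-halves : ∀ m → ½ ^ℚ suc m ℚ.+ ½ ^ℚ suc m ≡ ½ ^ℚ m
  ½^-halves m = trans (sym (ℚₚ.*-distribʳ-+ (½ ^ℚ m) ½ ½)) (ℚₚ.*-identityˡ (½ ^ℚ m))

  interchange : ∀ a b c d → (a ℚ.+ b) ℚ.+ (c ℚ.+ d) ≡ (a ℚ.+ c) ℚ.+ (b ℚ.+ d)
  interchange = solve 4 (λ a b c d → (a :+ b) :+ (c :+ d) := (a :+ c) :+ (b :+ d)) refl
    where open +-*-Solver

  sub-interchange : ∀ a b c d → (a ℚ.+ b) ℚ.- (c ℚ.+ d) ≡ (a ℚ.- c) ℚ.+ (b ℚ.- d)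
  sub-interchange = solve 4 (λ a b c d → (a :+ b) :- (c :+ d) := (a :- c) :+ (b :- d)) refl
    where open +-*-Solver

infixl 6 _+ᵣ_ _-ᵣ_
infix  8 -ᵣ_
infix  4 _<ᵣ_

fromℚ : ℚ → ℝ
approx  (fromℚ q) _   = q
regular (fromℚ q) m n =
  subst (ℚ._≤ _) (sym (cong ∣_∣ (ℚₚ.+-inverseʳ q)))
        (ℚₚ.+-mono-≤ (½^-nonNeg m) (½^-nonNeg n))

0ᵣ 1ᵣ : ℝ
0ᵣ = fromℚ 0ℚ
1ᵣ = fromℚ 1ℚ

_+ᵣ_ : ℝ → ℝ → ℝ
approx  (x +ᵣ y) k   = approx x (suc k) ℚ.+ approx y (suc k)
regular (x +ᵣ y) m n =
  subst (λ z → ∣ z ∣ ℚ.≤ ½ ^ℚ m ℚ.+ ½ ^ℚ n)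
        (sym (sub-interchange (approx x (suc m)) (approx y (suc m))
                              (approx x (suc n)) (approx y (suc n))))
  (ℚₚ.≤-trans (ℚₚ.∣p+q∣≤∣p∣+∣q∣ (approx x (suc m) ℚ.- approx x (suc n))
                                (approx y (suc m) ℚ.- approx y (suc n)))
  (ℚₚ.≤-trans (ℚₚ.+-mono-≤ (regular x (suc m) (suc n)) (regular y (suc m) (suc n)))
  (ℚₚ.≤-reflexive
    (trans (interchange (½ ^ℚ suc m) (½ ^ℚ suc n) (½ ^ℚ suc m) (½ ^ℚ suc n))
           (cong₂ ℚ._+_ (½^-halves m) (½^-halves n))))))

-ᵣ_ : ℝ → ℝ
approx  (-ᵣ x) k   = ℚ.- approx x k
regular (-ᵣ x) m n =
  subst (ℚ._≤ _)
        (trans (sym (ℚₚ.∣-p∣≡∣p∣ (approx x m ℚ.- approx x n)))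
               (cong ∣_∣ (ℚₚ.neg-distrib-+ (approx x m) (ℚ.- approx x n))))
        (regular x m n)

_-ᵣ_ : ℝ → ℝ → ℝ
x -ᵣ y = x +ᵣ -ᵣ y

_<ᵣ_ : ℝ → ℝ → Set
x <ᵣ y = ∃[ k ] approx x k ℚ.+ (½ ^ℚ k ℚ.+ ½ ^ℚ k) ℚ.< approx y k

fromℕ : ℕ → ℚ
fromℕ m = + m ℚ./ 1

_^ℤ_ : (n : ℕ) .{{_ : NonZero n}} → ℤ → ℚ
n ^ℤ (+ p)    = fromℕ n ^ℚ p
n ^ℤ -[1+ p ] = (+ 1 ℚ./ n) ^ℚ suc p

-- For x ≥ 0.  As n ≥ 1, n ^ r is the infimum of n ^ s over rational s > r
-- (resp. the supremum over rational s < r), and for s = p / q in lowest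
-- terms the inequality with n ^ s is raised to the power q.

_≤_·_^ᵣ_ : ℚ → ℕ → (n : ℕ) .{{_ : NonZero n}} → ℝ → Set
x ≤ C · n ^ᵣ r = ∀ (s : ℚ) → r <ᵣ fromℚ s → x ^ℚ (↧ₙ s) ℚ.≤ fromℕ C ^ℚ (↧ₙ s) ℚ.* n ^ℤ (↥ s)

_^ᵣ_≤_ : (n : ℕ) .{{_ : NonZero n}} → ℝ → ℚ → Set
n ^ᵣ r ≤ x = ∀ (s : ℚ) → fromℚ s <ᵣ r → n ^ℤ (↥ s) ℚ.≤ x ^ℚ (↧ₙ s)

-- c log n is rarely an integer.  This says | d - c log n | ≤ 1, in the form
-- 2 ^ d ≤ 2 n ^ c and n ^ c ≤ 2 ^ (d + 1); either way of rounding is allowed.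

_≈_log₂_ : ℕ → ℝ → (n : ℕ) .{{_ : NonZero n}} → Set
d ≈ c log₂ n = (fromℕ (2 ℕ.^ d) ≤ 2 · n ^ᵣ c) × (n ^ᵣ c ≤ fromℕ (2 ℕ.^ suc d))

BitVec : ℕ → Set
BitVec = Vec Bool

Orthogonal : ∀ {d} → BitVec d → BitVec d → Set
Orthogonal u v = ¬ (∃[ i ] lookup u i ≡ true × lookup v i ≡ true)

-- Repetitions are allowed, as for independent samples.
Input : ℕ → ℕ → Set
Input n d = Vec (BitVec d) n

sequences : ∀ {A : Set} → List A → (n : ℕ) → List (Vec A n)
sequences xs zero    = [] ∷ []
sequences xs (suc n) = cartesianProductWith _∷_ xs (sequences xs n)

allInputs : ∀ n d → List (Input n d)
allInputs n d = sequences (sequences (false ∷ true ∷ []) d) n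

-- Expectation when the n vectors are independent and uniform in {0,1}^d,
-- that is, when each of the 2 ^ (d n) inputs is equally likely.
𝔼 : ∀ n d → (Input n d → ℕ) → ℚ
𝔼 n d f = (+ List.sum (List.map f (allInputs n d)) ℚ./ (2 ℕ.^ (d ℕ.* n)))
            {{m^n≢0 2 (d ℕ.* n)}}

-- Word RAM with w-bit words, as a structured language.  A program mentions
-- finitely many registers, which are its only workspace; the memory is the
-- data structure and is read-only during a query.

record Word (w : ℕ) : Set where
  constructor mkWord
  field
    bits : Fin (2 ℕ.^ w)

value : ∀ {w} → Word w → ℕ
value (mkWord x) = toℕ x

word : ∀ {w} → ℕ → Word w
word {w} x = mkWord (_mod_ x (2 ℕ.^ w) {{m^n≢0 2 w}})

Reg : Set
Reg = ℕ

data Op : Set where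
  add sub mul div mod : Op

infixr 5 _⨾_

data Prog : Set where
  _≔#_     : Reg → ℕ → Prog
  _≔_⟨_⟩_  : Reg → Reg → Op → Reg → Prog
  _≔mem[_] : Reg → Reg → Prog
  skip     : Prog
  _⨾_      : Prog → Prog → Prog
  ifnz     : Reg → Prog → Prog → Prog
  whilenz  : Reg → Prog → Prog

⟦_⟧ : Op → ℕ → ℕ → ℕ
⟦ add ⟧ x y         = x ℕ.+ y
⟦ sub ⟧ x y         = x ℕ.∸ y
⟦ mul ⟧ x y         = x ℕ.* y
⟦ div ⟧ x zero      = 0
⟦ div ⟧ x y@(suc _) = x ℕ./ y
⟦ mod ⟧ x zero      = 0
⟦ mod ⟧ x y@(suc _) = x ℕ.% y

Regs : ℕ → Set
Regs w = Reg → Word w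

_[_↦_] : ∀ {w} → Regs w → Reg → Word w → Regs w
(ρ [ r ↦ x ]) s = if s ℕ.≡ᵇ r then x else ρ s

Memory : ℕ → Set
Memory w = List (Word w)

cell : ∀ {w} → Memory w → ℕ → Word w
cell []      _       = word 0
cell (x ∷ _) zero    = x
cell (_ ∷ m) (suc a) = cell m a

-- m ⊢ p , ρ ⇓[ t ] ρ′ : on memory m, started with registers ρ, the program p
-- halts after t unit-cost steps with registers ρ′.
infix 3 _⊢_,_⇓[_]_

data _⊢_,_⇓[_]_ {w} (m : Memory w) : Prog → Regs w → ℕ → Regs w → Set where
  ⇓const  : ∀ {ρ r k} → m ⊢ r ≔# k , ρ ⇓[ 1 ] (ρ [ r ↦ word k ])
  ⇓op     : ∀ {ρ r a o b} →
            m ⊢ r ≔ a ⟨ o ⟩ b , ρ ⇓[ 1 ] (ρ [ r ↦ word (⟦ o ⟧ (value (ρ a)) (value (ρ b))) ])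
  ⇓load   : ∀ {ρ r a} → m ⊢ r ≔mem[ a ] , ρ ⇓[ 1 ] (ρ [ r ↦ cell m (value (ρ a)) ])
  ⇓skip   : ∀ {ρ} → m ⊢ skip , ρ ⇓[ 0 ] ρ
  ⇓seq    : ∀ {p q ρ ρ′ ρ″ t u} →
            m ⊢ p , ρ ⇓[ t ] ρ′ → m ⊢ q , ρ′ ⇓[ u ] ρ″ → m ⊢ p ⨾ q , ρ ⇓[ t ℕ.+ u ] ρ″
  ⇓then   : ∀ {r p q ρ ρ′ t} → value (ρ r) ≢ 0 →
            m ⊢ p , ρ ⇓[ t ] ρ′ → m ⊢ ifnz r p q , ρ ⇓[ suc t ] ρ′
  ⇓else   : ∀ {r p q ρ ρ′ t} → value (ρ r) ≡ 0 →
            m ⊢ q , ρ ⇓[ t ] ρ′ → m ⊢ ifnz r p q , ρ ⇓[ suc t ] ρ′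
  ⇓stop   : ∀ {r p ρ} → value (ρ r) ≡ 0 → m ⊢ whilenz r p , ρ ⇓[ 1 ] ρ
  ⇓repeat : ∀ {r p ρ ρ′ ρ″ t u} → value (ρ r) ≢ 0 →
            m ⊢ p , ρ ⇓[ t ] ρ′ → m ⊢ whilenz r p , ρ′ ⇓[ u ] ρ″ →
            m ⊢ whilenz r p , ρ ⇓[ suc (t ℕ.+ u) ] ρ″

code : ∀ {d} → BitVec d → ℕ
code []      = 0
code (b ∷ v) = (if b then 1 else 0) ℕ.+ 2 ℕ.* code v

-- The memory holds the n input vectors, one per word and in an order chosen
-- by the preprocessing, followed by the auxiliary words it computes.
record OVIndex : Set where
  field
    wordFactor : ℕ

  -- Θ(log n), also for n = 1.
  wordSize : ℕ → ℕ
  wordSize n = wordFactor ℕ.* suc ⌊log₂ n ⌋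

  field
    arrange   : ∀ {n d} → Input n d → Input n d
    arrange-↭ : ∀ {n d} (S : Input n d) → toList (arrange S) ↭ toList S
    auxiliary : ∀ {n d} → Input n d → Memory (wordSize n)
    query     : Prog

  memory : ∀ {n d} → Input n d → Memory (wordSize n)
  memory S = List.map (λ u → word (code u)) (toList (arrange S)) ++ auxiliary S

  start : ∀ n {d} → BitVec d → Regs (wordSize n)
  start n {d} v 0 = word (code v)
  start n {d} v 1 = word n
  start n {d} v 2 = word d
  start n {d} v _ = word 0

  -- The n words that hold the input set itself are not charged: for c < 2 the
  -- bound n ^ (c - 1 + ε) can be smaller than n.  For c ≥ 2 they are dominated.
  space : ∀ {n d} → Input n d → ℕ
  space S = length (auxiliary S)

open OVIndex public

-- The query program answers "yes" by a nonzero value in register 0.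
AnswersIn : ∀ (D : OVIndex) {n d} → Input n d → BitVec d → ℕ → Set
AnswersIn D {n} S v t = ∃[ ρ ]
  (memory D S ⊢ query D , start D n v ⇓[ t ] ρ) ×
  (value (ρ 0) ≢ 0 ⇔ Any (λ u → Orthogonal u v) S)

QueryTime : Set
QueryTime = ∀ n d → Input n d → BitVec d → ℕ

-- The semantics is deterministic, so T is the running time of D.
Solves : OVIndex → ℝ → QueryTime → Set
Solves D c T = ∀ n d .{{_ : NonZero n}} → d ≈ c log₂ n →
  ∀ (S : Input n d) (v : BitVec d) → AnswersIn D S v (T n d S v)

SpaceO : OVIndex → ℝ → ℝ → Set
SpaceO D c r = ∃[ C ] ∃[ n₀ ] ∀ n d .{{_ : NonZero n}} → n₀ ℕ.≤ n → d ≈ c log₂ n →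
  ∀ (S : Input n d) → fromℕ (space D S) ≤ C · n ^ᵣ r

-- Only the input is random; the bound is uniform over the queries.
ExpectedTimeO : QueryTime → ℝ → ℝ → Set
ExpectedTimeO T c r = ∃[ C ] ∃[ n₀ ] ∀ n d .{{_ : NonZero n}} → n₀ ℕ.≤ n → d ≈ c log₂ n →
  ∀ (v : BitVec d) → 𝔼 n d (λ S → T n d S v) ≤ C · n ^ᵣ r

TrulySublinearExpected : QueryTime → ℝ → Set
TrulySublinearExpected T c = ∃[ δ ] (0ᵣ <ᵣ δ) × ExpectedTimeO T c (1ᵣ -ᵣ δ)

{-# OPTIONS --safe #-}

-- Let L = ⌊log n⌋ and call a query light if fewer than about δ L of its top L
-- bits are 1.  There are only n^(c - 1 + ε) light queries, where ε → 0 as δ → 0,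
-- so their answers are tabulated.  For a heavy query v, let q be its top bits:
-- only n^(1 - δ) of the prefixes are orthogonal to q, and as a random vector has
-- such a prefix with probability n^(-δ), only n^(1 - δ) vectors of S are expected
-- to have one.  With S sorted, these are all that has to be inspected: from a
-- candidate y, orthogonal to v, a binary search finds the next u ≥ y in S, and
-- the next candidate is the least y′ ≥ u that is orthogonal to v.

module Submission where

open import Defs
open import Data.Product.Base using (_×_; ∃-syntax; _,_; proj₁; proj₂; map₂)

import Algebra.Definitions.RawSemiring
open import Data.Bool.Base using (Bool; true; false; if_then_else_; _∧_)
import Data.Bool.Properties as Bool
open import Data.Fin.Base using (zero; suc)
open import Data.Fin.Properties using (toℕ-fromℕ<; toℕ<n)
import Data.Integer.Base as ℤ
import Data.Integer.Properties as ℤ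
open import Data.List.Base as List using (List; []; _∷_; _++_; length; map; upTo; filterᵇ)
open import Data.List.Membership.Propositional using (_∈_; find; lose)
open import Data.List.Membership.Propositional.Properties
  using (∈-map⁺; ∈-map⁻; ∈-filter⁺; ∈-filter⁻; ∈-upTo⁺; ∈-upTo⁻)
open import Data.List.Properties
  using (length-map; map-++; map-∘; length-filter; length-upTo; upTo-∷ʳ)
open import Data.List.Relation.Binary.Permutation.Propositional as Perm
  using (_↭_; ↭-refl; ↭-sym; ↭-trans)
open import Data.List.Relation.Binary.Permutation.Propositional.Properties
  using (All-resp-↭; ∈-resp-↭; map⁺)
open import Data.List.Relation.Unary.All as All using (All; []; _∷_)
import Data.List.Relation.Unary.All.Properties as All
open import Data.List.Relation.Unary.AllPairs using (AllPairs; []; _∷_)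
import Data.List.Relation.Unary.AllPairs.Properties as AllPairs
open import Data.List.Relation.Unary.Any as ListAny using (here; there)
open import Data.Nat.Base as ℕ
open import Data.Nat.Divisibility using (divides)
open import Data.Nat.DivMod hiding (_div_; _mod_)
open import Data.Nat.Induction using (<-wellFounded)
open import Data.Nat.ListAction using (sum)
open import Data.Nat.ListAction.Properties using (sum-++)
open import Data.Nat.Logarithm
open import Data.Nat.Logarithm.Core using (⌊log2⌋)
open import Data.Nat.Properties as ℕ
open import Data.Nat.Tactic.RingSolver using (solve-∀)
open import Data.Rational.Base as ℚ using (ℚ; mkℚ; 0ℚ; 1ℚ; ½; ↥_; ↧ₙ_)
import Data.Rational.Properties as ℚ
open import Data.Rational.Solver using (module +-*-Solver)
open import Data.Rational.Unnormalised.Base as ℚᵘ using (mkℚᵘ; *≤*)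
import Data.Rational.Unnormalised.Properties as ℚᵘ
open import Data.Sum.Base using (inj₁; inj₂)
open import Data.Vec.Base using (Vec; []; _∷_; toList)
open import Data.Vec.Properties using (length-toList)
import Data.Vec.Relation.Unary.Any as VecAny
import Data.Vec.Relation.Unary.Any.Properties as VecAny
open import Function.Base using (_∘_)
open import Function.Bundles using (_⇔_; mk⇔)
open import Function.Construct.Composition using (_⇔-∘_)
open import Induction.WellFounded using (Acc; acc)
open import Relation.Binary.PropositionalEquality
open import Relation.Nullary using (¬_; yes; no; contradiction; Dec)

open Algebra.Definitions.RawSemiring ℚ.+-*-rawSemiring using () renaming (_^_ to _^ℚ_)

-- The word RAM on natural numbers

-- A query cannot write to memory and has a fixed number of registers, so the prefixes orthogonal to
-- it are never listed: each candidate is computed from the last vector found, in one pass over the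
-- bits with a carry. Such a pass and the binary search cost a logarithmic factor, which has to be
-- paid out of the saving; therefore a heavy query is required to save `2 ^ (2 * (⌊log₂ n ⌋ / E))`,
-- of which one half of the exponent pays and the other is the gain, and `δ` is `1 / E`. The bits of
-- a light query below the top `⌊log₂ n ⌋` are arbitrary, which gives the exponent `c - 1`; the
-- choice of the top bits may contribute no more than `n ^ ε`, and this determines how large `E`
-- must be. Real exponents are approached through fractions above them, so that every estimate
-- becomes an inequality between powers of natural numbers with the denominators cleared.

get : List ℕ → ℕ → ℕ
get []       _       = 0
get (x ∷ _)  zero    = x
get (_ ∷ xs) (suc i) = get xs i

set : List ℕ → ℕ → ℕ → List ℕ
set []       zero    x = x ∷ []
set []       (suc r) x = 0 ∷ set [] r x
set (_ ∷ xs) zero    x = x ∷ xs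
set (y ∷ xs) (suc r) x = y ∷ set xs r x

get-set : ∀ σ r x s → get (set σ r x) s ≡ (if s ≡ᵇ r then x else get σ s)
get-set []      zero    x zero    = refl
get-set []      zero    x (suc s) = refl
get-set []      (suc r) x zero    = refl
get-set []      (suc r) x (suc s) = get-set [] r x s
get-set (y ∷ σ) zero    x zero    = refl
get-set (y ∷ σ) zero    x (suc s) = refl
get-set (y ∷ σ) (suc r) x zero    = refl
get-set (y ∷ σ) (suc r) x (suc s) = get-set σ r x s

execute : Reg → Reg → Op → Reg → List ℕ → List ℕ
execute r a o b σ = set σ r (⟦ o ⟧ (get σ a) (get σ b))

value-word : ∀ {w x} → x < 2 ^ w → value (word {w} x) ≡ x
value-word {w} {x} x<2^w =
  trans (toℕ-fromℕ< (m%n<n x (2 ^ w) {{m^n≢0 2 w}})) (m<n⇒m%n≡m {{m^n≢0 2 w}} x<2^w)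

value<2^w : ∀ {w} (x : Word w) → value x < 2 ^ w
value<2^w (mkWord x) = toℕ<n x

cell-word : ∀ {w} {xs} → All (_< 2 ^ w) xs → ∀ a → value (cell {w} (List.map word xs) a) ≡ get xs a
cell-word {w} []         a       = value-word {w} (m^n>0 2 w)
cell-word {w} (x<W ∷ _)  zero    = value-word {w} x<W
cell-word     (_ ∷ xs<W) (suc a) = cell-word xs<W a

-- Programs whose intermediate results all fit in a word run on registers and
-- memory that hold natural numbers; registers beyond the list hold 0.
module Machine {w} (m : Memory w) (μ : ℕ → ℕ) (m≈μ : ∀ a → value (cell m a) ≡ μ a) where

  load : Reg → Reg → List ℕ → List ℕ
  load r a σ = set σ r (μ (get σ a))

  infix 3 _~_

  _~_ : Regs w → List ℕ → Set
  ρ ~ σ = ∀ r → value (ρ r) ≡ get σ r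

  -- An upper bound on the steps, instead of their exact number, lets both arms of a conditional
  -- share one `b`. The final registers are a list that Agda computes, so a program is verified by
  -- replaying its instructions.
  record Run (p : Prog) (σ : List ℕ) (b : ℕ) (σ′ : List ℕ) : Set where
    constructor mkRun
    field
      run : ∀ {ρ} → ρ ~ σ → ∃[ t ] ∃[ ρ′ ] (m ⊢ p , ρ ⇓[ t ] ρ′) × t ≤ b × ρ′ ~ σ′

  open Run public

  ~-set : ∀ {ρ} σ r {x y} → ρ ~ σ → value x ≡ y → ρ [ r ↦ x ] ~ set σ r y
  ~-set σ r {x} {y} ρ~σ x≡y s rewrite get-set σ r y s with s ≡ᵇ r
  ... | true  = x≡y
  ... | false = ρ~σ s

  get< : ∀ {ρ} σ → ρ ~ σ → ∀ r → get σ r < 2 ^ w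
  get< {ρ} σ ρ~σ r = subst (_< 2 ^ w) (ρ~σ r) (value<2^w (ρ r))

  -- The bound may assume `ρ ~ σ`, by which the operands are words: `sub`, `div` and `mod` never
  -- exceed their left operand and so fit without a hypothesis.
  run-op : ∀ {r a b σ} o → (∀ ρ → ρ ~ σ → ⟦ o ⟧ (get σ a) (get σ b) < 2 ^ w) →
           Run (r ≔ a ⟨ o ⟩ b) σ 1 (execute r a o b σ)
  run-op {r} {a} {b} {σ} o bounded .run ρ~σ =
    1 , _ , ⇓op , ≤-refl ,
    ~-set σ r ρ~σ (trans (cong₂ (λ x y → value (word {w} (⟦ o ⟧ x y))) (ρ~σ a) (ρ~σ b))
                       (value-word {w} (bounded _ ρ~σ)))

  run-const : ∀ {r k σ} → k < 2 ^ w → Run (r ≔# k) σ 1 (set σ r k)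
  run-const {r} {σ = σ} k<W .run ρ~σ = 1 , _ , ⇓const , ≤-refl , ~-set σ r ρ~σ (value-word {w} k<W)

  run-add : ∀ {r a b σ} → get σ a + get σ b < 2 ^ w →
            Run (r ≔ a ⟨ add ⟩ b) σ 1 (execute r a add b σ)
  run-add bounded = run-op add (λ _ _ → bounded)

  run-mul : ∀ {r a b σ} → get σ a * get σ b < 2 ^ w →
            Run (r ≔ a ⟨ mul ⟩ b) σ 1 (execute r a mul b σ)
  run-mul bounded = run-op mul (λ _ _ → bounded)

  run-sub : ∀ {r a b σ} → Run (r ≔ a ⟨ sub ⟩ b) σ 1 (execute r a sub b σ)
  run-sub {a = a} {b} {σ} =
    run-op sub (λ _ ρ~σ → ≤-<-trans (m∸n≤m (get σ a) (get σ b)) (get< σ ρ~σ a))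

  run-div : ∀ {r a b σ} → Run (r ≔ a ⟨ div ⟩ b) σ 1 (execute r a div b σ)
  run-div {a = a} {b} {σ} = run-op div bounded
    where
    bounded : ∀ ρ → ρ ~ σ → ⟦ div ⟧ (get σ a) (get σ b) < 2 ^ w
    bounded _ ρ~σ with get σ b
    ... | zero  = m^n>0 2 w
    ... | suc y = ≤-<-trans (m/n≤m (get σ a) (suc y)) (get< σ ρ~σ a)

  run-mod : ∀ {r a b σ} → Run (r ≔ a ⟨ mod ⟩ b) σ 1 (execute r a mod b σ)
  run-mod {a = a} {b} {σ} = run-op mod bounded
    where
    bounded : ∀ ρ → ρ ~ σ → ⟦ mod ⟧ (get σ a) (get σ b) < 2 ^ w
    bounded _ ρ~σ with get σ b
    ... | zero  = m^n>0 2 w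
    ... | suc y = ≤-<-trans (m%n≤m (get σ a) (suc y)) (get< σ ρ~σ a)

  run-load : ∀ {r a σ} → Run (r ≔mem[ a ]) σ 1 (load r a σ)
  run-load {r} {a} {σ} .run ρ~σ =
    1 , _ , ⇓load , ≤-refl ,
    ~-set σ r ρ~σ (trans (m≈μ _) (cong μ (ρ~σ a)))

  run-skip : ∀ {σ} → Run skip σ 0 σ
  run-skip .run ρ~σ = 0 , _ , ⇓skip , ≤-refl , ρ~σ

  infixr 5 _▸_

  _▸_ : ∀ {p q σ σ′ σ″ b c} → Run p σ b σ′ → Run q σ′ c σ″ → Run (p ⨾ q) σ (b + c) σ″
  (p⇓ ▸ q⇓) .run ρ~σ with p⇓ .run ρ~σ
  ... | t , _ , d , t≤b , ρ~σ′ with q⇓ .run ρ~σ′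
  ...   | u , _ , e , u≤c , ρ~σ″ = t + u , _ , ⇓seq d e , +-mono-≤ t≤b u≤c , ρ~σ″

  run-then : ∀ {r p q σ σ′ b} → get σ r ≢ 0 → Run p σ b σ′ → Run (ifnz r p q) σ (suc b) σ′
  run-then {r} r≢0 p⇓ .run ρ~σ with p⇓ .run ρ~σ
  ... | t , _ , d , t≤b , ρ~σ′ =
    suc t , _ , ⇓then (r≢0 ∘ trans (sym (ρ~σ r))) d , s≤s t≤b , ρ~σ′

  run-else : ∀ {r p q σ σ′ b} → get σ r ≡ 0 → Run q σ b σ′ → Run (ifnz r p q) σ (suc b) σ′
  run-else {r} r≡0 q⇓ .run ρ~σ with q⇓ .run ρ~σ
  ... | t , _ , d , t≤b , ρ~σ′ = suc t , _ , ⇓else (trans (ρ~σ r) r≡0) d , s≤s t≤b , ρ~σ′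

  run-stop : ∀ {r p σ} → get σ r ≡ 0 → Run (whilenz r p) σ 1 σ
  run-stop {r} r≡0 .run ρ~σ = 1 , _ , ⇓stop (trans (ρ~σ r) r≡0) , ≤-refl , ρ~σ

  run-repeat : ∀ {r p σ σ′ σ″ b c} → get σ r ≢ 0 → Run p σ b σ′ → Run (whilenz r p) σ′ c σ″ →
               Run (whilenz r p) σ (suc (b + c)) σ″
  run-repeat {r} r≢0 p⇓ w⇓ .run ρ~σ with p⇓ .run ρ~σ
  ... | t , _ , d , t≤b , ρ~σ′ with w⇓ .run ρ~σ′
  ...   | u , _ , e , u≤c , ρ~σ″ =
    suc (t + u) , _ , ⇓repeat (r≢0 ∘ trans (sym (ρ~σ r))) d e , s≤s (+-mono-≤ t≤b u≤c) , ρ~σ″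

  run-within : ∀ {p σ σ′ b c} → b ≤ c → Run p σ b σ′ → Run p σ c σ′
  run-within b≤c p⇓ .run ρ~σ with p⇓ .run ρ~σ
  ... | t , _ , d , t≤b , ρ~σ′ = t , _ , d , ≤-trans t≤b b≤c , ρ~σ′

-- Orthogonality of binary numbers

[b+2x]%2≡b : ∀ {b} → b < 2 → ∀ x → (b + 2 * x) % 2 ≡ b
[b+2x]%2≡b {b} b<2 x rewrite *-comm 2 x = trans ([m+kn]%n≡m%n b x 2) (m<n⇒m%n≡m b<2)

[b+2x]/2≡x : ∀ {b} → b < 2 → ∀ x → (b + 2 * x) / 2 ≡ x
[b+2x]/2≡x {b} b<2 x rewrite *-comm 2 x =
  trans (+-distrib-/-∣ʳ b (divides x refl))
        (cong₂ _+_ (m<n⇒m/n≡0 b<2) (m*n/n≡m x 2))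

[x+2y]%2≡x%2 : ∀ x y → (x + 2 * y) % 2 ≡ x % 2
[x+2y]%2≡x%2 x y rewrite *-comm 2 y = [m+kn]%n≡m%n x y 2

[x+2y]/2≡x/2+y : ∀ x y → (x + 2 * y) / 2 ≡ x / 2 + y
[x+2y]/2≡x/2+y x y rewrite *-comm 2 y =
  trans (+-distrib-/-∣ʳ x (divides y refl)) (cong (x / 2 +_) (m*n/n≡m y 2))

x≡x%2+2[x/2] : ∀ x → x ≡ x % 2 + 2 * (x / 2)
x≡x%2+2[x/2] x = trans (m≡m%n+[m/n]*n x 2) (cong (x % 2 +_) (*-comm (x / 2) 2))

x<2y⇒x/2<y : ∀ {x y} → x < 2 * y → x / 2 < y
x<2y⇒x/2<y {x} {y} x<2y = m<n*o⇒m/o<n (subst (x <_) (*-comm 2 y) x<2y)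

orth : ℕ → ℕ → ℕ → Bool
orth zero    x v = true
orth (suc d) x v = (x % 2 * (v % 2) ≡ᵇ 0) ∧ orth d (x / 2) (v / 2)

∧-swap : ∀ p q r → p ∧ (q ∧ r) ≡ q ∧ (p ∧ r)
∧-swap p q r = trans (sym (Bool.∧-assoc p q r)) (trans (cong (_∧ r) (Bool.∧-comm p q)) (Bool.∧-assoc q p r))

double : ∀ c m → c * (2 * m) ≡ 2 * (c * m)
double = solve-∀

-- `orth` consumes bits from the bottom, while the next candidate is built by adding bits at the
-- top; this unfolds `orth` at that end.
orth-snoc : ∀ {x v b a} i → x < 2 ^ i → v < 2 ^ i → b < 2 → a < 2 →
            orth (suc i) (x + b * 2 ^ i) (v + a * 2 ^ i) ≡ (b * a ≡ᵇ 0) ∧ orth i x v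
orth-snoc {zero} {zero} {b} {a} zero _ _ b<2 a<2
  rewrite *-identityʳ b | *-identityʳ a | m<n⇒m%n≡m b<2 | m<n⇒m%n≡m a<2 = refl
orth-snoc {suc x} zero (s≤s ()) _ _ _
orth-snoc {zero} {suc v} zero _ (s≤s ()) _ _
orth-snoc {x} {v} {b} {a} (suc i) x< v< b<2 a<2
  rewrite double b (2 ^ i) | double a (2 ^ i)
  | [x+2y]%2≡x%2 x (b * 2 ^ i) | [x+2y]%2≡x%2 v (a * 2 ^ i)
  | [x+2y]/2≡x/2+y x (b * 2 ^ i) | [x+2y]/2≡x/2+y v (a * 2 ^ i)
  | orth-snoc i (x<2y⇒x/2<y x<) (x<2y⇒x/2<y v<) b<2 a<2
  = ∧-swap (x % 2 * (v % 2) ≡ᵇ 0) (b * a ≡ᵇ 0) (orth i (x / 2) (v / 2))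

orth-0 : ∀ i v → orth i 0 v ≡ true
orth-0 zero    v = refl
orth-0 (suc i) v = orth-0 i (v / 2)

-- y is the least number ≥ u with y ⟂ v, or the sentinel 2 ^ i if there is none
-- below it; in the bit-by-bit computation the sentinel acts as a carry.
record IsNext (i u v y : ℕ) : Set where
  field
    above      : u ≤ y
    below      : y ≤ 2 ^ i
    orthogonal : y < 2 ^ i → orth i y v ≡ true
    least      : ∀ {x} → u ≤ x → x < y → orth i x v ≡ false

open IsNext

-- Where the query has a 0, bit `i` of a candidate is free, so the bit of `u` is simply added to the
-- result for the lower bits.
next-zeroBit : ∀ {u i v b y} → u < 2 ^ i → v < 2 ^ i → b < 2 → IsNext i u v y →
               IsNext (suc i) (u + b * 2 ^ i) (v + 0 * 2 ^ i) (y + b * 2 ^ i)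
next-zeroBit {u} {i} {v} {b} {y} u< v< b<2 N = record
  { above      = +-monoˡ-≤ (b * 2 ^ i) (N .above)
  ; below      = +-mono-≤ (N .below) (*-monoˡ-≤ (2 ^ i) (≤-pred b<2))
  ; orthogonal = orthogonal′ b b<2
  ; least      = least′
  }
  where
  orthogonal′ : ∀ b → b < 2 → y + b * 2 ^ i < 2 ^ suc i →
                orth (suc i) (y + b * 2 ^ i) (v + 0 * 2 ^ i) ≡ true
  orthogonal′ b b<2 y< with y <? 2 ^ i
  ... | yes y<2^i rewrite orth-snoc {y} {v} {b} {0} i y<2^i v< b<2 z<s | *-zeroʳ b = N .orthogonal y<2^i
  -- Here `y` is the sentinel `2 ^ i`. For `b ≡ 0` it carries into bit `i` over zero low bits, which
  -- is orthogonal because the query has 0 there; for `b ≡ 1` the sum is the new sentinel.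
  ... | no  y≮2^i with ≤-antisym (N .below) (≮⇒≥ y≮2^i)
  orthogonal′ 0 b<2 y< | no y≮2^i | refl =
    trans (orth-snoc {0} {v} {1} {0} i (m^n>0 2 i) v< (s<s z<s) z<s) (orth-0 i v)
  orthogonal′ 1 b<2 y< | no y≮2^i | refl = contradiction y< (<-irrefl refl)
  orthogonal′ (suc (suc b)) (s<s (s<s ())) y< | no y≮2^i | refl
  least′ : ∀ {x} → u + b * 2 ^ i ≤ x → x < y + b * 2 ^ i →
           orth (suc i) x (v + 0 * 2 ^ i) ≡ false
  least′ {x} u≤x x<y = subst (λ z → orth (suc i) z (v + 0 * 2 ^ i) ≡ false) x′+
    (trans (orth-snoc {x′} {v} {b} {0} i (<-≤-trans x′<y (N .below)) v< b<2 z<s)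
           (trans (cong (λ z → (z ≡ᵇ 0) ∧ orth i x′ v) (*-zeroʳ b)) (N .least u≤x′ x′<y)))
    where
    x′ = x ∸ b * 2 ^ i
    x′+ : x′ + b * 2 ^ i ≡ x
    x′+ = m∸n+n≡m (≤-trans (m≤n+m _ u) u≤x)
    x′<y : x′ < y
    x′<y = +-cancelʳ-< (b * 2 ^ i) x′ y (subst (_< y + b * 2 ^ i) (sym x′+) x<y)
    u≤x′ : u ≤ x′
    u≤x′ = +-cancelʳ-≤ (b * 2 ^ i) u x′ (subst (u + b * 2 ^ i ≤_) (sym x′+) u≤x)

-- Where the query has a 1, numbers with bit `i` set fail at that bit. Numbers below `2 ^ i` are too
-- small if `b ≡ 1`; if `b ≡ 0`, the carry means that `y` is the sentinel, so none of them is
-- orthogonal either.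
next-oneBit-carry : ∀ {u i v b y} → u < 2 ^ i → v < 2 ^ i → b < 2 → IsNext i u v y → 2 ^ i ≤ y + b * 2 ^ i →
                    IsNext (suc i) (u + b * 2 ^ i) (v + 1 * 2 ^ i) (2 ^ i + 2 ^ i)
next-oneBit-carry {u} {i} {v} {b} {y} u< v< b<2 N carry = record
  { above      = +-mono-≤ (<⇒≤ u<) (≤-trans (*-monoˡ-≤ (2 ^ i) (≤-pred b<2)) (≤-reflexive (+-identityʳ _)))
  ; below      = ≤-reflexive (cong (2 ^ i +_) (sym (+-identityʳ _)))
  ; orthogonal = λ y< → contradiction (subst (2 ^ i + 2 ^ i <_) (cong (2 ^ i +_) (+-identityʳ _)) y<) (<-irrefl refl)
  ; least      = λ {x} → least′ x
  }
  where
  least′ : ∀ x → u + b * 2 ^ i ≤ x → x < 2 ^ i + 2 ^ i → orth (suc i) x (v + 1 * 2 ^ i) ≡ false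
  least′ x u≤x x< with x <? 2 ^ i
  ... | no x≮2^i = subst (λ z → orth (suc i) z (v + 1 * 2 ^ i) ≡ false) x′+
                     (orth-snoc {x′} {v} {1} {1} i x′< v< (s<s z<s) (s<s z<s))
    where
    x′ = x ∸ 1 * 2 ^ i
    x′+ : x′ + 1 * 2 ^ i ≡ x
    x′+ = m∸n+n≡m (subst (_≤ x) (sym (+-identityʳ (2 ^ i))) (≮⇒≥ x≮2^i))
    x′< : x′ < 2 ^ i
    x′< = +-cancelʳ-< (1 * 2 ^ i) x′ (2 ^ i)
            (subst₂ _<_ (sym x′+) (cong (2 ^ i +_) (sym (+-identityʳ (2 ^ i)))) x<)
  ... | yes x<2^i = least″ b u≤x carry
    where
    least″ : ∀ b → u + b * 2 ^ i ≤ x → 2 ^ i ≤ y + b * 2 ^ i → orth (suc i) x (v + 1 * 2 ^ i) ≡ false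
    least″ zero u≤x carry =
      trans (cong (λ z → orth (suc i) z (v + 1 * 2 ^ i)) (sym (+-identityʳ x)))
      (trans (orth-snoc {x} {v} {0} {1} i x<2^i v< z<s (s<s z<s))
             (N .least (subst (_≤ x) (+-identityʳ u) u≤x)
                       (<-≤-trans x<2^i (subst (2 ^ i ≤_) (+-identityʳ y) carry))))
    least″ (suc b) u≤x carry =
      contradiction x<2^i (≤⇒≯ (≤-trans (≤-trans (m≤m+n (2 ^ i) (b * 2 ^ i)) (m≤n+m _ u)) u≤x))

next-oneBit : ∀ {u i v b y} → u < 2 ^ i → v < 2 ^ i → b < 2 → IsNext i u v y → y + b * 2 ^ i < 2 ^ i →
              IsNext (suc i) (u + b * 2 ^ i) (v + 1 * 2 ^ i) (y + b * 2 ^ i)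
next-oneBit {u} {i} {v} {zero} {y} u< v< b<2 N y< rewrite +-identityʳ y | +-identityʳ u = record
  { above      = N .above
  ; below      = ≤-trans (N .below) (m≤m+n _ _)
  ; orthogonal = λ _ → trans (snoc y<) (N .orthogonal y<)
  ; least      = λ u≤x x<y → trans (snoc (<-trans x<y y<)) (N .least u≤x x<y)
  }
  where
  snoc : ∀ {x} → x < 2 ^ i → orth (suc i) x (v + 1 * 2 ^ i) ≡ orth i x v
  snoc {x} x< = trans (cong (λ z → orth (suc i) z (v + 1 * 2 ^ i)) (sym (+-identityʳ x)))
                      (orth-snoc {x} {v} {0} {1} i x< v< z<s (s<s z<s))
next-oneBit {u} {i} {v} {suc b} {y} u< v< b<2 N y< =
  contradiction y< (≤⇒≯ (≤-trans (m≤m+n (2 ^ i) (b * 2 ^ i)) (m≤n+m _ y)))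

-- The query program

-- Registers: 0 the query and finally the answer, 1 n, 2 d, 3 and 4 the
-- constants 1 and 2, 5 the first step of a binary search, 6 and 7 address and
-- length of the searched segment, 8 the key, 9 the offset found, 10 the step,
-- 11 and 12 temporaries, 13 the constant 0, 14 a vector u of the input, 17 the
-- least y ≥ u orthogonal to the query, 15, 16, 18 and 19 the rest of u and of
-- the query, the current power of two and a counter in the computation of y,
-- 20 whether to continue.

searchStep search shift nextStep next scanStep scan setup probe queryProgram : Prog

-- `x < y` is tested by whether the truncated difference `y - x` is nonzero, and subtracting
-- register 13, which holds 0, is a move.
searchStep =
  11 ≔ 9 ⟨ add ⟩ 10 ⨾
  12 ≔ 11 ⟨ sub ⟩ 7 ⨾
  ifnz 12 skip
    ( 12 ≔ 6 ⟨ add ⟩ 11 ⨾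
      12 ≔ 12 ⟨ sub ⟩ 3 ⨾
      12 ≔mem[ 12 ] ⨾
      12 ≔ 8 ⟨ sub ⟩ 12 ⨾
      ifnz 12 (9 ≔ 11 ⟨ sub ⟩ 13) skip ) ⨾
  10 ≔ 10 ⟨ div ⟩ 4

search =
  9 ≔# 0 ⨾
  10 ≔ 5 ⟨ sub ⟩ 13 ⨾
  whilenz 10 searchStep

shift =
  15 ≔ 15 ⟨ div ⟩ 4 ⨾
  16 ≔ 16 ⟨ div ⟩ 4 ⨾
  18 ≔ 18 ⟨ add ⟩ 18 ⨾
  19 ≔ 19 ⟨ sub ⟩ 3

nextStep =
  11 ≔ 15 ⟨ mod ⟩ 4 ⨾
  11 ≔ 11 ⟨ mul ⟩ 18 ⨾
  17 ≔ 17 ⟨ add ⟩ 11 ⨾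
  12 ≔ 16 ⟨ mod ⟩ 4 ⨾
  ifnz 12
    ( 12 ≔ 18 ⟨ sub ⟩ 17 ⨾
      ifnz 12 skip (17 ≔ 18 ⟨ add ⟩ 18) )
    skip ⨾
  shift

next =
  15 ≔ 14 ⟨ sub ⟩ 13 ⨾
  16 ≔ 0 ⟨ sub ⟩ 13 ⨾
  17 ≔# 0 ⨾
  18 ≔# 1 ⨾
  19 ≔ 2 ⟨ sub ⟩ 13 ⨾
  whilenz 19 nextStep

scanStep =
  6 ≔# 0 ⨾
  7 ≔ 1 ⟨ sub ⟩ 13 ⨾
  search ⨾
  11 ≔ 7 ⟨ sub ⟩ 9 ⨾
  ifnz 11
    ( 14 ≔mem[ 9 ] ⨾
      next ⨾
      11 ≔ 17 ⟨ sub ⟩ 14 ⨾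
      ifnz 11
        (8 ≔ 17 ⟨ sub ⟩ 13)
        (0 ≔# 1 ⨾ 20 ≔# 0) )
    (0 ≔# 0 ⨾ 20 ≔# 0)

scan =
  8 ≔# 0 ⨾
  20 ≔# 1 ⨾
  whilenz 20 scanStep

setup =
  3 ≔# 1 ⨾
  4 ≔# 2 ⨾
  5 ≔mem[ 1 ] ⨾
  11 ≔ 1 ⟨ add ⟩ 3 ⨾
  7 ≔mem[ 11 ] ⨾
  6 ≔ 11 ⟨ add ⟩ 3 ⨾
  8 ≔ 0 ⟨ mul ⟩ 4

probe =
  11 ≔ 6 ⟨ add ⟩ 9 ⨾
  12 ≔mem[ 11 ] ⨾
  12 ≔ 12 ⟨ sub ⟩ 8 ⨾
  11 ≔ 12 ⟨ div ⟩ 4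

queryProgram =
  setup ⨾
  search ⨾
  11 ≔ 7 ⟨ sub ⟩ 9 ⨾
  ifnz 11
    (probe ⨾ ifnz 11 scan (0 ≔ 12 ⟨ sub ⟩ 13))
    scan

-- Binary search, next candidate and scan: correctness and step counts

Monotonic : List ℕ → Set
Monotonic xs = ∀ {i j} → i ≤ j → j < length xs → get xs i ≤ get xs j

record IsLowerBound (xs : List ℕ) (key pos : ℕ) : Set where
  field
    inside : pos ≤ length xs
    before : ∀ {i} → i < pos → get xs i < key
    after  : ∀ {i} → pos ≤ i → i < length xs → key ≤ get xs i

open IsLowerBound public

-- 2 ^ (k - 1), rounded down.
half^ : ℕ → ℕ
half^ zero    = 0
half^ (suc k) = 2 ^ k

half^-/2 : ∀ k → half^ (suc k) / 2 ≡ half^ k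
half^-/2 zero    = refl
half^-/2 (suc k) = trans (cong (_/ 2) (*-comm 2 (2 ^ k))) (m*n/n≡m (2 ^ k) 2)

module Execution {w} (m : Memory w) (μ : ℕ → ℕ) (m≈μ : ∀ a → value (cell m a) ≡ μ a)
                 (v n d τ : ℕ) where

  open Machine m μ m≈μ public

  W = 2 ^ w

  st : (base len key pos step t x : ℕ) → List ℕ → List ℕ
  st base len key pos step t x rest =
    v ∷ n ∷ d ∷ 1 ∷ 2 ∷ 2 ^ τ ∷ base ∷ len ∷ key ∷ pos ∷ step ∷ t ∷ x ∷ 0 ∷ rest

  module Searching (xs : List ℕ) (mono : Monotonic xs) (base : ℕ)
                   (segment : ∀ {i} → i < length xs → μ (base + i) ≡ get xs i)
                   (addresses : base + length xs < W) (offsets : length xs + 2 ^ τ < W) where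

    len = length xs

    module Step {pos} k (k≤τ : k ≤ τ) (inside : pos ≤ len) where

      q = pos + 2 ^ k

      q< : q < W
      q< = ≤-<-trans (+-mono-≤ inside (^-monoʳ-≤ 2 k≤τ)) offsets

      1≤q : 1 ≤ q
      1≤q = ≤-trans (m^n>0 2 k) (m≤n+m _ pos)

      suc[q∸1]≡q : suc (q ∸ 1) ≡ q
      suc[q∸1]≡q = m+[n∸m]≡n 1≤q

      halve : ∀ {key pos t x rest} →
              Run (10 ≔ 10 ⟨ div ⟩ 4) (st base len key pos (2 ^ k) t x rest) 1
                  (st base len key pos (half^ k) t x rest)
      halve {key} {pos} {t} {x} {rest} =
        subst (λ z → Run (10 ≔ 10 ⟨ div ⟩ 4) (st base len key pos (2 ^ k) t x rest) 1
                         (st base len key pos z t x rest)) (half^-/2 k) run-div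

      bq< : q ≤ len → base + q < W
      bq< q≤len = ≤-<-trans (+-monoʳ-≤ base q≤len) addresses

      loaded : q ≤ len → μ (base + q ∸ 1) ≡ get xs (q ∸ 1)
      loaded q≤len = trans (cong μ (+-∸-assoc base 1≤q))
                           (segment (subst (_≤ len) (sym suc[q∸1]≡q) q≤len))

    -- By monotonicity one comparison, at position `pos + 2 ^ k - 1`, settles a whole side. The
    -- premise on `suc i` says that entries from position `pos + 2 ^ suc k - 1` on are at least the
    -- key; when the step has become 0, this is the lower bound property of `pos`.
    search-step : ∀ {key} k → k ≤ τ → ∀ {pos t x rest} →
      pos ≤ len → (∀ {i} → i < pos → get xs i < key) →
      (∀ {i} → pos + 2 ^ suc k ≤ suc i → i < len → key ≤ get xs i) →
      ∃[ pos′ ] ∃[ t′ ] ∃[ x′ ]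
        Run searchStep (st base len key pos (2 ^ k) t x rest) 10
                       (st base len key pos′ (half^ k) t′ x′ rest) ×
        pos′ ≤ len × (∀ {i} → i < pos′ → get xs i < key) ×
        (∀ {i} → pos′ + 2 ^ k ≤ suc i → i < len → key ≤ get xs i)
    search-step {key} k k≤τ {pos} {t} {x} {rest} inside before after
      with pos + 2 ^ k ≤? len
    ... | no  q≰len =
      pos , _ , _ ,
      run-within (m≤m+n 4 6)
        (run-add q< ▸ run-sub ▸ run-then (m>n⇒m∸n≢0 (≰⇒> q≰len)) run-skip ▸ halve) ,
      inside , before ,
      λ q≤si i<len → contradiction (≤-trans q≤si i<len) q≰len
      where open Step {pos} k k≤τ inside
    ... | yes q≤len with get xs (pos + 2 ^ k ∸ 1) <? key
    ...   | yes xq<key =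
      q , _ , _ ,
      (run-add q< ▸ run-sub ▸
       run-else (m≤n⇒m∸n≡0 q≤len)
         (run-add (bq< q≤len) ▸ run-sub ▸ run-load ▸ run-sub ▸
          run-then (λ e → m>n⇒m∸n≢0 xq<key (trans (cong (key ∸_) (sym (loaded q≤len))) e)) run-sub) ▸
       halve) ,
      q≤len ,
      (λ i<q → ≤-<-trans (mono (≤-pred (≤-trans i<q (≤-reflexive (sym suc[q∸1]≡q))))
                               (subst (_≤ len) (sym suc[q∸1]≡q) q≤len)) xq<key) ,
      λ q≤ → after (≤-trans (≤-reflexive (sym (twice pos (2 ^ k)))) q≤)
      where
      open Step {pos} k k≤τ inside
      twice : ∀ p s → p + s + s ≡ p + 2 * s
      twice = solve-∀
    ...   | no  xq≮key =
      pos , _ , _ ,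
      run-within (n≤1+n 9)
        (run-add q< ▸ run-sub ▸
         run-else (m≤n⇒m∸n≡0 q≤len)
           (run-add (bq< q≤len) ▸ run-sub ▸ run-load ▸ run-sub ▸
            run-else (trans (cong (key ∸_) (loaded q≤len)) (m≤n⇒m∸n≡0 (≮⇒≥ xq≮key))) run-skip) ▸
         halve) ,
      inside , before ,
      λ q≤si i<len → ≤-trans (≮⇒≥ xq≮key)
        (mono (≤-pred (≤-trans (≤-reflexive suc[q∸1]≡q) q≤si)) i<len)
      where open Step {pos} k k≤τ inside

    search-loop : ∀ {key} k → k ≤ suc τ → ∀ {pos t x rest} →
      pos ≤ len → (∀ {i} → i < pos → get xs i < key) →
      (∀ {i} → pos + 2 ^ k ≤ suc i → i < len → key ≤ get xs i) →
      ∃[ pos′ ] ∃[ t′ ] ∃[ x′ ]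
        Run (whilenz 10 searchStep) (st base len key pos (half^ k) t x rest) (k * 11 + 1)
                                    (st base len key pos′ 0 t′ x′ rest) ×
        IsLowerBound xs key pos′
    search-loop zero k≤ {pos} inside before after =
      pos , _ , _ , run-stop refl ,
      record { inside = inside ; before = before
             ; after  = λ p≤i → after (≤-trans (≤-reflexive (+-comm pos 1)) (s≤s p≤i)) }
    search-loop (suc k) (s≤s k≤τ) inside before after
      with search-step k k≤τ inside before after
    ... | _ , _ , _ , step , inside′ , before′ , after′
      with search-loop k (m≤n⇒m≤1+n k≤τ) inside′ before′ after′
    ...   | _ , _ , _ , loop , lower =
      _ , _ , _ , run-repeat (m^n≢0′ k) step loop , lower
      where
      m^n≢0′ : ∀ k → 2 ^ k ≢ 0
      m^n≢0′ k e = contradiction (m^n>0 2 k) (λ 0< → <-irrefl (sym e) 0<)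

    searchTime = 2 + (suc τ * 11 + 1)

    run-search : len < 2 ^ suc τ → 0 < W → ∀ {key pos step t x rest} →
      ∃[ pos′ ] ∃[ t′ ] ∃[ x′ ]
        Run search (st base len key pos step t x rest) searchTime
                   (st base len key pos′ 0 t′ x′ rest) ×
        IsLowerBound xs key pos′
    run-search len< 0<W
      with search-loop (suc τ) ≤-refl z≤n (λ ())
             -- The upper condition holds vacuously at the start, as `2 ^ suc τ` exceeds the length.
             (λ b≤si i<len → contradiction (≤-trans b≤si i<len) (<⇒≱ len<))
    ... | _ , _ , _ , loop , lower =
      _ , _ , _ , (run-const 0<W ▸ run-sub ▸ loop) , lower

module Stepping {w} (m : Memory w) (μ : ℕ → ℕ) (m≈μ : ∀ a → value (cell m a) ≡ μ a)
                (v n d τ : ℕ) (2^d<W : 2 ^ d < 2 ^ w) where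

  open Execution m μ m≈μ v n d τ

  nextTime : ℕ
  nextTime = 5 + (d * 13 + 1)

  module _ {base len key pos step u flag : ℕ} where

    ns : (t x uu vv y pw cnt : ℕ) → List ℕ
    ns t x uu vv y pw cnt =
      st base len key pos step t x (u ∷ uu ∷ vv ∷ y ∷ pw ∷ cnt ∷ flag ∷ [])

    next-step : ∀ {i} → i < d → ∀ {ul vl t x uu vv y cnt} →
      ul < 2 ^ i → vl < 2 ^ i → IsNext i ul vl y →
      ∃[ t′ ] ∃[ x′ ] ∃[ y′ ]
        Run nextStep (ns t x uu vv y (2 ^ i) (suc cnt)) 12
                     (ns t′ x′ (uu / 2) (vv / 2) y′ (2 ^ suc i) cnt) ×
        IsNext (suc i) (ul + uu % 2 * 2 ^ i) (vl + vv % 2 * 2 ^ i) y′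
    next-step {i} i<d {ul} {vl} {t} {x} {uu} {vv} {y} {cnt} ul< vl< N =
      split (vv % 2) refl (m%n<n vv 2)
      where
      b = uu % 2

      b2^i≤ : b * 2 ^ i ≤ 2 ^ i
      b2^i≤ = ≤-trans (*-monoˡ-≤ (2 ^ i) (≤-pred (m%n<n uu 2))) (≤-reflexive (+-identityʳ _))

      2^i+2^i≡ : 2 ^ i + 2 ^ i ≡ 2 ^ suc i
      2^i+2^i≡ = cong (2 ^ i +_) (sym (+-identityʳ _))

      2^i+2^i< : 2 ^ i + 2 ^ i < 2 ^ w
      2^i+2^i< = ≤-<-trans (≤-trans (≤-reflexive 2^i+2^i≡) (^-monoʳ-≤ 2 i<d)) 2^d<W

      mul< : b * 2 ^ i < 2 ^ w
      mul< = ≤-<-trans (≤-trans b2^i≤ (m≤m+n _ _)) 2^i+2^i<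

      add< : y + b * 2 ^ i < 2 ^ w
      add< = ≤-<-trans (+-mono-≤ (IsNext.below N) b2^i≤) 2^i+2^i<

      run-shift : ∀ {t x y} → Run shift (ns t x uu vv y (2 ^ i) (suc cnt)) 4
                                        (ns t x (uu / 2) (vv / 2) y (2 ^ suc i) cnt)
      run-shift {t} {x} {y} =
        subst (λ z → Run shift (ns t x uu vv y (2 ^ i) (suc cnt)) 4
                           (ns t x (uu / 2) (vv / 2) y z cnt)) 2^i+2^i≡
              (run-div ▸ run-div ▸ run-add 2^i+2^i< ▸ run-sub)

      split : ∀ a → vv % 2 ≡ a → a < 2 →
        ∃[ t′ ] ∃[ x′ ] ∃[ y′ ]
          Run nextStep (ns t x uu vv y (2 ^ i) (suc cnt)) 12
                       (ns t′ x′ (uu / 2) (vv / 2) y′ (2 ^ suc i) cnt) ×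
          IsNext (suc i) (ul + b * 2 ^ i) (vl + vv % 2 * 2 ^ i) y′
      split 0 a≡ _ =
        _ , _ , _ ,
        run-within (m≤m+n 9 3)
          (run-mod ▸ run-mul mul< ▸ run-add add< ▸ run-mod ▸ run-else a≡ run-skip ▸ run-shift) ,
        subst (λ a → IsNext (suc i) (ul + b * 2 ^ i) (vl + a * 2 ^ i) (y + b * 2 ^ i)) (sym a≡)
              (next-zeroBit ul< vl< (m%n<n uu 2) N)
      split 1 a≡ _ with y + b * 2 ^ i <? 2 ^ i
      ... | yes y< =
        _ , _ , _ ,
        run-within (m≤m+n 11 1)
          (run-mod ▸ run-mul mul< ▸ run-add add< ▸ run-mod ▸
           run-then (λ a≡0 → 1≢0 (trans (sym a≡) a≡0))
             (run-sub ▸ run-then (m>n⇒m∸n≢0 y<) run-skip) ▸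
           run-shift) ,
        subst (λ a → IsNext (suc i) (ul + b * 2 ^ i) (vl + a * 2 ^ i) (y + b * 2 ^ i)) (sym a≡)
              (next-oneBit ul< vl< (m%n<n uu 2) N y<)
        where 1≢0 : 1 ≢ 0
              1≢0 ()
      ... | no  y≮ =
        _ , _ , _ ,
        (run-mod ▸ run-mul mul< ▸ run-add add< ▸ run-mod ▸
         run-then (λ a≡0 → 1≢0 (trans (sym a≡) a≡0))
           (run-sub ▸ run-else (m≤n⇒m∸n≡0 (≮⇒≥ y≮)) (run-add 2^i+2^i<)) ▸
         run-shift) ,
        subst (λ a → IsNext (suc i) (ul + b * 2 ^ i) (vl + a * 2 ^ i) (2 ^ i + 2 ^ i)) (sym a≡)
              (next-oneBit-carry ul< vl< (m%n<n uu 2) N (≮⇒≥ y≮))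
        where 1≢0 : 1 ≢ 0
              1≢0 ()
      split (suc (suc _)) _ (s<s (s<s ()))

    peel : ∀ i l h → l + h * 2 ^ i ≡ (l + h % 2 * 2 ^ i) + h / 2 * 2 ^ suc i
    peel i l h = trans (cong (λ z → l + z * 2 ^ i) (x≡x%2+2[x/2] h)) (regroup l (h % 2) (h / 2) (2 ^ i))
      where
      regroup : ∀ l b q p → l + (b + 2 * q) * p ≡ (l + b * p) + q * (2 * p)
      regroup = solve-∀

    low< : ∀ i l h → l < 2 ^ i → l + h % 2 * 2 ^ i < 2 ^ suc i
    low< i l h l< = +-mono-<-≤ l< (*-monoˡ-≤ (2 ^ i) (≤-pred (m%n<n h 2)))

    remainder≡ : ∀ i l h {x} → x ≡ l + h * 2 ^ i → x < 2 ^ i → l ≡ x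
    remainder≡ i l zero    x≡ x< = sym (trans x≡ (+-identityʳ l))
    remainder≡ i l (suc h) x≡ x< =
      contradiction (subst (_< 2 ^ i) x≡ x<) (≤⇒≯ (≤-trans (m≤m+n (2 ^ i) (h * 2 ^ i)) (m≤n+m _ l)))

    -- `ul` and `vl` are the bits already consumed, `uu` and `vv` those left in registers 15 and 16.
    -- After `d` rounds the latter contribute nothing, since `u` and `v` are below `2 ^ d`.
    next-loop : ∀ k {i} → k + i ≡ d → ∀ {ul vl t x uu vv y} →
      u ≡ ul + uu * 2 ^ i → v ≡ vl + vv * 2 ^ i → u < 2 ^ d → v < 2 ^ d →
      ul < 2 ^ i → vl < 2 ^ i → IsNext i ul vl y →
      ∃[ t′ ] ∃[ x′ ] ∃[ uu′ ] ∃[ vv′ ] ∃[ y′ ] ∃[ pw′ ]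
        Run (whilenz 19 nextStep) (ns t x uu vv y (2 ^ i) k) (k * 13 + 1)
                                  (ns t′ x′ uu′ vv′ y′ pw′ 0) ×
        IsNext d u v y′
    next-loop zero {i} refl {ul} {vl} {uu = uu} {vv} {y} u≡ v≡ u< v< ul< vl< N =
      _ , _ , _ , _ , _ , _ , run-stop refl ,
      subst₂ (λ a b → IsNext d a b y) (remainder≡ i ul uu u≡ u<) (remainder≡ i vl vv v≡ v<) N
    next-loop (suc k) {i} k+i≡d {ul} {vl} {uu = uu} {vv} u≡ v≡ u< v< ul< vl< N
      with next-step (≤-trans (s≤s (m≤n+m i k)) (≤-reflexive k+i≡d)) ul< vl< N
    ... | _ , _ , _ , step , N′
      with next-loop k (trans (+-suc k i) k+i≡d)
             (trans u≡ (peel i ul uu)) (trans v≡ (peel i vl vv)) u< v<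
             (low< i ul uu ul<) (low< i vl vv vl<) N′
    ...   | _ , _ , _ , _ , _ , _ , loop , N″ =
      _ , _ , _ , _ , _ , _ , run-repeat (λ ()) step loop , N″

    run-next : u < 2 ^ d → v < 2 ^ d → ∀ {t x uu vv y pw cnt} →
      ∃[ t′ ] ∃[ x′ ] ∃[ uu′ ] ∃[ vv′ ] ∃[ y′ ] ∃[ pw′ ]
        Run next (ns t x uu vv y pw cnt) nextTime (ns t′ x′ uu′ vv′ y′ pw′ 0) ×
        IsNext d u v y′
    run-next u< v<
      with next-loop d {0} (+-identityʳ d) {0} {0} (sym (*-identityʳ u)) (sym (*-identityʳ v)) u< v<
             z<s z<s (record { above = z≤n ; below = z≤n ; orthogonal = λ _ → refl
                             ; least = λ _ () })
    ... | _ , _ , _ , _ , _ , _ , loop , N =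
      _ , _ , _ , _ , _ , _ ,
      (run-sub ▸ run-sub ▸ run-const (≤-trans z<s 2^d<W) ▸ run-const (≤-<-trans (m^n>0 2 d) 2^d<W) ▸
       run-sub ▸ loop) , N

Found : ℕ → List ℕ → ℕ → Set
Found d xs v = ∃[ i ] i < length xs × orth d (get xs i) v ≡ true

true≢false : true ≢ false
true≢false ()

module Scanning {w} (m : Memory w) (μ : ℕ → ℕ) (m≈μ : ∀ a → value (cell m a) ≡ μ a)
                (v d τ : ℕ) (xs : List ℕ) (mono : Monotonic xs)
                (segment : ∀ {i} → i < length xs → μ i ≡ get xs i)
                (xs< : ∀ {i} → i < length xs → get xs i < 2 ^ d) (v< : v < 2 ^ d)
                (2^d<W : 2 ^ d < 2 ^ w) (offsets : length xs + 2 ^ τ < 2 ^ w)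
                (len< : length xs < 2 ^ suc τ) where

  n = length xs

  open Execution m μ m≈μ v n d τ public
  open Searching xs mono 0 segment (≤-<-trans (m≤m+n _ _) offsets) offsets
    using (searchTime; run-search)
  open Stepping m μ m≈μ v n d τ 2^d<W using (nextTime; run-next)

  0<W : 0 < W
  0<W = m^n>0 2 w

  1<W : 1 < W
  1<W = ≤-<-trans (m^n>0 2 d) 2^d<W

  scanStepTime : ℕ
  scanStepTime = 1 + (1 + (searchTime + (1 + (2 + (nextTime + 4)))))

  -- The measure stays abstract: any quantity that is bounded by `B` and grows whenever the scan
  -- goes on limits the number of iterations. Growth is only demanded from a candidate that is
  -- orthogonal to the query.
  module Looping (D : ℕ → ℕ) (B : ℕ) (D≤B : ∀ {y} → y ≤ 2 ^ d → D y ≤ B)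
                 (progress : ∀ {y i y′} → orth d y v ≡ true → i < n → y ≤ get xs i →
                             IsNext d (get xs i) v y′ → get xs i < y′ → D y < D y′) where

    -- No orthogonal vector of the input lies below the candidate `key`. The candidate may be the
    -- sentinel `2 ^ d`; then the search finds nothing and the scan ends. `f` counts the growth that
    -- `D` still has left.
    scan-loop : ∀ f {key} → key ≤ 2 ^ d → (key < 2 ^ d → orth d key v ≡ true) →
      (∀ {i} → i < n → orth d (get xs i) v ≡ true → key ≤ get xs i) → B ≤ D key + f →
      ∀ {base len pos step t x u uu vv y pw cnt} →
      ∃[ σ ]
        Run (whilenz 20 scanStep)
            (st base len key pos step t x (u ∷ uu ∷ vv ∷ y ∷ pw ∷ cnt ∷ 1 ∷ []))
            (suc f * suc scanStepTime + 1) σ ×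
        (get σ 0 ≢ 0 ⇔ Found d xs v)
    scan-loop f {key} key≤ key-orth key-least B≤
      with run-search len< 0<W {key}
    ... | pos , _ , _ , search⇓ , lower with pos <? n
    ...   | no  pos≮n =
      _ ,
      run-within (+-monoˡ-≤ 1 (m≤m+n (suc scanStepTime) (f * suc scanStepTime)))
        (run-repeat (λ ())
          (run-const 0<W ▸ run-sub ▸ search⇓ ▸ run-sub ▸
           run-else (m≤n⇒m∸n≡0 (≮⇒≥ pos≮n))
             (run-within (s≤s (s≤s z≤n)) (run-const 0<W ▸ run-const 0<W)))
          (run-stop refl)) ,
      mk⇔ (λ 0≢0 → contradiction refl 0≢0)
          (λ (i , i<n , ⊥ᵢ) → contradiction (key-least i<n ⊥ᵢ)
                                  (<⇒≱ (lower .before (<-≤-trans i<n (≮⇒≥ pos≮n)))))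
    ...   | yes pos<n
      with run-next (subst (_< 2 ^ d) (sym (segment pos<n)) (xs< pos<n)) v<
    -- As the next candidate is never below `u`, the test `y ≤ u` asks whether `u` itself is
    -- orthogonal to the query.
    ... | _ , _ , _ , _ , y , _ , next⇓ , N with y ≤? μ pos
    ...   | yes y≤u =
      _ ,
      run-within (+-monoˡ-≤ 1 (m≤m+n (suc scanStepTime) (f * suc scanStepTime)))
        (run-repeat (λ ())
            (run-const 0<W ▸ run-sub ▸ search⇓ ▸ run-sub ▸
             run-then (m>n⇒m∸n≢0 pos<n)
               (run-load ▸ next⇓ ▸ run-sub ▸
                run-else (m≤n⇒m∸n≡0 y≤u) (run-const 1<W ▸ run-const 0<W)))
            (run-stop refl)) ,
      mk⇔ (λ _ → pos , pos<n ,
             trans (cong (λ z → orth d z v) (trans (sym (segment pos<n)) (sym y≡u)))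
                   (N .orthogonal (subst (_< 2 ^ d) (trans (sym (segment pos<n)) (sym y≡u)) (xs< pos<n))))
          (λ _ ())
      where
      y≡u : y ≡ μ pos
      y≡u = ≤-antisym y≤u (N .above)
    ...   | no  y≰u with subst (λ u → IsNext d u v y) (segment pos<n) N
                       | subst (_< y) (segment pos<n) (≰⇒> y≰u)
    ...     | N′ | u<y with progress (key-orth key<) pos<n key≤u N′ u<y
      where
      key≤u : key ≤ get xs pos
      key≤u = lower .after ≤-refl pos<n
      key< : key < 2 ^ d
      key< = ≤-<-trans key≤u (xs< pos<n)
    ... | D< with f
    ...   | zero = contradiction (≤-trans D< (D≤B (N .below))) (≤⇒≯ (subst (B ≤_) (+-identityʳ _) B≤))
    ...   | suc f′ with scan-loop f′ (N .below) (N .orthogonal) least′ B≤′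
      where
      B≤′ : B ≤ D y + f′
      B≤′ = ≤-trans B≤ (≤-trans (≤-reflexive (+-suc (D key) f′)) (+-monoˡ-≤ f′ D<))
      -- Entries before `pos` are below the old candidate, and entries from `pos` on that are below
      -- `y` were jumped over by the minimality of `y`.
      least′ : ∀ {i} → i < n → orth d (get xs i) v ≡ true → y ≤ get xs i
      least′ {i} i<n ⊥ᵢ with y ≤? get xs i
      ... | yes y≤ = y≤
      ... | no  y≰ with pos ≤? i
      ...   | yes pos≤i = contradiction (trans (sym ⊥ᵢ) (N′ .least (mono pos≤i i<n) (≰⇒> y≰))) true≢false
      ...   | no  pos≰i = contradiction (key-least i<n ⊥ᵢ) (<⇒≱ (lower .before (≰⇒> pos≰i)))
    ...     | _ , loop⇓ , answer =
      _ ,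
      run-within (≤-reflexive (sym (+-assoc (suc scanStepTime) (suc f′ * suc scanStepTime) 1)))
        (run-repeat (λ ())
          (run-const 0<W ▸ run-sub ▸ search⇓ ▸ run-sub ▸
           run-then (m>n⇒m∸n≢0 pos<n)
             (run-load ▸ next⇓ ▸ run-sub ▸
              run-then (m>n⇒m∸n≢0 (≰⇒> y≰u)) (run-within (s≤s z≤n) run-sub)))
          loop⇓) ,
      answer

    scanTime : ℕ
    scanTime = 2 + (suc B * suc scanStepTime + 1)

    run-scan : ∀ {base len key pos step t x u uu vv y pw cnt flag} →
      ∃[ σ ]
        Run scan (st base len key pos step t x (u ∷ uu ∷ vv ∷ y ∷ pw ∷ cnt ∷ flag ∷ [])) scanTime σ ×
        (get σ 0 ≢ 0 ⇔ Found d xs v)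
    -- The first candidate is 0, which is orthogonal to everything.
    run-scan with scan-loop B z≤n (λ _ → orth-0 d v) (λ _ _ → z≤n) (m≤n+m B (D 0))
    ... | _ , loop⇓ , answer = _ , (run-const 0<W ▸ run-const 1<W ▸ loop⇓) , answer

-- The memory layout and the table of light queries

get-++ˡ : ∀ xs {ys i} → i < length xs → get (xs ++ ys) i ≡ get xs i
get-++ˡ (x ∷ xs) {i = zero}  _         = refl
get-++ˡ (x ∷ xs) {i = suc i} (s<s i<n) = get-++ˡ xs i<n

get-++ʳ : ∀ xs {ys} i → get (xs ++ ys) (length xs + i) ≡ get ys i
get-++ʳ []       i = refl
get-++ʳ (x ∷ xs) i = get-++ʳ xs i

get-map : ∀ (f : ℕ → ℕ) xs {i} → i < length xs → get (List.map f xs) i ≡ f (get xs i)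
get-map f (x ∷ xs) {zero}  _         = refl
get-map f (x ∷ xs) {suc i} (s<s i<n) = get-map f xs i<n

StrictlyMonotonic : List ℕ → Set
StrictlyMonotonic xs = ∀ {i j} → i < j → j < length xs → get xs i < get xs j

-- Key and answer share a word, so that a search for `v * 2` meets the entry of `v` whichever its
-- answer is. The entry found exceeds `v * 2` by the answer bit if `v` is a key and by at least 2
-- otherwise; `probe` tells these apart by a division by 2.
table : (ℕ → ℕ) → List ℕ → List ℕ
table bit = List.map (λ x → x * 2 + bit x)

module Table (bit : ℕ → ℕ) (bit≤1 : ∀ x → bit x ≤ 1) (ks : List ℕ) (inc : StrictlyMonotonic ks) where

  len≡ : length (table bit ks) ≡ length ks
  len≡ = length-map _ ks

  entry : ∀ {i} → i < length (table bit ks) → get (table bit ks) i ≡ get ks i * 2 + bit (get ks i)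
  entry i< = get-map _ ks (subst (_ <_) len≡ i<)

  key<key : ∀ {x y} → x < y → x * 2 + bit x < y * 2
  key<key {x} {y} x<y =
    ≤-trans (s≤s (≤-trans (+-monoʳ-≤ (x * 2) (bit≤1 x)) (≤-reflexive (+-comm _ 1))))
            (*-monoˡ-≤ 2 x<y)

  entry≤⇒key≤ : ∀ {x y} → y * 2 ≤ x * 2 + bit x → y ≤ x
  entry≤⇒key≤ {x} {y} y2≤ with y ≤? x
  ... | yes y≤x = y≤x
  ... | no  y≰x = contradiction (key<key (≰⇒> y≰x)) (≤⇒≯ y2≤)

  table-mono : Monotonic (table bit ks)
  table-mono {i} {j} i≤j j< with m≤n⇒m<n∨m≡n i≤j

  ... | inj₂ refl = ≤-refl
  ... | inj₁ i<j
    rewrite entry (<-trans i<j j<) | entry j< =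
    ≤-trans (<⇒≤ (key<key (inc i<j (subst (_ <_) len≡ j<)))) (m≤m+n _ _)

  module _ {v pos} (lower : IsLowerBound (table bit ks) (v * 2) pos) where

    light-position : ∀ {j} → j < length ks → get ks j ≡ v →
                     pos < length (table bit ks) × get (table bit ks) pos ∸ v * 2 ≡ bit v
    light-position {j} j< refl = pos< , (begin
      get (table bit ks) pos ∸ v * 2           ≡⟨ cong (_∸ v * 2) (trans (entry pos<) (cong (λ x → x * 2 + bit x) ks[pos]≡v)) ⟩
      v * 2 + bit v ∸ v * 2                    ≡⟨ m+n∸m≡n (v * 2) (bit v) ⟩
      bit v                                    ∎)
      where
      open ≡-Reasoning
      j<′ : j < length (table bit ks)
      j<′ = subst (j <_) (sym len≡) j<
      pos≤j : pos ≤ j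
      pos≤j with pos ≤? j
      ... | yes p = p
      ... | no  p = contradiction (subst (_< v * 2) (entry j<′) (lower .before (≰⇒> p)))
                                  (≤⇒≯ (m≤m+n _ _))
      pos< : pos < length (table bit ks)
      pos< = ≤-<-trans pos≤j j<′
      ks[pos]≡v : get ks pos ≡ v
      ks[pos]≡v = ≤-antisym
        (entry≤⇒key≤ (≤-trans (m≤m+n (get ks pos * 2) (bit (get ks pos)))
                      (subst₂ _≤_ (entry pos<) (entry j<′) (table-mono pos≤j j<′))))
        (entry≤⇒key≤ (subst (v * 2 ≤_) (entry pos<) (lower .after ≤-refl pos<)))

    heavy-position : (∀ {j} → j < length ks → get ks j ≢ v) → pos < length (table bit ks) →
                     (get (table bit ks) pos ∸ v * 2) / 2 ≢ 0
    heavy-position v∉ pos< /≡0 = contradiction (m/n≡0⇒m<n /≡0) (≤⇒≯ 2≤)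
      where
      v< : v < get ks pos
      v< = ≤∧≢⇒< (entry≤⇒key≤ (subst (v * 2 ≤_) (entry pos<) (lower .after ≤-refl pos<)))
                 (λ e → v∉ (subst (pos <_) len≡ pos<) (sym e))
      2≤ : 2 ≤ get (table bit ks) pos ∸ v * 2
      2≤ = m+n≤o⇒m≤o∸n 2 (subst (2 + v * 2 ≤_) (sym (entry pos<))
             (≤-trans (*-monoˡ-≤ 2 v<) (m≤m+n _ _)))

module Answering {w} (m : Memory w) (v d τ : ℕ) (xs : List ℕ) (mono : Monotonic xs)
                 (xs< : ∀ {i} → i < length xs → get xs i < 2 ^ d) (v< : v < 2 ^ d)
                 (bit : ℕ → ℕ) (bit≤1 : ∀ x → bit x ≤ 1) (ks : List ℕ) (inc : StrictlyMonotonic ks)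
                 (m≈ : ∀ a → value (cell m a) ≡
                             get (xs ++ 2 ^ τ ∷ length (table bit ks) ∷ table bit ks) a)
                 (2^[1+d]<W : 2 ^ suc d < 2 ^ w) (offsets : length xs + 2 ^ τ < 2 ^ w)
                 (len< : length xs < 2 ^ suc τ)
                 (offsets′ : length (table bit ks) + 2 ^ τ < 2 ^ w)
                 (len<′ : length (table bit ks) < 2 ^ suc τ)
                 (addresses : length xs + 1 + 1 + length (table bit ks) < 2 ^ w) where

  open Table bit bit≤1 ks inc

  len = length (table bit ks)

  memory′ = xs ++ 2 ^ τ ∷ len ∷ table bit ks

  2^d<W : 2 ^ d < 2 ^ w
  2^d<W = ≤-<-trans (m≤m+n _ _) 2^[1+d]<W

  open Scanning m (get memory′) m≈ v d τ xs mono (get-++ˡ xs) xs< v< 2^d<W offsets len<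

  base = n + 1 + 1

  segment′ : ∀ {i} → i < len → get memory′ (base + i) ≡ get (table bit ks) i
  segment′ {i} _ = trans (cong (get memory′) (reassociate n i)) (get-++ʳ xs (2 + i))
    where
    reassociate : ∀ n i → n + 1 + 1 + i ≡ n + (2 + i)
    reassociate = solve-∀

  module Lookup = Searching (table bit ks) table-mono base segment′ addresses offsets′

  initial : List ℕ
  initial = v ∷ n ∷ d ∷ List.replicate 18 0

  base<W : base < W
  base<W = ≤-<-trans (m≤m+n _ _) addresses

  2v<W : v * 2 < W
  2v<W = ≤-<-trans (≤-trans (*-monoˡ-≤ 2 (<⇒≤ v<)) (≤-reflexive (*-comm (2 ^ d) 2))) 2^[1+d]<W

  run-setup : Run setup initial 7 (st base len (v * 2) 0 0 (n + 1) 0 (List.replicate 7 0))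
  run-setup =
    subst₂ (λ p l → Run setup initial 7 (v ∷ n ∷ d ∷ 1 ∷ 2 ∷ p ∷ base ∷ l ∷ v * 2 ∷ 0 ∷ 0 ∷ n + 1 ∷ List.replicate 9 0))
      (trans (cong (get memory′) (sym (+-identityʳ n))) (get-++ʳ xs 0)) (get-++ʳ xs 1)
      (run-const 1<W ▸ run-const (≤-<-trans (*-monoʳ-≤ 2 (m^n>0 2 d)) 2^[1+d]<W) ▸ run-load ▸
       run-add (≤-<-trans (m≤m+n _ _) base<W) ▸ run-load ▸ run-add base<W ▸ run-mul 2v<W)

  LookedUp : ℕ → ℕ → ℕ → Set
  LookedUp pos t x =
    Run search (st base len (v * 2) 0 0 (n + 1) 0 (List.replicate 7 0)) Lookup.searchTime
               (st base len (v * 2) pos 0 t x (List.replicate 7 0)) ×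
    IsLowerBound (table bit ks) (v * 2) pos

  run-lookup : ∃[ pos ] ∃[ t ] ∃[ x ] LookedUp pos t x
  run-lookup = Lookup.run-search len<′ 0<W

  entryAt : ℕ → ℕ
  entryAt pos = get memory′ (base + pos) ∸ v * 2

  run-probe : ∀ {pos t x} → pos < len →
              Run probe (st base len (v * 2) pos 0 t x (List.replicate 7 0)) 4
                        (st base len (v * 2) pos 0 (entryAt pos / 2) (entryAt pos) (List.replicate 7 0))
  run-probe pos< = run-add (<-trans (+-monoʳ-< base pos<) addresses) ▸ run-load ▸ run-sub ▸ run-div

  lightTime : ℕ
  lightTime = 7 + (Lookup.searchTime + (1 + (1 + (4 + 2))))

  run-light : ∀ {j} → j < length ks → get ks j ≡ v →
              ∃[ σ ] Run queryProgram initial lightTime σ × get σ 0 ≡ bit v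
  run-light j< ks[j]≡v = conclude run-lookup
    where
    conclude : ∃[ pos ] ∃[ t ] ∃[ x ] LookedUp pos t x →
               ∃[ σ ] Run queryProgram initial lightTime σ × get σ 0 ≡ bit v
    conclude (pos , _ , _ , search⇓ , lower) =
      _ ,
      (run-setup ▸ search⇓ ▸ run-sub ▸
       run-then (m>n⇒m∸n≢0 pos<)
         (run-probe pos< ▸ run-else (m<n⇒m/n≡0 (subst (_< 2) (sym loaded≡) (s≤s (bit≤1 v)))) run-sub)) ,
      loaded≡
      where
      pos< : pos < len
      pos< = proj₁ (light-position lower j< ks[j]≡v)
      loaded≡ : entryAt pos ≡ bit v
      loaded≡ = trans (cong (_∸ v * 2) (segment′ pos<)) (proj₂ (light-position lower j< ks[j]≡v))

  module Heavy (D : ℕ → ℕ) (B : ℕ) (D≤B : ∀ {y} → y ≤ 2 ^ d → D y ≤ B)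
               (progress : ∀ {y i y′} → orth d y v ≡ true → i < n → y ≤ get xs i →
                           IsNext d (get xs i) v y′ → get xs i < y′ → D y < D y′) where

    open Looping D B D≤B progress

    heavyTime : ℕ
    heavyTime = 7 + (Lookup.searchTime + (1 + (1 + (4 + (1 + scanTime)))))

    run-heavy : (∀ {j} → j < length ks → get ks j ≢ v) →
                ∃[ σ ] Run queryProgram initial heavyTime σ × (get σ 0 ≢ 0 ⇔ Found d xs v)
    run-heavy v∉ = conclude run-lookup
      where
      conclude : ∃[ pos ] ∃[ t ] ∃[ x ] LookedUp pos t x →
                 ∃[ σ ] Run queryProgram initial heavyTime σ × (get σ 0 ≢ 0 ⇔ Found d xs v)
      conclude (pos , t , x , search⇓ , lower) = split (pos <? len)
        where
        split : Dec (pos < len) →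
                ∃[ σ ] Run queryProgram initial heavyTime σ × (get σ 0 ≢ 0 ⇔ Found d xs v)
        split (yes pos<) = _ ,
          (run-setup ▸ search⇓ ▸ run-sub ▸
           run-then (m>n⇒m∸n≢0 pos<)
             (run-probe pos< ▸ run-then found (proj₁ (proj₂ scanned)))) ,
          proj₂ (proj₂ scanned)
          where
          scanned = run-scan {base} {len} {v * 2} {pos} {0} {entryAt pos / 2} {entryAt pos} {0} {0} {0} {0} {0} {0} {0}
          found : entryAt pos / 2 ≢ 0
          found e = heavy-position lower v∉ pos< (trans (cong (λ z → (z ∸ v * 2) / 2) (sym (segment′ pos<))) e)
        split (no pos≮) = _ ,
          (run-setup ▸ search⇓ ▸ run-sub ▸
           run-else (m≤n⇒m∸n≡0 (≮⇒≥ pos≮)) (run-within (m≤n+m scanTime 5) (proj₁ (proj₂ scanned)))) ,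
          proj₂ (proj₂ scanned)
          where
          scanned = run-scan {base} {len} {v * 2} {pos} {0} {len ∸ pos} {x} {0} {0} {0} {0} {0} {0} {0}

-- Counting

private
  variable
    𝒳 𝒴 : Set

sumTo : (ℕ → ℕ) → ℕ → ℕ
sumTo f zero    = 0
sumTo f (suc n) = sumTo f n + f n

sumTo-cong : ∀ {f g} → (∀ x → f x ≡ g x) → ∀ n → sumTo f n ≡ sumTo g n
sumTo-cong f≗g zero    = refl
sumTo-cong f≗g (suc n) = cong₂ _+_ (sumTo-cong f≗g n) (f≗g n)

sumTo-+ : ∀ f g n → sumTo (λ x → f x + g x) n ≡ sumTo f n + sumTo g n
sumTo-+ f g zero    = refl
sumTo-+ f g (suc n) rewrite sumTo-+ f g n = interchange (sumTo f n) (sumTo g n) (f n) (g n)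
  where
  interchange : ∀ a b c d → a + b + (c + d) ≡ a + c + (b + d)
  interchange = solve-∀

sumTo-0 : ∀ n → sumTo (λ _ → 0) n ≡ 0
sumTo-0 zero    = refl
sumTo-0 (suc n) = trans (+-identityʳ _) (sumTo-0 n)

sumTo-mono-≤ : ∀ f {m n} → m ≤ n → sumTo f m ≤ sumTo f n
sumTo-mono-≤ f {n = zero}  z≤n = z≤n
sumTo-mono-≤ f {n = suc n} m≤n with m≤n⇒m<n∨m≡n m≤n
... | inj₁ (s≤s m≤n) = ≤-trans (sumTo-mono-≤ f m≤n) (m≤m+n _ _)
... | inj₂ refl = ≤-refl

sumTo-double : ∀ f n → sumTo f (2 * n) ≡ sumTo (λ x → f (2 * x)) n + sumTo (λ x → f (1 + 2 * x)) n
sumTo-double f zero    = refl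
sumTo-double f (suc n) =
  trans (cong (sumTo f) (*-suc 2 n))
  (trans (cong (λ s → s + f (2 * n) + f (1 + 2 * n)) (sumTo-double f n))
         (interchange (sumTo (λ x → f (2 * x)) n) (sumTo (λ x → f (1 + 2 * x)) n) (f (2 * n)) (f (1 + 2 * n))))
  where
  interchange : ∀ a b c d → a + b + c + d ≡ a + c + (b + d)
  interchange = solve-∀

ind : Bool → ℕ
ind b = if b then 1 else 0

[2x]%2≡0 : ∀ x → (2 * x) % 2 ≡ 0
[2x]%2≡0 = [b+2x]%2≡b z<s

[2x]/2≡x : ∀ x → (2 * x) / 2 ≡ x
[2x]/2≡x = [b+2x]/2≡x z<s

[1+2x]%2≡1 : ∀ x → (1 + 2 * x) % 2 ≡ 1
[1+2x]%2≡1 = [b+2x]%2≡b (s<s z<s)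

[1+2x]/2≡x : ∀ x → (1 + 2 * x) / 2 ≡ x
[1+2x]/2≡x = [b+2x]/2≡x (s<s z<s)

high : ℕ → ℕ → ℕ
high zero    x = x
high (suc k) x = high k (x / 2)

weight : ℕ → ℕ → ℕ
weight zero    x = 0
weight (suc i) x = x % 2 + weight i (x / 2)

high-mono : ∀ k {x y} → x ≤ y → high k x ≤ high k y
high-mono zero    x≤y = x≤y
high-mono (suc k) x≤y = high-mono k (/-monoˡ-≤ 2 x≤y)

high-2^ : ∀ k i → high k (2 ^ (k + i)) ≡ 2 ^ i
high-2^ zero    i = refl
high-2^ (suc k) i = trans (cong (high k) ([2x]/2≡x (2 ^ (k + i)))) (high-2^ k i)

∧-true : ∀ {a b} → a ∧ b ≡ true → b ≡ true
∧-true {true} b≡ = b≡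

orth-high : ∀ k {i x v} → orth (k + i) x v ≡ true → orth i (high k x) (high k v) ≡ true
orth-high zero    ⊥x = ⊥x
orth-high (suc k) {i} {x} {v} ⊥x = orth-high k (∧-true {x % 2 * (v % 2) ≡ᵇ 0} ⊥x)

sumTo-high : ∀ f k i → sumTo (f ∘ high k) (2 ^ (k + i)) ≡ 2 ^ k * sumTo f (2 ^ i)
sumTo-high f zero    i = sym (+-identityʳ _)
sumTo-high f (suc k) i = begin
  sumTo (λ x → f (high k (x / 2))) (2 * 2 ^ (k + i))
    ≡⟨ sumTo-double _ (2 ^ (k + i)) ⟩
  sumTo (λ x → f (high k ((2 * x) / 2))) (2 ^ (k + i)) + sumTo (λ x → f (high k ((1 + 2 * x) / 2))) (2 ^ (k + i))
    ≡⟨ cong₂ _+_ (sumTo-cong (λ x → cong (f ∘ high k) ([2x]/2≡x x)) (2 ^ (k + i)))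
                 (sumTo-cong (λ x → cong (f ∘ high k) ([1+2x]/2≡x x)) (2 ^ (k + i))) ⟩
  sumTo (f ∘ high k) (2 ^ (k + i)) + sumTo (f ∘ high k) (2 ^ (k + i))
    ≡⟨ cong₂ _+_ (sumTo-high f k i) (sumTo-high f k i) ⟩
  2 ^ k * sumTo f (2 ^ i) + 2 ^ k * sumTo f (2 ^ i)
    ≡⟨ twice (2 ^ k) (sumTo f (2 ^ i)) ⟩
  2 ^ suc k * sumTo f (2 ^ i) ∎
  where
  open ≡-Reasoning
  twice : ∀ a b → a * b + a * b ≡ 2 * a * b
  twice = solve-∀

orthCount : ℕ → ℕ → ℕ
orthCount i v = sumTo (λ x → ind (orth i x v)) (2 ^ i)

-- A 1 of `v` forces a 0 and a 0 of `v` leaves the bit free, so `2 ^ (i - weight i v)` numbers are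
-- orthogonal. The product form avoids the subtraction and lets later estimates cancel a power of
-- two.
orthCount-weight : ∀ i v → orthCount i v * 2 ^ weight i v ≡ 2 ^ i
orthCount-weight zero    v = refl
orthCount-weight (suc i) v = trans (cong (_* 2 ^ weight (suc i) v) halves) (split (v % 2) refl (m%n<n v 2))
  where
  n = orthCount i (v / 2)
  halves : orthCount (suc i) v ≡ n + sumTo (λ x → ind ((1 * (v % 2) ≡ᵇ 0) ∧ orth i x (v / 2))) (2 ^ i)
  halves = trans (sumTo-double _ (2 ^ i)) (cong₂ _+_
    (sumTo-cong (λ x → cong₂ (λ b y → ind ((b * (v % 2) ≡ᵇ 0) ∧ orth i y (v / 2))) ([2x]%2≡0 x) ([2x]/2≡x x)) (2 ^ i))
    (sumTo-cong (λ x → cong₂ (λ b y → ind ((b * (v % 2) ≡ᵇ 0) ∧ orth i y (v / 2))) ([1+2x]%2≡1 x) ([1+2x]/2≡x x)) (2 ^ i)))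
  split : ∀ a → v % 2 ≡ a → a < 2 →
    (n + sumTo (λ x → ind ((1 * (v % 2) ≡ᵇ 0) ∧ orth i x (v / 2))) (2 ^ i)) * 2 ^ weight (suc i) v ≡ 2 ^ suc i
  split 0 a≡ _ rewrite a≡ =
    trans (twice n (2 ^ weight i (v / 2))) (cong (2 *_) (orthCount-weight i (v / 2)))
    where
    twice : ∀ a b → (a + a) * b ≡ 2 * (a * b)
    twice = solve-∀
  split 1 a≡ _ rewrite a≡ | sumTo-0 (2 ^ i) =
    trans (twice n (2 ^ weight i (v / 2))) (cong (2 *_) (orthCount-weight i (v / 2)))
    where
    twice : ∀ a b → (a + 0) * (2 * b) ≡ 2 * (a * b)
    twice = solve-∀
  split (suc (suc _)) _ (s<s (s<s ()))

-- With `<ᵇ suc t` for "at most `t`", removing a 1 at the bottom turns the test for `suc t` into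
-- that for `t` by computation.
lightCount : ℕ → ℕ → ℕ
lightCount i t = sumTo (λ x → ind (weight i x <ᵇ suc t)) (2 ^ i)

lightCount-halves : ∀ i t → lightCount (suc i) t ≡
                    lightCount i t + sumTo (λ x → ind (suc (weight i x) <ᵇ suc t)) (2 ^ i)
lightCount-halves i t = trans (sumTo-double _ (2 ^ i)) (cong₂ _+_
  (sumTo-cong (λ x → cong₂ (λ b y → ind (b + weight i y <ᵇ suc t)) ([2x]%2≡0 x) ([2x]/2≡x x)) (2 ^ i))
  (sumTo-cong (λ x → cong₂ (λ b y → ind (b + weight i y <ᵇ suc t)) ([1+2x]%2≡1 x) ([1+2x]/2≡x x)) (2 ^ i)))

-- The bound from the generating function ∑ₓ z^(weight x) = (1 + z)^i at z = 1 / X.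
lightCount-bound : ∀ X → 1 ≤ X → ∀ i t → lightCount i t * X ^ i ≤ suc X ^ i * X ^ t
lightCount-bound X 1≤X zero t = ≤-trans (m^n>0 X {{>-nonZero 1≤X}} t) (≤-reflexive (sym (+-identityʳ _)))
lightCount-bound X 1≤X (suc i) zero
  rewrite lightCount-halves i 0 | sumTo-0 (2 ^ i) = begin
  (lightCount i 0 + 0) * (X * X ^ i)  ≡⟨ rearrange (lightCount i 0) X (X ^ i) ⟩
  X * (lightCount i 0 * X ^ i)        ≤⟨ *-mono-≤ (n≤1+n X) (lightCount-bound X 1≤X i 0) ⟩
  suc X * (suc X ^ i * 1)             ≡⟨ *-assoc (suc X) (suc X ^ i) 1 ⟨
  suc X * suc X ^ i * 1               ∎
  where
  open ≤-Reasoning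
  rearrange : ∀ c x p → (c + 0) * (x * p) ≡ x * (c * p)
  rearrange = solve-∀
lightCount-bound X 1≤X (suc i) (suc t)
  rewrite lightCount-halves i (suc t) = begin
  (lightCount i (suc t) + lightCount i t) * (X * X ^ i)
    ≡⟨ rearrange (lightCount i (suc t)) (lightCount i t) X (X ^ i) ⟩
  X * (lightCount i (suc t) * X ^ i) + X * (lightCount i t * X ^ i)
    ≤⟨ +-mono-≤ (*-monoʳ-≤ X (lightCount-bound X 1≤X i (suc t)))
                (*-monoʳ-≤ X (lightCount-bound X 1≤X i t)) ⟩
  X * (suc X ^ i * (X * X ^ t)) + X * (suc X ^ i * X ^ t)
    ≡⟨ collect X (suc X ^ i) (X ^ t) ⟩
  suc X * suc X ^ i * (X * X ^ t) ∎
  where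
  open ≤-Reasoning
  rearrange : ∀ c e x p → (c + e) * (x * p) ≡ x * (c * p) + x * (e * p)
  rearrange = solve-∀
  collect : ∀ x p q → x * (p * (x * q)) + x * (p * q) ≡ (1 + x) * p * (x * q)
  collect = solve-∀

-- Sums over lists and over all sequences

sumOver : (𝒳 → ℕ) → List 𝒳 → ℕ
sumOver f xs = sum (map f xs)

sumOver-++ : ∀ (f : 𝒳 → ℕ) xs ys → sumOver f (xs ++ ys) ≡ sumOver f xs + sumOver f ys
sumOver-++ f xs ys = trans (cong sum (map-++ f xs ys)) (sum-++ (map f xs) (map f ys))

sumOver-cong : ∀ {f g : 𝒳 → ℕ} → (∀ x → f x ≡ g x) → ∀ xs → sumOver f xs ≡ sumOver g xs
sumOver-cong f≗g []       = refl
sumOver-cong f≗g (x ∷ xs) = cong₂ _+_ (f≗g x) (sumOver-cong f≗g xs)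

sumOver-mono-≤ : ∀ {f g : 𝒳 → ℕ} → (∀ x → f x ≤ g x) → ∀ xs → sumOver f xs ≤ sumOver g xs
sumOver-mono-≤ f≤g []       = z≤n
sumOver-mono-≤ f≤g (x ∷ xs) = +-mono-≤ (f≤g x) (sumOver-mono-≤ f≤g xs)

sumOver-mono-< : ∀ {f g : 𝒳 → ℕ} → (∀ x → f x ≤ g x) → ∀ {x xs} → x ∈ xs → f x < g x →
                 sumOver f xs < sumOver g xs
sumOver-mono-< f≤g {xs = _ ∷ xs} (here refl) f<g = +-mono-<-≤ f<g (sumOver-mono-≤ f≤g xs)
sumOver-mono-< f≤g {xs = y ∷ _}  (there x∈) f<g = +-mono-≤-< (f≤g y) (sumOver-mono-< f≤g x∈ f<g)

sumOver-map : ∀ (f : 𝒴 → ℕ) (g : 𝒳 → 𝒴) xs → sumOver f (map g xs) ≡ sumOver (f ∘ g) xs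
sumOver-map f g []       = refl
sumOver-map f g (x ∷ xs) = cong (f (g x) +_) (sumOver-map f g xs)

sumOver-+ : ∀ (f g : 𝒳 → ℕ) xs → sumOver (λ x → f x + g x) xs ≡ sumOver f xs + sumOver g xs
sumOver-+ f g []       = refl
sumOver-+ f g (x ∷ xs) rewrite sumOver-+ f g xs = interchange (f x) (g x) (sumOver f xs) (sumOver g xs)
  where
  interchange : ∀ a b c d → a + b + (c + d) ≡ a + c + (b + d)
  interchange = solve-∀

sumOver-*ˡ : ∀ c (f : 𝒳 → ℕ) xs → sumOver (λ x → c * f x) xs ≡ c * sumOver f xs
sumOver-*ˡ c f []       = sym (*-zeroʳ c)
sumOver-*ˡ c f (x ∷ xs) rewrite sumOver-*ˡ c f xs = sym (*-distribˡ-+ c (f x) (sumOver f xs))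

sumOver-const : ∀ c (xs : List 𝒳) → sumOver (λ _ → c) xs ≡ length xs * c
sumOver-const c []       = refl
sumOver-const c (x ∷ xs) = cong (c +_) (sumOver-const c xs)

sumOver-cartesian : ∀ {Z : Set} (f : Z → ℕ) (g : 𝒳 → 𝒴 → Z) xs ys →
  sumOver f (List.cartesianProductWith g xs ys) ≡ sumOver (λ x → sumOver (λ y → f (g x y)) ys) xs
sumOver-cartesian f g []       ys = refl
sumOver-cartesian f g (x ∷ xs) ys = trans (sumOver-++ f (map (g x) ys) _)
  (cong₂ _+_ (sumOver-map f (g x) ys) (sumOver-cartesian f g xs ys))

length≡sumOver : ∀ (xs : List 𝒳) → length xs ≡ sumOver (λ _ → 1) xs
length≡sumOver xs = sym (trans (sumOver-const 1 xs) (*-identityʳ _))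

length-sequences : ∀ (xs : List 𝒳) n → length (sequences xs n) ≡ length xs ^ n
length-sequences xs zero    = refl
length-sequences xs (suc n) = begin
  length (sequences xs (suc n))                          ≡⟨ length≡sumOver (sequences xs (suc n)) ⟩
  sumOver (λ _ → 1) (sequences xs (suc n))               ≡⟨ sumOver-cartesian _ _∷_ xs (sequences xs n) ⟩
  sumOver (λ _ → sumOver (λ _ → 1) (sequences xs n)) xs  ≡⟨ sumOver-const _ xs ⟩
  length xs * sumOver (λ _ → 1) (sequences xs n)         ≡⟨ cong (length xs *_) (trans (sym (length≡sumOver (sequences xs n))) (length-sequences xs n)) ⟩
  length xs * length xs ^ n                              ∎
  where open ≡-Reasoning

-- Linearity of expectation: each of the `n` positions takes each value equally often. The factor
-- `length xs` on the left stands in for an exponent `n - 1` on the right.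
sumOver-sequences : ∀ (f : 𝒳 → ℕ) xs n →
  length xs * sumOver (λ S → sumOver f (toList S)) (sequences xs n) ≡ n * (sumOver f xs * length xs ^ n)
sumOver-sequences f xs zero    = *-zeroʳ (length xs)
sumOver-sequences f xs (suc n) = begin
  k * sumOver F (sequences xs (suc n))
    ≡⟨ cong (k *_) (sumOver-cartesian F _∷_ xs (sequences xs n)) ⟩
  k * sumOver (λ x → sumOver (λ S → f x + F S) (sequences xs n)) xs
    ≡⟨ cong (k *_) (sumOver-cong (λ x → trans (sumOver-+ (λ _ → f x) F (sequences xs n))
         (cong (_+ s) (trans (sumOver-const (f x) (sequences xs n)) (cong (_* f x) (length-sequences xs n))))) xs) ⟩
  k * sumOver (λ x → k ^ n * f x + s) xs
    ≡⟨ cong (k *_) (trans (sumOver-+ (λ x → k ^ n * f x) (λ _ → s) xs)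
                          (cong₂ _+_ (sumOver-*ˡ (k ^ n) f xs) (sumOver-const s xs))) ⟩
  k * (k ^ n * sumOver f xs + k * s)
    ≡⟨ cong (λ z → k * (k ^ n * sumOver f xs + z)) (sumOver-sequences f xs n) ⟩
  k * (k ^ n * sumOver f xs + n * (sumOver f xs * k ^ n))
    ≡⟨ collect k (k ^ n) (sumOver f xs) n ⟩
  suc n * (sumOver f xs * (k * k ^ n)) ∎
  where
  open ≡-Reasoning
  k = length xs
  F : ∀ {n} → Vec _ n → ℕ
  F S = sumOver f (toList S)
  s = sumOver F (sequences xs n)
  collect : ∀ k p g n → k * (p * g + n * (g * p)) ≡ (1 + n) * (g * (k * p))
  collect = solve-∀

bitVecs : ∀ d → List (BitVec d)
bitVecs = sequences (false ∷ true ∷ [])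

-- The first coordinate is the lowest bit of `code`, so splitting it off amounts to separating even
-- from odd numbers.
sumOver-code : ∀ f d → sumOver (f ∘ code) (bitVecs d) ≡ sumTo f (2 ^ d)
sumOver-code f zero    = +-identityʳ (f 0)
sumOver-code f (suc d) = begin
  sumOver (f ∘ code) (bitVecs (suc d))
    ≡⟨ sumOver-cartesian (f ∘ code) _∷_ (false ∷ true ∷ []) (bitVecs d) ⟩
  sumOver (λ u → f (2 * code u)) (bitVecs d) + (sumOver (λ u → f (1 + 2 * code u)) (bitVecs d) + 0)
    ≡⟨ cong₂ _+_ (sumOver-code (λ x → f (2 * x)) d)
                 (trans (+-identityʳ _) (sumOver-code (λ x → f (1 + 2 * x)) d)) ⟩
  sumTo (λ x → f (2 * x)) (2 ^ d) + sumTo (λ x → f (1 + 2 * x)) (2 ^ d)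
    ≡⟨ sumTo-double f (2 ^ d) ⟨
  sumTo f (2 ^ suc d) ∎
  where open ≡-Reasoning

-- From bit vectors to numbers

private
  variable
    d n : ℕ

-- Each iteration of the scan either meets a vector of S whose high bits are
-- orthogonal to those of v, or moves on to larger high bits orthogonal to them.
module Measure (k i v : ℕ) (cs : List ℕ) where

  compatible : ℕ → ℕ
  compatible p = ind (orth i p (high k v))

  progressTo : ℕ → ℕ
  progressTo y = sumTo compatible (high k y) +
                 sumOver (λ c → ind (c <ᵇ y) * compatible (high k c)) cs

  total : ℕ
  total = orthCount i (high k v) + sumOver (compatible ∘ high k) cs

  progress≤total : ∀ {y} → y ≤ 2 ^ (k + i) → progressTo y ≤ total
  progress≤total {y} y≤ =
    +-mono-≤ (sumTo-mono-≤ compatible (≤-trans (high-mono k y≤) (≤-reflexive (high-2^ k i))))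
             (sumOver-mono-≤ (λ c → indicator (c <ᵇ y) (compatible (high k c))) cs)
    where
    indicator : ∀ b x → ind b * x ≤ x
    indicator true  x = ≤-reflexive (+-identityʳ x)
    indicator false x = z≤n

  <⇒<ᵇ≡true : ∀ {x y} → x < y → (x <ᵇ y) ≡ true
  <⇒<ᵇ≡true {zero}  {suc y} _         = refl
  <⇒<ᵇ≡true {suc x} {suc y} (s<s x<y) = <⇒<ᵇ≡true x<y

  ≥⇒<ᵇ≡false : ∀ {x y} → y ≤ x → (x <ᵇ y) ≡ false
  ≥⇒<ᵇ≡false {x}     {zero}  _         = refl
  ≥⇒<ᵇ≡false {suc x} {suc y} (s≤s y≤x) = ≥⇒<ᵇ≡false y≤x

  ind-<ᵇ-mono : ∀ c {y y′} → y ≤ y′ → ind (c <ᵇ y) ≤ ind (c <ᵇ y′)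
  ind-<ᵇ-mono c {y} y≤y′ with c <? y
  ... | yes c<y rewrite <⇒<ᵇ≡true c<y | <⇒<ᵇ≡true (<-≤-trans c<y y≤y′) = ≤-refl
  ... | no  c≮y rewrite ≥⇒<ᵇ≡false (≮⇒≥ c≮y) = z≤n

  -- If the high bits of `u` are compatible, `u` is newly counted in the second sum, because
  -- `y ≤ u < y′`. If not, they differ from those of `y`, which are compatible since `y` is
  -- orthogonal to `v`; the high bits of `y` are then strictly below those of `y′` and newly counted
  -- in the first sum.
  progress< : ∀ {y u y′} → orth (k + i) y v ≡ true → u ∈ cs → y ≤ u → u < y′ →
              progressTo y < progressTo y′
  progress< {y} {u} {y′} ⊥y u∈ y≤u u<y′ with orth i (high k u) (high k v) in ⊥u
  ... | true  = +-mono-≤-< (sumTo-mono-≤ compatible (high-mono k (<⇒≤ (≤-<-trans y≤u u<y′))))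
                           (sumOver-mono-< (λ c → *-monoˡ-≤ (compatible (high k c)) (ind-<ᵇ-mono c (<⇒≤ (≤-<-trans y≤u u<y′)))) u∈ strict)
    where
    strict : ind (u <ᵇ y) * compatible (high k u) < ind (u <ᵇ y′) * compatible (high k u)
    strict rewrite ≥⇒<ᵇ≡false y≤u | <⇒<ᵇ≡true u<y′ | ⊥u = ≤-refl
  ... | false = +-mono-<-≤ strict (sumOver-mono-≤ (λ c → *-monoˡ-≤ (compatible (high k c)) (ind-<ᵇ-mono c (<⇒≤ (≤-<-trans y≤u u<y′)))) cs)
    where
    ⊥y′ = orth-high k ⊥y
    y≢u : high k y ≢ high k u
    y≢u y≡u = true≢false (trans (sym ⊥y′) (trans (cong (λ z → orth i z (high k v)) y≡u) ⊥u))
    strict : sumTo compatible (high k y) < sumTo compatible (high k y′)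
    strict = ≤-trans
      (≤-reflexive (trans (+-comm 1 _) (cong (λ b → sumTo compatible (high k y) + ind b) (sym ⊥y′))))
      (sumTo-mono-≤ compatible (≤-trans (≤∧≢⇒< (high-mono k y≤u) y≢u) (high-mono k (<⇒≤ u<y′))))

code<2^d : (u : BitVec d) → code u < 2 ^ d
code<2^d []          = ≤-refl
code<2^d {suc d} (false ∷ u) = *-monoʳ-< 2 (code<2^d u)
code<2^d {suc d} (true ∷ u)  = ≤-trans (≤-reflexive (sym (*-suc 2 (code u)))) (*-monoʳ-≤ 2 (code<2^d u))

orth-code : ∀ a (u : BitVec d) b (v : BitVec d) →
            orth (suc d) (code (a ∷ u)) (code (b ∷ v)) ≡ (ind a * ind b ≡ᵇ 0) ∧ orth d (code u) (code v)
orth-code {d} a u b v = cong₂ _∧_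
  (cong₂ (λ x y → x * y ≡ᵇ 0) ([b+2x]%2≡b (ind<2 a) (code u)) ([b+2x]%2≡b (ind<2 b) (code v)))
  (cong₂ (orth d) ([b+2x]/2≡x (ind<2 a) (code u)) ([b+2x]/2≡x (ind<2 b) (code v)))
  where
  ind<2 : ∀ b → ind b < 2
  ind<2 true  = s<s z<s
  ind<2 false = z<s

orth⇒Orthogonal : (u v : BitVec d) → orth d (code u) (code v) ≡ true → Orthogonal u v
orth⇒Orthogonal {suc d} (a ∷ u) (b ∷ v) ⊥uv (i , uᵢ , vᵢ) with trans (sym (orth-code a u b v)) ⊥uv
orth⇒Orthogonal (true  ∷ u) (true  ∷ v) ⊥uv (zero  , refl , refl) | ()
orth⇒Orthogonal (a ∷ u) (b ∷ v) ⊥uv (suc i , uᵢ , vᵢ) | ⊥uv′ =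
  orth⇒Orthogonal u v (∧-true {ind a * ind b ≡ᵇ 0} ⊥uv′) (i , uᵢ , vᵢ)

Orthogonal⇒orth : (u v : BitVec d) → Orthogonal u v → orth d (code u) (code v) ≡ true
Orthogonal⇒orth []      []      _ = refl
Orthogonal⇒orth (a ∷ u) (b ∷ v) ⊥uv =
  trans (orth-code a u b v)
  (trans (cong ((ind a * ind b ≡ᵇ 0) ∧_) (Orthogonal⇒orth u v (λ (i , uᵢ , vᵢ) → ⊥uv (suc i , uᵢ , vᵢ))))
         (heads a b ⊥uv))
  where
  heads : ∀ a b → Orthogonal (a ∷ u) (b ∷ v) → (ind a * ind b ≡ᵇ 0) ∧ true ≡ true
  heads false b     ⊥uv = refl
  heads true  false ⊥uv = refl
  heads true  true  ⊥uv = contradiction (zero , refl , refl) ⊥uv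

-- Sorted inputs, tabulated answers and light numbers

insert : BitVec d → Vec (BitVec d) n → Vec (BitVec d) (suc n)
insert u []      = u ∷ []
insert u (v ∷ S) with code u ≤? code v
... | yes _ = u ∷ v ∷ S
... | no  _ = v ∷ insert u S

sort : Input n d → Input n d
sort []      = []
sort (u ∷ S) = insert u (sort S)

insert-↭ : (u : BitVec d) (S : Vec (BitVec d) n) → toList (insert u S) ↭ u ∷ toList S
insert-↭ u []      = ↭-refl
insert-↭ u (v ∷ S) with code u ≤? code v
... | yes _ = ↭-refl
... | no  _ = ↭-trans (Perm.prep v (insert-↭ u S)) (Perm.swap v u ↭-refl)

sort-↭ : (S : Input n d) → toList (sort S) ↭ toList S
sort-↭ []      = ↭-refl
sort-↭ (u ∷ S) = ↭-trans (insert-↭ u (sort S)) (Perm.prep u (sort-↭ S))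

codes : Input n d → List ℕ
codes S = map code (toList S)

insert-sorted : (u : BitVec d) (S : Vec (BitVec d) n) → AllPairs _≤_ (codes S) → AllPairs _≤_ (codes (insert u S))
insert-sorted u []      _ = [] ∷ []
insert-sorted u (v ∷ S) (v≤S ∷ sorted) with code u ≤? code v
... | yes u≤v = (u≤v ∷ All.map (≤-trans u≤v) v≤S) ∷ v≤S ∷ sorted
... | no  u≰v = All-resp-↭ (↭-sym (map⁺ code (insert-↭ u S))) (<⇒≤ (≰⇒> u≰v) ∷ v≤S) ∷ insert-sorted u S sorted

sort-sorted : (S : Input n d) → AllPairs _≤_ (codes (sort S))
sort-sorted []      = []
sort-sorted (u ∷ S) = insert-sorted u (sort S) (sort-sorted S)

get-∈ : ∀ xs {i} → i < length xs → get xs i ∈ xs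
get-∈ (x ∷ xs) {zero}  _         = here refl
get-∈ (x ∷ xs) {suc i} (s<s i<n) = there (get-∈ xs i<n)

∈-get : ∀ {xs x} → x ∈ xs → ∃[ i ] i < length xs × get xs i ≡ x
∈-get (here refl) = 0 , z<s , refl
∈-get (there x∈) with ∈-get x∈
... | i , i< , e = suc i , s<s i< , e

AllPairs-get : ∀ {R : ℕ → ℕ → Set} {xs} → AllPairs R xs → ∀ {i j} → i < j → j < length xs → R (get xs i) (get xs j)
AllPairs-get {xs = _ ∷ xs} (x≤ ∷ _) {zero}  {suc j} _         (s<s j<) = All.lookup x≤ (get-∈ xs j<)
AllPairs-get (_ ∷ ps)               {suc i} {suc j} (s<s i<j) (s<s j<) = AllPairs-get ps i<j j<

sorted⇒Monotonic : ∀ {xs} → AllPairs _≤_ xs → Monotonic xs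
sorted⇒Monotonic sorted i≤j j< with m≤n⇒m<n∨m≡n i≤j
... | inj₁ i<j  = AllPairs-get sorted i<j j<
... | inj₂ refl = ≤-refl

∈-codes : ∀ (S : Input n d) {x} → x ∈ codes S → x < 2 ^ d
∈-codes S x∈ with ∈-map⁻ code x∈
... | u , _ , refl = code<2^d u

sort-∈ : (S : Input n d) → ∀ {x} → x ∈ codes (sort S) → x ∈ codes S
sort-∈ S = ∈-resp-↭ (map⁺ code (sort-↭ S))

length-codes : (S : Input n d) → length (codes S) ≡ n
length-codes S = trans (length-map code (toList S)) (length-toList S)

Found⇔Any : (S : Input n d) (v : BitVec d) →
            Found d (codes (sort S)) (code v) ⇔ VecAny.Any (λ u → Orthogonal u v) S
Found⇔Any {d = d} S v = mk⇔ to from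
  where
  to : Found d (codes (sort S)) (code v) → VecAny.Any (λ u → Orthogonal u v) S
  to (i , i< , ⊥i) with ∈-map⁻ code (sort-∈ S (get-∈ (codes (sort S)) i<))
  ... | u , u∈ , xᵢ≡u = VecAny.toList⁻ (lose u∈
        (orth⇒Orthogonal u v (trans (cong (λ z → orth d z (code v)) (sym xᵢ≡u)) ⊥i)))
  from : VecAny.Any (λ u → Orthogonal u v) S → Found d (codes (sort S)) (code v)
  from any with find (VecAny.toList⁺ any)
  ... | u , u∈ , ⊥uv with ∈-get (∈-map⁺ code (∈-resp-↭ (↭-sym (sort-↭ S)) u∈))
  ...   | i , i< , xᵢ≡u = i , i< , trans (cong (λ z → orth d z (code v)) xᵢ≡u) (Orthogonal⇒orth u v ⊥uv)

found? : ∀ d xs v → Dec (ListAny.Any (λ x → orth d x v ≡ true) xs)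
found? d xs v = ListAny.any? (λ x → orth d x v Bool.≟ true) xs

answer : ℕ → List ℕ → ℕ → ℕ
answer d xs v with found? d xs v
... | yes _ = 1
... | no  _ = 0

answer≤1 : ∀ d xs v → answer d xs v ≤ 1
answer≤1 d xs v with found? d xs v
... | yes _ = ≤-refl
... | no  _ = z≤n

answer⇔Found : ∀ d xs v → answer d xs v ≢ 0 ⇔ Found d xs v
answer⇔Found d xs v with found? d xs v
... | yes any = mk⇔ (λ _ → found) (λ _ ())
  where
  found : Found d xs v
  found with find any
  ... | x , x∈ , ⊥x with ∈-get x∈
  ...   | i , i< , refl = i , i< , ⊥x
... | no ¬any = mk⇔ (contradiction refl) (λ (i , i< , ⊥i) _ → ¬any (lose (get-∈ xs i<) ⊥i))

lights : (k i t : ℕ) → List ℕ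
lights k i t = filterᵇ (λ x → weight i (high k x) <ᵇ suc t) (upTo (2 ^ (k + i)))

lights-increasing : ∀ k i t → StrictlyMonotonic (lights k i t)
lights-increasing k i t =
  AllPairs-get (AllPairs.filter⁺ _ (AllPairs.applyUpTo⁺₁ _ (2 ^ (k + i)) (λ i<j _ → i<j)))

length-filterᵇ : ∀ (p : ℕ → Bool) xs → length (filterᵇ p xs) ≡ sumOver (ind ∘ p) xs
length-filterᵇ p []       = refl
length-filterᵇ p (x ∷ xs) with p x
... | true  = cong suc (length-filterᵇ p xs)
... | false = length-filterᵇ p xs

sumOver-upTo : ∀ f n → sumOver f (upTo n) ≡ sumTo f n
sumOver-upTo f zero    = refl
sumOver-upTo f (suc n) = begin
  sumOver f (upTo (suc n))              ≡⟨ cong (sumOver f) (upTo-∷ʳ n) ⟨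
  sumOver f (upTo n ++ n ∷ [])          ≡⟨ sumOver-++ f (upTo n) (n ∷ []) ⟩
  sumOver f (upTo n) + (f n + 0)        ≡⟨ cong₂ _+_ (sumOver-upTo f n) (+-identityʳ (f n)) ⟩
  sumTo f n + f n                       ∎
  where open ≡-Reasoning

length-lights : ∀ k i t → length (lights k i t) ≡ 2 ^ k * lightCount i t
length-lights k i t = begin
  length (lights k i t)                                               ≡⟨ length-filterᵇ _ (upTo (2 ^ (k + i))) ⟩
  sumOver (λ x → ind (weight i (high k x) <ᵇ suc t)) (upTo (2 ^ (k + i))) ≡⟨ sumOver-upTo _ (2 ^ (k + i)) ⟩
  sumTo (λ x → ind (weight i (high k x) <ᵇ suc t)) (2 ^ (k + i))      ≡⟨ sumTo-high (λ x → ind (weight i x <ᵇ suc t)) k i ⟩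
  2 ^ k * lightCount i t                                              ∎
  where open ≡-Reasoning

2^⌊log₂n⌋≤n : ∀ n .{{_ : NonZero n}} → 2 ^ ⌊log₂ n ⌋ ≤ n
2^⌊log₂n⌋≤n n = bound n (<-wellFounded n)
  where
  bound : ∀ n .{{_ : NonZero n}} (a : Acc _<_ n) → 2 ^ ⌊log2⌋ n a ≤ n
  bound 1 _ = ≤-refl
  bound (suc (suc n)) (acc rs) = begin
    2 * 2 ^ ⌊log2⌋ (suc ⌊ n /2⌋) _     ≤⟨ *-monoʳ-≤ 2 (bound (suc ⌊ n /2⌋) _) ⟩
    2 * suc ⌊ n /2⌋                    ≡⟨ *-suc 2 ⌊ n /2⌋ ⟩
    2 + (⌊ n /2⌋ + (⌊ n /2⌋ + 0))      ≡⟨ cong (λ z → 2 + (⌊ n /2⌋ + z)) (+-identityʳ ⌊ n /2⌋) ⟩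
    2 + (⌊ n /2⌋ + ⌊ n /2⌋)            ≤⟨ +-monoʳ-≤ 2 (+-monoʳ-≤ ⌊ n /2⌋ (⌊n/2⌋≤⌈n/2⌉ n)) ⟩
    2 + (⌊ n /2⌋ + ⌈ n /2⌉)            ≡⟨ cong (2 +_) (⌊n/2⌋+⌈n/2⌉≡n n) ⟩
    2 + n                              ∎
    where open ≤-Reasoning

n<2^[1+⌊log₂n⌋] : ∀ n → n < 2 ^ suc ⌊log₂ n ⌋
n<2^[1+⌊log₂n⌋] n with n <? 2 ^ suc ⌊log₂ n ⌋
... | yes n< = n<
... | no  n≮ = contradiction (⌊log₂⌋-mono-≤ (≮⇒≥ n≮))
                 (<⇒≱ (≤-reflexive (sym (⌊log₂[2^n]⌋≡n (suc ⌊log₂ n ⌋)))))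

-- The data structure

lights-light : ∀ k i t {x} → x ∈ lights k i t → weight i (high k x) ≤ t
lights-light k i t x∈ = ≤-pred (<ᵇ⇒< _ _ (proj₂ (∈-filter⁻ _ {xs = upTo (2 ^ (k + i))} x∈)))

∈-lights : ∀ k i t {x} → x < 2 ^ (k + i) → weight i (high k x) ≤ t → x ∈ lights k i t
∈-lights k i t x< light = ∈-filter⁺ _ (∈-upTo⁺ x<) (<⇒<ᵇ (s≤s light))

lights< : ∀ k i t {x} → x ∈ lights k i t → x < 2 ^ (k + i)
lights< k i t x∈ = ∈-upTo⁻ (proj₁ (∈-filter⁻ _ x∈))

length-lights≤ : ∀ k i t → length (lights k i t) ≤ 2 ^ (k + i)
length-lights≤ k i t = ≤-trans (length-filter _ (upTo (2 ^ (k + i)))) (≤-reflexive (length-upTo (2 ^ (k + i))))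

n<2^n : ∀ n → n < 2 ^ n
n<2^n zero    = z<s
n<2^n (suc n) = ≤-trans (+-mono-≤ (m^n>0 2 n) (n<2^n n)) (≤-reflexive (cong (2 ^ n +_) (sym (+-identityʳ _))))

module Structure (K E : ℕ) .{{_ : NonZero E}} where

  -- The factor 2 provides for the logarithmic cost of an iteration: `2 ^ (⌊log₂ n ⌋ / E)` absorbs
  -- it and as much again remains as gain.
  threshold : ℕ → ℕ
  threshold n = 2 * (⌊log₂ n ⌋ / E)

  -- `highBits n d` is the minimum of `d` and `⌊log₂ n ⌋`, in a form that makes both parts add up to
  -- `d` without a case distinction.
  lowBits highBits : ℕ → ℕ → ℕ
  lowBits  n d = d ∸ ⌊log₂ n ⌋
  highBits n d = d ∸ lowBits n d

  low+high : ∀ n d → lowBits n d + highBits n d ≡ d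
  low+high n d = m+[n∸m]≡n (m∸n≤m d ⌊log₂ n ⌋)

  highBits≤ : ∀ n d → highBits n d ≤ ⌊log₂ n ⌋
  highBits≤ n d = m≤n+o⇒m∸n≤o d (lowBits n d) (≤-trans (m≤n+m∸n d ⌊log₂ n ⌋) (≤-reflexive (+-comm ⌊log₂ n ⌋ _)))

  lightTable : ∀ n d (k i : ℕ) → Input n d → List ℕ
  lightTable n d k i S = table (answer d (codes (sort S))) (lights k i (threshold n))

  -- The first word is the initial step of both binary searches. A search needs a length below twice
  -- its first step: the table has at most `2 ^ d` entries, and `n` is below `2 ^ suc ⌊log₂ n ⌋`.
  auxiliaryWords : ∀ n d → Input n d → List ℕ
  auxiliaryWords n d S = 2 ^ (d + ⌊log₂ n ⌋) ∷ length tb ∷ tb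
    where tb = lightTable n d (lowBits n d) (highBits n d) S

  -- The table has an entry for every light vector, so that a heavy query is
  -- recognised by its absence.
  index : OVIndex
  index = record
    { wordFactor = K + 6
    ; arrange    = sort
    ; arrange-↭  = sort-↭
    ; auxiliary  = λ {n} {d} S → map word (auxiliaryWords n d S)
    ; query      = queryProgram
    }

  Admissible : ℕ → ℕ → Set
  Admissible n d = d ≤ K * suc ⌊log₂ n ⌋

  extra : ∀ n d → Input n d → BitVec d → ℕ
  extra n d S v with weight (highBits n d) (high (lowBits n d) (code v)) ≤? threshold n
  ... | yes _ = 0
  -- The unsorted input: the sum does not depend on the order, and the expectation is taken over `S`
  -- itself.
  ... | no  _ = Measure.total (lowBits n d) (highBits n d) (code v) (codes S)

  timeBound : ∀ n d → Input n d → BitVec d → ℕ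
  timeBound n d S v = 100 * suc (d + ⌊log₂ n ⌋) * suc (extra n d S v)

  -- `k` and `i` are variables because the light numbers and the measure live at width `k + i`,
  -- which is only propositionally equal to `d`.
  module Query {n d k i : ℕ} (k+i≡d : k + i ≡ d) (admissible : Admissible n d)
               (S : Input n d) (v : BitVec d)
               (memory≡ : memory index S ≡
                  map word (codes (sort S) ++ 2 ^ (d + ⌊log₂ n ⌋) ∷ length (lightTable n d k i S) ∷ lightTable n d k i S))
               where

    w L V : ℕ
    w = wordSize index n
    L = ⌊log₂ n ⌋
    V = 2 ^ (d + L)

    xs ks tb : List ℕ
    xs = codes (sort S)
    ks = lights k i (threshold n)
    tb = lightTable n d k i S

    -- The origin of the word factor `K + 6`: `K` covers `d`, and 6 covers both `⌊log₂ n ⌋` and six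
    -- spare bits. All words that occur are at most `8 * V`.
    64V≤2^w : 64 * V ≤ 2 ^ w
    64V≤2^w = ≤-trans (≤-reflexive (sym (^-distribˡ-+-* 2 6 (d + L)))) (^-monoʳ-≤ 2 (begin
      6 + (d + L)                ≤⟨ +-monoʳ-≤ 6 (+-mono-≤ admissible (m≤m+n L (5 * L))) ⟩
      6 + (K * suc L + 6 * L)    ≡⟨ rearrange K L ⟩
      (K + 6) * suc L            ∎))
      where
      open ≤-Reasoning
      rearrange : ∀ K L → 6 + (K * suc L + 6 * L) ≡ (K + 6) * suc L
      rearrange = solve-∀

    fits : ∀ {x} → x ≤ 8 * V → x < 2 ^ w
    fits x≤ = <-≤-trans (≤-<-trans x≤ (*-monoˡ-< V {{m^n≢0 2 (d + L)}} (m≤m+n 9 55))) 64V≤2^w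

    2^d≤V : 2 ^ d ≤ V
    2^d≤V = ^-monoʳ-≤ 2 (m≤m+n d L)

    1≤V : 1 ≤ V
    1≤V = m^n>0 2 (d + L)

    length-xs : length xs ≡ n
    length-xs = length-codes (sort S)

    n<2V : n < 2 * V
    n<2V = <-≤-trans (n<2^[1+⌊log₂n⌋] n) (*-monoʳ-≤ 2 (^-monoʳ-≤ 2 (m≤n+m L d)))

    xs<2V : length xs < 2 * V
    xs<2V = subst (_< 2 * V) (sym length-xs) n<2V

    ks< : ∀ {x} → x ∈ ks → x < 2 ^ d
    ks< x∈ = subst (λ z → _ < 2 ^ z) k+i≡d (lights< k i (threshold n) x∈)

    tb≤V : length tb ≤ V
    tb≤V = ≤-trans (≤-reflexive (length-map _ ks))
           (≤-trans (length-lights≤ k i (threshold n)) (≤-trans (≤-reflexive (cong (2 ^_) k+i≡d)) 2^d≤V))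

    words-fit : All (_< 2 ^ w) (xs ++ V ∷ length tb ∷ tb)
    words-fit = All.++⁺
      (All.tabulate (λ x∈ → fits (≤-trans (<⇒≤ (∈-codes (sort S) x∈)) (≤-trans 2^d≤V (m≤m+n V (7 * V))))))
      (fits (m≤m+n V (7 * V)) ∷ fits (≤-trans tb≤V (m≤m+n V (7 * V))) ∷
       All.map⁺ (All.tabulate (λ {x} x∈ → fits (begin
         x * 2 + answer d xs x     ≤⟨ +-mono-≤ (*-monoˡ-≤ 2 (≤-trans (<⇒≤ (ks< x∈)) 2^d≤V)) (≤-trans (answer≤1 d xs x) 1≤V) ⟩
         V * 2 + V                 ≤⟨ m≤m+n (V * 2 + V) (5 * V) ⟩
         V * 2 + V + 5 * V         ≡⟨ collect V ⟩
         8 * V                     ∎))))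
      where
      open ≤-Reasoning
      collect : ∀ V → V * 2 + V + 5 * V ≡ 8 * V
      collect = solve-∀

    memory≈ : ∀ a → value (cell (memory index S) a) ≡ get (xs ++ V ∷ length tb ∷ tb) a
    memory≈ a = trans (cong (λ m → value (cell m a)) memory≡) (cell-word words-fit a)

    offsets : length xs + V < 2 ^ w
    offsets = fits (≤-trans (+-monoˡ-≤ V (<⇒≤ xs<2V)) (≤-trans (m≤m+n _ (5 * V)) (≤-reflexive (collect V))))
      where
      collect : ∀ V → 2 * V + V + 5 * V ≡ 8 * V
      collect = solve-∀

    offsets′ : length tb + V < 2 ^ w
    offsets′ = fits (≤-trans (+-monoˡ-≤ V tb≤V) (≤-trans (m≤m+n _ (6 * V)) (≤-reflexive (collect V))))
      where
      collect : ∀ V → V + V + 6 * V ≡ 8 * V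
      collect = solve-∀

    addresses : length xs + 1 + 1 + length tb < 2 ^ w
    addresses = fits (≤-trans (+-mono-≤ (+-mono-≤ (+-mono-≤ (<⇒≤ xs<2V) 1≤V) 1≤V) tb≤V)
                              (≤-trans (m≤m+n _ (3 * V)) (≤-reflexive (collect V))))
      where
      collect : ∀ V → 2 * V + V + V + V + 3 * V ≡ 8 * V
      collect = solve-∀

    module Answer = Answering (memory index S) (code v) d (d + L) xs
      (sorted⇒Monotonic (sort-sorted S)) (λ i< → ∈-codes (sort S) (get-∈ xs i<)) (code<2^d v)
      (answer d xs) (answer≤1 d xs) ks (lights-increasing k i (threshold n)) memory≈
      (fits (≤-trans (*-monoʳ-≤ 2 2^d≤V) (*-monoˡ-≤ V (m≤m+n 2 6))))
      offsets xs<2V offsets′ (≤-<-trans tb≤V (m<m+n V (≤-trans 1≤V (m≤m+n V 0)))) addresses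

    open Answer using (initial; lightTime; run-light; module Heavy)
    open Machine (memory index S) (get (xs ++ V ∷ length tb ∷ tb)) memory≈ using (_~_; Run; run)

    start~initial : start index n v ~ initial
    start~initial 0 = value-word {w} (fits (≤-trans (<⇒≤ (code<2^d v)) (≤-trans 2^d≤V (m≤m+n V (7 * V)))))
    start~initial 1 = trans (value-word {w} (fits (≤-trans (<⇒≤ n<2V) (*-monoˡ-≤ V (m≤m+n 2 6))))) (sym length-xs)
    start~initial 2 = value-word {w} (fits (≤-trans (<⇒≤ (n<2^n d)) (≤-trans 2^d≤V (m≤m+n V (7 * V)))))
    start~initial (suc (suc (suc r))) = trans (value-word {w} (m^n>0 2 w)) (sym (get-replicate 18 r))
      where
      get-replicate : ∀ k r → get (List.replicate k 0) r ≡ 0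
      get-replicate zero    r       = refl
      get-replicate (suc k) zero    = refl
      get-replicate (suc k) (suc r) = get-replicate k r

    finish : ∀ {b σ} → Run queryProgram initial b σ → (get σ 0 ≢ 0 ⇔ Found d xs (code v)) →
             ∃[ t ] AnswersIn index S v t × t ≤ b
    finish program⇓ correct with run program⇓ start~initial
    ... | t , ρ , ⇓ρ , t≤b , ρ~σ =
      t , (ρ , ⇓ρ , Found⇔Any S v ⇔-∘ (correct ⇔-∘ mk⇔ (subst (_≢ 0) (ρ~σ 0)) (subst (_≢ 0) (sym (ρ~σ 0))))) , t≤b

    answer-light : weight i (high k (code v)) ≤ threshold n →
                   ∃[ t ] AnswersIn index S v t × t ≤ 100 * suc (d + L)
    answer-light light = conclude (run-light (proj₁ (proj₂ position)) (proj₂ (proj₂ position)))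
      where
      position : ∃[ j ] j < length ks × get ks j ≡ code v
      position = ∈-get (∈-lights k i (threshold n) (subst (λ z → code v < 2 ^ z) (sym k+i≡d) (code<2^d v)) light)

      bound : lightTime ≤ 100 * suc (d + L)
      bound = ≤-trans (m≤m+n lightTime (89 * (d + L) + 71)) (≤-reflexive (total (d + L)))
        where
        total : ∀ τ → 7 + (2 + (suc τ * 11 + 1) + 8) + (89 * τ + 71) ≡ 100 * suc τ
        total = solve-∀

      conclude : ∃[ σ ] Run queryProgram initial lightTime σ × get σ 0 ≡ answer d xs (code v) →
                 ∃[ t ] AnswersIn index S v t × t ≤ 100 * suc (d + L)
      conclude (_ , program⇓ , σ₀≡) =
        map₂ (map₂ (λ t≤ → ≤-trans t≤ bound))
             (finish program⇓ (subst (λ z → z ≢ 0 ⇔ Found d xs (code v)) (sym σ₀≡) (answer⇔Found d xs (code v))))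

    answer-heavy : ¬ weight i (high k (code v)) ≤ threshold n →
                   ∃[ t ] AnswersIn index S v t × t ≤ 100 * suc (d + L) * suc (Measure.total k i (code v) (codes S))
    answer-heavy heavy = conclude (run-heavy v∉)
      where
      open Measure k i (code v) (codes S)
      open Heavy progressTo total
        (λ y≤ → progress≤total (subst (λ z → _ ≤ 2 ^ z) (sym k+i≡d) y≤))
        (λ {y} ⊥y j< y≤u _ u<y′ →
          progress< (subst (λ z → orth z y (code v) ≡ true) (sym k+i≡d) ⊥y) (sort-∈ S (get-∈ xs j<)) y≤u u<y′)

      v∉ : ∀ {j} → j < length ks → get ks j ≢ code v
      v∉ j< e = heavy (lights-light k i (threshold n) (subst (_∈ ks) e (get-∈ ks j<)))

      bound : heavyTime ≤ 100 * suc (d + L) * suc total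
      -- The omitted summand is the slack up to the constant 100; written out in `identity`, it
      -- turns the estimate into a ring identity.
      bound = ≤-trans (m≤m+n heavyTime _) (≤-reflexive (identity d L total))
        where
        identity : ∀ d L B →
          7 + (2 + (suc (d + L) * 11 + 1) + (9 + (suc B * suc (2 + (2 + (suc (d + L) * 11 + 1) + (3 + (5 + (d * 13 + 1) + 4)))) + 1)))
            + (B * (11 * (d + L) + 31) + (65 * (d + L) + 39) * suc B + 13 * L * suc B)
          ≡ 100 * suc (d + L) * suc B
        identity = solve-∀

      conclude : ∃[ σ ] Run queryProgram initial heavyTime σ × (get σ 0 ≢ 0 ⇔ Found d xs (code v)) →
                 ∃[ t ] AnswersIn index S v t × t ≤ 100 * suc (d + L) * suc total
      conclude (_ , program⇓ , correct) = map₂ (map₂ (λ t≤ → ≤-trans t≤ bound)) (finish program⇓ correct)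

  memory-words : ∀ {n d} (S : Input n d) → memory index S ≡ map word (codes (sort S) ++ auxiliaryWords n d S)
  memory-words {n} {d} S = 
    trans (cong (_++ map word (auxiliaryWords n d S)) (map-∘ (toList (sort S))))
          (sym (map-++ word (codes (sort S)) (auxiliaryWords n d S)))

  answers : ∀ n d → Admissible n d → (S : Input n d) (v : BitVec d) →
            ∃[ t ] AnswersIn index S v t × t ≤ timeBound n d S v
  answers n d admissible S v with weight (highBits n d) (high (lowBits n d) (code v)) ≤? threshold n
  ... | yes light = map₂ (map₂ (λ t≤ → ≤-trans t≤ (≤-reflexive (sym (*-identityʳ _))))) (answer-light light)
    where open Query {n} {d} {lowBits n d} {highBits n d} (low+high n d) admissible S v (memory-words S)
  ... | no  heavy = answer-heavy heavy
    where open Query {n} {d} {lowBits n d} {highBits n d} (low+high n d) admissible S v (memory-words S)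

  admissible? : ∀ n d → Dec (Admissible n d)
  admissible? n d = d ≤? K * suc ⌊log₂ n ⌋

  -- The running time is read off from the constructed execution. The value 0 is a default for
  -- dimensions that are too large for the word size; by `dimension≤`, every `d ≈ c log₂ n` takes
  -- the first branch.
  time : QueryTime
  time n d S v with admissible? n d
  ... | yes admissible = proj₁ (answers n d admissible S v)
  ... | no  _          = 0

  time-answers : ∀ {n d} → Admissible n d → (S : Input n d) (v : BitVec d) → AnswersIn index S v (time n d S v)
  time-answers {n} {d} admissible S v with admissible? n d
  ... | yes adm = proj₁ (proj₂ (answers n d adm S v))
  ... | no ¬adm = contradiction admissible ¬adm

  time≤ : ∀ n d (S : Input n d) (v : BitVec d) → time n d S v ≤ timeBound n d S v
  time≤ n d S v with admissible? n d
  ... | yes adm = proj₂ (proj₂ (answers n d adm S v))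
  ... | no _    = z≤n

-- Expected query time

length-bitVecs : ∀ d → length (bitVecs d) ≡ 2 ^ d
length-bitVecs d = length-sequences _ d

length-allInputs : ∀ n d → length (allInputs n d) ≡ 2 ^ (d * n)
length-allInputs n d = trans (length-sequences (bitVecs d) n)
                             (trans (cong (_^ n) (length-bitVecs d)) (^-*-assoc 2 d n))

-- A uniform vector has high bits orthogonal to `q` with probability `2 ^ (- weight i q)`, so `n` of
-- them contain `n * 2 ^ (- weight i q)` such vectors on average.
sumOver-orth : ∀ n k i q →
  sumOver (λ S → sumOver (λ c → ind (orth i (high k c) q)) (codes S)) (allInputs n (k + i)) * 2 ^ weight i q
  ≡ n * 2 ^ ((k + i) * n)
sumOver-orth n k i q = *-cancelˡ-≡ (F * W) (n * 2 ^ (e * n)) (2 ^ e) {{m^n≢0 2 e}} (begin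
  2 ^ e * (F * W)                         ≡⟨ cong₂ (λ a b → a * (b * W)) (sym (length-bitVecs e))
                                               (sumOver-cong (λ S → sumOver-map g code (toList S)) (allInputs n e)) ⟩
  length vs * (F′ * W)                    ≡⟨ *-assoc (length vs) F′ W ⟨
  length vs * F′ * W                      ≡⟨ cong (_* W) (sumOver-sequences (g ∘ code) vs n) ⟩
  n * (sumOver (g ∘ code) vs * length vs ^ n) * W
    ≡⟨ cong₂ (λ a b → n * (a * b) * W) (trans (sumOver-code g e) (sumTo-high (λ p → ind (orth i p q)) k i))
             (trans (cong (_^ n) (length-bitVecs e)) (^-*-assoc 2 e n)) ⟩
  n * (2 ^ k * orthCount i q * 2 ^ (e * n)) * W ≡⟨ rearrange n (2 ^ k) (orthCount i q) (2 ^ (e * n)) W ⟩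
  2 ^ k * (orthCount i q * W) * (n * 2 ^ (e * n)) ≡⟨ cong (λ z → 2 ^ k * z * (n * 2 ^ (e * n))) (orthCount-weight i q) ⟩
  2 ^ k * 2 ^ i * (n * 2 ^ (e * n))       ≡⟨ cong (_* (n * 2 ^ (e * n))) (^-distribˡ-+-* 2 k i) ⟨
  2 ^ e * (n * 2 ^ (e * n))               ∎)
  where
  open ≡-Reasoning
  e = k + i
  vs = bitVecs e
  g : ℕ → ℕ
  g c = ind (orth i (high k c) q)
  F = sumOver (λ S → sumOver g (codes S)) (allInputs n e)
  F′ = sumOver (λ S → sumOver (g ∘ code) (toList S)) (sequences vs n)
  W = 2 ^ weight i q
  rearrange : ∀ n a c p w → n * (a * c * p) * w ≡ a * (c * w) * (n * p)
  rearrange = solve-∀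

module _ (n r s : ℕ) (n< : n < 2 ^ suc (r + s)) where

  -- On average, the single 1 and the orthogonal prefixes contribute at most `2 ^ r` each, and the
  -- vectors with such a prefix at most `2 * 2 ^ r`, because `n` is below `2 * 2 ^ (r + s)`.
  sumOver-suc-total : ∀ {k i d} → k + i ≡ d → i ≤ r + s → ∀ v → s ≤ weight i (high k v) →
    sumOver (λ S → suc (Measure.total k i v (codes S))) (allInputs n d) ≤ 4 * 2 ^ r * 2 ^ (d * n)
  sumOver-suc-total {k} {i} refl i≤ v s≤w = begin
    sumOver (λ S → suc N + X S) (allInputs n (k + i))
      ≡⟨ sumOver-+ (λ _ → suc N) X (allInputs n (k + i)) ⟩
    sumOver (λ _ → suc N) (allInputs n (k + i)) + F
      ≡⟨ cong (_+ F) (trans (sumOver-const (suc N) (allInputs n (k + i))) (cong (_* suc N) (length-allInputs n (k + i)))) ⟩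
    P * suc N + F
      ≤⟨ +-mono-≤ (*-monoʳ-≤ P (+-mono-≤ (m^n>0 2 r) N≤)) F≤ ⟩
    P * (2 ^ r + 2 ^ r) + 2 * 2 ^ r * P
      ≡⟨ collect P (2 ^ r) ⟩
    4 * 2 ^ r * P ∎
    where
    open ≤-Reasoning
    q = high k v
    N = orthCount i q
    P = 2 ^ ((k + i) * n)
    X : Input n (k + i) → ℕ
    X S = sumOver (λ c → ind (orth i (high k c) q)) (codes S)
    F = sumOver X (allInputs n (k + i))
    collect : ∀ P R → P * (R + R) + 2 * R * P ≡ 4 * R * P
    collect = solve-∀
    2^s≤ : 2 ^ s ≤ 2 ^ weight i q
    2^s≤ = ^-monoʳ-≤ 2 s≤w
    N≤ : N ≤ 2 ^ r
    N≤ = *-cancelʳ-≤ N (2 ^ r) (2 ^ s) {{m^n≢0 2 s}} (begin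
      N * 2 ^ s            ≤⟨ *-monoʳ-≤ N 2^s≤ ⟩
      N * 2 ^ weight i q   ≡⟨ orthCount-weight i q ⟩
      2 ^ i                ≤⟨ ^-monoʳ-≤ 2 i≤ ⟩
      2 ^ (r + s)          ≡⟨ ^-distribˡ-+-* 2 r s ⟩
      2 ^ r * 2 ^ s        ∎)
    F≤ : F ≤ 2 * 2 ^ r * P
    F≤ = *-cancelʳ-≤ F (2 * 2 ^ r * P) (2 ^ s) {{m^n≢0 2 s}} (begin
      F * 2 ^ s                 ≤⟨ *-monoʳ-≤ F 2^s≤ ⟩
      F * 2 ^ weight i q        ≡⟨ sumOver-orth n k i q ⟩
      n * P                     ≤⟨ *-monoˡ-≤ P (<⇒≤ n<) ⟩
      2 * 2 ^ (r + s) * P       ≡⟨ cong (λ z → 2 * z * P) (^-distribˡ-+-* 2 r s) ⟩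
      2 * (2 ^ r * 2 ^ s) * P   ≡⟨ rearrange (2 ^ r) (2 ^ s) P ⟩
      2 * 2 ^ r * P * 2 ^ s     ∎)
      where
      rearrange : ∀ a b p → 2 * (a * b) * p ≡ 2 * a * p * b
      rearrange = solve-∀

module ExpectedTime (K E : ℕ) .{{_ : NonZero E}} (2≤E : 2 ≤ E) where

  open Structure K E

  gain : ℕ → ℕ
  gain n = ⌊log₂ n ⌋ / E

  threshold≤ : ∀ n → threshold n ≤ ⌊log₂ n ⌋
  threshold≤ n = begin
    2 * gain n       ≤⟨ *-monoˡ-≤ (gain n) 2≤E ⟩
    E * gain n       ≡⟨ *-comm E (gain n) ⟩
    gain n * E       ≤⟨ m/n*n≤m ⌊log₂ n ⌋ E ⟩
    ⌊log₂ n ⌋        ∎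
    where open ≤-Reasoning

  remaining : ℕ → ℕ
  remaining n = ⌊log₂ n ⌋ ∸ threshold n

  split-log : ∀ n → remaining n + threshold n ≡ ⌊log₂ n ⌋
  split-log n = m∸n+n≡m (threshold≤ n)

  sum-extra : ∀ n d v → sumOver (λ S → suc (extra n d S v)) (allInputs n d) ≤ 4 * 2 ^ remaining n * 2 ^ (d * n)
  sum-extra n d v with weight (highBits n d) (high (lowBits n d) (code v)) ≤? threshold n
  ... | yes _ = begin
    sumOver (λ _ → 1) (allInputs n d)  ≡⟨ trans (sym (length≡sumOver (allInputs n d))) (length-allInputs n d) ⟩
    2 ^ (d * n)                        ≡⟨ *-identityˡ _ ⟨
    1 * 2 ^ (d * n)                    ≤⟨ *-monoˡ-≤ (2 ^ (d * n)) (≤-trans (m^n>0 2 (remaining n)) (m≤m+n _ _)) ⟩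
    4 * 2 ^ remaining n * 2 ^ (d * n)  ∎
    where open ≤-Reasoning
  ... | no heavy = sumOver-suc-total n (remaining n) (threshold n)
      (subst (λ z → n < 2 ^ suc z) (sym (split-log n)) (n<2^[1+⌊log₂n⌋] n))
      (low+high n d) (≤-trans (highBits≤ n d) (≤-reflexive (sym (split-log n)))) (code v) (<⇒≤ (≰⇒> heavy))

  -- Here the logarithmic factor is traded for one of the two factors `2 ^ gain n` that a heavy
  -- query saves.
  suc-log≤ : ∀ n → suc ⌊log₂ n ⌋ ≤ E * 2 ^ gain n
  suc-log≤ n = begin
    suc ⌊log₂ n ⌋                                      ≡⟨ cong suc (m≡m%n+[m/n]*n ⌊log₂ n ⌋ E) ⟩
    suc (⌊log₂ n ⌋ % E) + gain n * E                   ≤⟨ +-monoˡ-≤ (gain n * E) (m%n<n ⌊log₂ n ⌋ E) ⟩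
    suc (gain n) * E                                   ≤⟨ *-monoˡ-≤ E (n<2^n (gain n)) ⟩
    2 ^ gain n * E                                     ≡⟨ *-comm (2 ^ gain n) E ⟩
    E * 2 ^ gain n                                     ∎
    where open ≤-Reasoning

  factor : ℕ
  factor = 400 * suc K * E

  sum-time : ∀ n d → Admissible n d → (v : BitVec d) →
    sumOver (λ S → time n d S v) (allInputs n d) ≤ factor * 2 ^ (gain n + remaining n) * 2 ^ (d * n)
  sum-time n d admissible v = begin
    sumOver (λ S → time n d S v) (allInputs n d)
      ≤⟨ sumOver-mono-≤ (λ S → time≤ n d S v) (allInputs n d) ⟩
    sumOver (λ S → 100 * suc (d + L) * suc (extra n d S v)) (allInputs n d)
      ≡⟨ sumOver-*ˡ (100 * suc (d + L)) (λ S → suc (extra n d S v)) (allInputs n d) ⟩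
    100 * suc (d + L) * sumOver (λ S → suc (extra n d S v)) (allInputs n d)
      ≤⟨ *-mono-≤ (*-monoʳ-≤ 100 words) (sum-extra n d v) ⟩
    100 * (suc K * (E * 2 ^ gain n)) * (4 * 2 ^ remaining n * 2 ^ (d * n))
      ≡⟨ rearrange K E (2 ^ gain n) (2 ^ remaining n) (2 ^ (d * n)) ⟩
    factor * (2 ^ gain n * 2 ^ remaining n) * 2 ^ (d * n)
      ≡⟨ cong (λ z → factor * z * 2 ^ (d * n)) (^-distribˡ-+-* 2 (gain n) (remaining n)) ⟨
    factor * 2 ^ (gain n + remaining n) * 2 ^ (d * n) ∎
    where
    open ≤-Reasoning
    L = ⌊log₂ n ⌋
    rearrange : ∀ K E a r p → 100 * (suc K * (E * a)) * (4 * r * p) ≡ 400 * suc K * E * (a * r) * p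
    rearrange = solve-∀
    words : suc (d + L) ≤ suc K * (E * 2 ^ gain n)
    words = begin
      suc (d + L)              ≤⟨ s≤s (+-monoˡ-≤ L admissible) ⟩
      suc (K * suc L + L)      ≡⟨ cong suc (+-comm (K * suc L) L) ⟩
      suc K * suc L            ≤⟨ *-monoʳ-≤ (suc K) (suc-log≤ n) ⟩
      suc K * (E * 2 ^ gain n) ∎

-- Exponents

^-distribʳ-* : ∀ m n k → (m * n) ^ k ≡ m ^ k * n ^ k
^-distribʳ-* m n zero    = refl
^-distribʳ-* m n (suc k) rewrite ^-distribʳ-* m n k = interchange m n (m ^ k) (n ^ k)
  where
  interchange : ∀ a b c d → a * b * (c * d) ≡ a * c * (b * d)
  interchange = solve-∀

^-cancelˡ-≤ : ∀ k .{{_ : NonZero k}} {m n} → m ^ k ≤ n ^ k → m ≤ n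
^-cancelˡ-≤ k {m} {n} m^k≤n^k with m ≤? n
... | yes m≤n = m≤n
... | no  m≰n = contradiction (^-monoˡ-< k (≰⇒> m≰n)) (≤⇒≯ m^k≤n^k)

^-swap : ∀ m k l → (m ^ k) ^ l ≡ (m ^ l) ^ k
^-swap m k l = trans (^-*-assoc m k l) (trans (cong (m ^_) (*-comm k l)) (sym (^-*-assoc m l k)))

-- A form of Bernoulli's inequality (1 - 1 / (1 + X))^m ≥ 1 - m / (1 + X).
bernoulli : ∀ X m y → m + y ≡ X → suc y * suc X ^ m ≤ suc X * X ^ m
bernoulli X zero    y refl = ≤-refl
bernoulli X (suc m) y refl = begin
  suc y * (suc X * suc X ^ m)   ≡⟨ *-assoc (suc y) (suc X) (suc X ^ m) ⟨
  suc y * suc X * suc X ^ m     ≤⟨ *-monoˡ-≤ (suc X ^ m) (≤-trans (m≤m+n _ m) (≤-reflexive (expand m y))) ⟩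
  X * suc (suc y) * suc X ^ m   ≡⟨ *-assoc X (suc (suc y)) (suc X ^ m) ⟩
  X * (suc (suc y) * suc X ^ m) ≤⟨ *-monoʳ-≤ X (bernoulli X m (suc y) (+-suc m y)) ⟩
  X * (suc X * X ^ m)           ≡⟨ swap X (suc X) (X ^ m) ⟩
  suc X * (X * X ^ m)           ∎
  where
  open ≤-Reasoning
  expand : ∀ m y → suc y * suc (suc m + y) + m ≡ (suc m + y) * suc (suc y)
  expand = solve-∀
  swap : ∀ a b c → a * (b * c) ≡ b * (a * c)
  swap = solve-∀

-- Bernoulli with `X = 2 * F` and `m = y = F` bounds the quotient of the powers by
-- `(1 + 2 * F) / (1 + F)`, which is below 2.
[1+2F]^F≤2[2F]^F : ∀ F → suc (2 * F) ^ F ≤ 2 * (2 * F) ^ F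
[1+2F]^F≤2[2F]^F F = *-cancelˡ-≤ (suc F) (begin
  suc F * suc (2 * F) ^ F        ≤⟨ bernoulli (2 * F) F F (cong (F +_) (sym (+-identityʳ F))) ⟩
  suc (2 * F) * (2 * F) ^ F      ≤⟨ *-monoˡ-≤ ((2 * F) ^ F) (≤-trans (n≤1+n _) (≤-reflexive (sym (*-suc 2 F)))) ⟩
  2 * suc F * (2 * F) ^ F        ≡⟨ swap (suc F) ((2 * F) ^ F) ⟩
  suc F * (2 * (2 * F) ^ F)      ∎)
  where
  open ≤-Reasoning
  swap : ∀ a b → 2 * a * b ≡ a * (2 * b)
  swap = solve-∀

-- With X = 2 F = 2^j, the bound (1 + 1 / X)^i X^t is at most 2^(i / F + j t).
lightCount-power : ∀ j F → 2 * F ≡ 2 ^ j → ∀ i t →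
                   lightCount i t ^ F ≤ 2 ^ i * 2 ^ (j * (t * F))
lightCount-power j F X≡ i t = *-cancelʳ-≤ (c ^ F) (2 ^ i * 2 ^ (j * (t * F))) ((X ^ i) ^ F) {{m^n≢0 (X ^ i) F {{m^n≢0 X i {{X≢0}}}}}} (begin
  c ^ F * (X ^ i) ^ F                     ≡⟨ ^-distribʳ-* c (X ^ i) F ⟨
  (c * X ^ i) ^ F                         ≤⟨ ^-monoˡ-≤ F (lightCount-bound X (>-nonZero⁻¹ X {{X≢0}}) i t) ⟩
  (suc X ^ i * X ^ t) ^ F                 ≡⟨ ^-distribʳ-* (suc X ^ i) (X ^ t) F ⟩
  (suc X ^ i) ^ F * (X ^ t) ^ F           ≡⟨ cong₂ _*_ (^-swap (suc X) i F) (^-*-assoc X t F) ⟩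
  (suc X ^ F) ^ i * X ^ (t * F)           ≤⟨ *-monoˡ-≤ (X ^ (t * F)) (^-monoˡ-≤ i ([1+2F]^F≤2[2F]^F F)) ⟩
  (2 * X ^ F) ^ i * X ^ (t * F)           ≡⟨ cong₂ _*_ (trans (^-distribʳ-* 2 (X ^ F) i) (cong (2 ^ i *_) (^-swap X F i)))
                                                       (trans (cong (_^ (t * F)) X≡) (^-*-assoc 2 j (t * F))) ⟩
  2 ^ i * (X ^ i) ^ F * 2 ^ (j * (t * F)) ≡⟨ rearrange (2 ^ i) ((X ^ i) ^ F) (2 ^ (j * (t * F))) ⟩
  2 ^ i * 2 ^ (j * (t * F)) * (X ^ i) ^ F ∎)
  where
  open ≤-Reasoning
  X = 2 * F
  c = lightCount i t
  X≢0 : NonZero X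
  X≢0 = subst NonZero (sym X≡) (m^n≢0 2 j)
  rearrange : ∀ a b c → a * b * c ≡ a * c * b
  rearrange = solve-∀

-- `p / q` is the exponent at which the space bound is tested, and `p′ / q′` is `p / q + 1 - 1 / G`,
-- which will lie above `c`. The low bits lower `p′ / q′` by 1, and the light prefixes add `1 / G`.
module Space {n d L G cnt p q p′ q′ : ℕ} .{{_ : NonZero G}} .{{_ : NonZero q′}} .{{_ : NonZero n}}
             (cnt^G≤2^L : cnt ^ G ≤ 2 ^ L) (2^L≤n : 2 ^ L ≤ n) (n< : n < 2 ^ suc L)
             (2^d≤ : (2 ^ d) ^ q′ ≤ 2 ^ q′ * n ^ p′)
             (p′/q′≡ : (p′ * G + q′) * q ≡ (p + q) * (q′ * G)) (q≤pG : q ≤ p * G) where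

  k c Q : ℕ
  k = d ∸ L
  -- At least 1, so that the product with `2 ^ k` can also absorb the two words in front of the
  -- table.
  c = cnt ⊔ 1
  Q = q * (q′ * G)

  c^G≤2^L : c ^ G ≤ 2 ^ L
  c^G≤2^L with ⊔-sel cnt 1
  ... | inj₁ c≡ = subst (λ z → z ^ G ≤ 2 ^ L) (sym c≡) cnt^G≤2^L
  ... | inj₂ c≡ = subst (λ z → z ^ G ≤ 2 ^ L) (sym c≡) (≤-trans (≤-reflexive (^-zeroˡ G)) (m^n>0 2 L))

  c^Q≤ : c ^ Q ≤ n ^ (q * q′)
  c^Q≤ = begin
    c ^ Q              ≡⟨ cong (c ^_) (rearrange q q′ G) ⟩
    c ^ (G * (q * q′)) ≡⟨ ^-*-assoc c G (q * q′) ⟨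
    (c ^ G) ^ (q * q′) ≤⟨ ^-monoˡ-≤ (q * q′) (≤-trans c^G≤2^L 2^L≤n) ⟩
    n ^ (q * q′)       ∎
    where
    open ≤-Reasoning
    rearrange : ∀ q q′ G → q * (q′ * G) ≡ G * (q * q′)
    rearrange = solve-∀

  power : (2 ^ k * c) ^ Q ≤ 4 ^ Q * n ^ (p * (q′ * G))
  power with L ≤? d
  -- Multiplication by `(2 ^ L) ^ Q` completes `2 ^ k` to `2 ^ d`. The two factors 2 in 4 come from
  -- the rounding of `d` and from `n < 2 ^ suc L`.
  ... | yes L≤d = *-cancelʳ-≤ ((2 ^ k * c) ^ Q) (4 ^ Q * n ^ (p * (q′ * G))) ((2 ^ L) ^ Q) {{m^n≢0 (2 ^ L) Q {{m^n≢0 2 L}}}} (begin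
    (2 ^ k * c) ^ Q * (2 ^ L) ^ Q               ≡⟨ ^-distribʳ-* (2 ^ k * c) (2 ^ L) Q ⟨
    (2 ^ k * c * 2 ^ L) ^ Q                     ≡⟨ cong (_^ Q) (trans (swap (2 ^ k) c (2 ^ L))
                                                     (cong (_* c) (trans (sym (^-distribˡ-+-* 2 k L)) (cong (2 ^_) (m∸n+n≡m L≤d))))) ⟩
    (2 ^ d * c) ^ Q                             ≡⟨ ^-distribʳ-* (2 ^ d) c Q ⟩
    (2 ^ d) ^ Q * c ^ Q                         ≤⟨ *-mono-≤ 2^d^Q≤ c^Q≤ ⟩
    2 ^ Q * n ^ (p′ * (q * G)) * n ^ (q * q′)   ≡⟨ *-assoc (2 ^ Q) (n ^ (p′ * (q * G))) (n ^ (q * q′)) ⟩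
    2 ^ Q * (n ^ (p′ * (q * G)) * n ^ (q * q′)) ≡⟨ cong (2 ^ Q *_) (trans (sym (^-distribˡ-+-* n (p′ * (q * G)) (q * q′)))
                                                     (trans (cong (n ^_) exponents) (^-distribˡ-+-* n (p * (q′ * G)) Q))) ⟩
    2 ^ Q * (n ^ (p * (q′ * G)) * n ^ Q)        ≤⟨ *-monoʳ-≤ (2 ^ Q) (*-monoʳ-≤ (n ^ (p * (q′ * G))) (^-monoˡ-≤ Q (<⇒≤ n<))) ⟩
    2 ^ Q * (n ^ (p * (q′ * G)) * (2 * 2 ^ L) ^ Q) ≡⟨ cong (λ z → 2 ^ Q * (n ^ (p * (q′ * G)) * z)) (^-distribʳ-* 2 (2 ^ L) Q) ⟩
    2 ^ Q * (n ^ (p * (q′ * G)) * (2 ^ Q * (2 ^ L) ^ Q)) ≡⟨ collect (2 ^ Q) (n ^ (p * (q′ * G))) ((2 ^ L) ^ Q) ⟩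
    2 ^ Q * 2 ^ Q * n ^ (p * (q′ * G)) * (2 ^ L) ^ Q ≡⟨ cong (λ z → z * n ^ (p * (q′ * G)) * (2 ^ L) ^ Q) (^-distribʳ-* 2 2 Q) ⟨
    4 ^ Q * n ^ (p * (q′ * G)) * (2 ^ L) ^ Q    ∎)
    where
    open ≤-Reasoning
    swap : ∀ a b c → a * b * c ≡ a * c * b
    swap = solve-∀
    collect : ∀ t m l → t * (m * (t * l)) ≡ t * t * m * l
    collect = solve-∀
    exponents : p′ * (q * G) + q * q′ ≡ p * (q′ * G) + Q
    exponents = trans (regroup p′ q G q′) (trans p′/q′≡ (*-distribʳ-+ (q′ * G) p q))
      where
      regroup : ∀ p′ q G q′ → p′ * (q * G) + q * q′ ≡ (p′ * G + q′) * q
      regroup = solve-∀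
    Q≡ : Q ≡ q′ * (q * G)
    Q≡ = reorder q q′ G
      where
      reorder : ∀ a b c → a * (b * c) ≡ b * (a * c)
      reorder = solve-∀
    2^d^Q≤ : (2 ^ d) ^ Q ≤ 2 ^ Q * n ^ (p′ * (q * G))
    2^d^Q≤ = begin
      (2 ^ d) ^ Q                               ≡⟨ trans (cong ((2 ^ d) ^_) Q≡) (sym (^-*-assoc (2 ^ d) q′ (q * G))) ⟩
      ((2 ^ d) ^ q′) ^ (q * G)                  ≤⟨ ^-monoˡ-≤ (q * G) 2^d≤ ⟩
      (2 ^ q′ * n ^ p′) ^ (q * G)               ≡⟨ ^-distribʳ-* (2 ^ q′) (n ^ p′) (q * G) ⟩
      (2 ^ q′) ^ (q * G) * (n ^ p′) ^ (q * G)   ≡⟨ cong₂ _*_ (trans (^-*-assoc 2 q′ (q * G)) (cong (2 ^_) (sym Q≡))) (^-*-assoc n p′ (q * G)) ⟩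
      2 ^ Q * n ^ (p′ * (q * G))                ∎
  -- Now there are no low bits, and the light prefixes fit because `p / q` is at least `1 / G`.
  ... | no  L≰d = begin
    (2 ^ k * c) ^ Q               ≡⟨ cong (λ z → (2 ^ z * c) ^ Q) (m≤n⇒m∸n≡0 (<⇒≤ (≰⇒> L≰d))) ⟩
    (1 * c) ^ Q                   ≡⟨ cong (_^ Q) (*-identityˡ c) ⟩
    c ^ Q                         ≤⟨ c^Q≤ ⟩
    n ^ (q * q′)                  ≤⟨ ^-monoʳ-≤ n (≤-trans (*-monoˡ-≤ q′ q≤pG) (≤-reflexive (reorder p G q′))) ⟩
    n ^ (p * (q′ * G))            ≡⟨ *-identityˡ _ ⟨
    1 * n ^ (p * (q′ * G))        ≤⟨ *-monoˡ-≤ (n ^ (p * (q′ * G))) (m^n>0 4 Q) ⟩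
    4 ^ Q * n ^ (p * (q′ * G))    ∎
    where
    open ≤-Reasoning
    reorder : ∀ p G q → p * G * q ≡ p * (q * G)
    reorder = solve-∀

  -- The constant is 3 times 4: a factor 3 for the two additional words, and 4 from `power`, whose
  -- common exponent `q′ * G` is cancelled here.
  bound : (2 + 2 ^ k * cnt) ^ q ≤ 12 ^ q * n ^ p
  bound = begin
    (2 + 2 ^ k * cnt) ^ q          ≤⟨ ^-monoˡ-≤ q (≤-trans (+-mono-≤ (*-monoʳ-≤ 2 1≤) (*-monoʳ-≤ (2 ^ k) (m≤m⊔n cnt 1))) (≤-reflexive (collect (2 ^ k * c)))) ⟩
    (3 * (2 ^ k * c)) ^ q          ≡⟨ ^-distribʳ-* 3 (2 ^ k * c) q ⟩
    3 ^ q * (2 ^ k * c) ^ q        ≤⟨ *-monoʳ-≤ (3 ^ q) root ⟩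
    3 ^ q * (4 ^ q * n ^ p)        ≡⟨ *-assoc (3 ^ q) (4 ^ q) (n ^ p) ⟨
    3 ^ q * 4 ^ q * n ^ p          ≡⟨ cong (_* n ^ p) (^-distribʳ-* 3 4 q) ⟨
    12 ^ q * n ^ p                 ∎
    where
    open ≤-Reasoning
    1≤ : 1 ≤ 2 ^ k * c
    1≤ = *-mono-≤ (m^n>0 2 k) (m≤n⊔m cnt 1)
    collect : ∀ x → 2 * x + x ≡ 3 * x
    collect = solve-∀
    root : (2 ^ k * c) ^ q ≤ 4 ^ q * n ^ p
    root = ^-cancelˡ-≤ (q′ * G) {{m*n≢0 q′ G}} (begin
      ((2 ^ k * c) ^ q) ^ (q′ * G)                 ≡⟨ ^-*-assoc (2 ^ k * c) q (q′ * G) ⟩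
      (2 ^ k * c) ^ Q                              ≤⟨ power ⟩
      4 ^ Q * n ^ (p * (q′ * G))                   ≡⟨ cong₂ _*_ (^-*-assoc 4 q (q′ * G)) (^-*-assoc n p (q′ * G)) ⟨
      (4 ^ q) ^ (q′ * G) * (n ^ p) ^ (q′ * G)      ≡⟨ ^-distribʳ-* (4 ^ q) (n ^ p) (q′ * G) ⟨
      (4 ^ q * n ^ p) ^ (q′ * G)                   ∎)

-- `qE≤` says that `p / q` is at least `1 - 1 / E`. The exponent `L / E + r` is `L` less one
-- `L / E`; rounding that quotient down costs at most 1 in the exponent, hence the factor 2.
saved-power : ∀ E .{{_ : NonZero E}} {n L r p q A} → r + 2 * (L / E) ≡ L → 2 ^ L ≤ n →
              q * E ≤ p * E + q → (A * 2 ^ (L / E + r)) ^ q ≤ (A * 2) ^ q * n ^ p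
saved-power E {n} {L} {r} {p} {q} {A} L≡ 2^L≤n qE≤ = begin
  (A * 2 ^ (a + r)) ^ q           ≡⟨ ^-distribʳ-* A (2 ^ (a + r)) q ⟩
  A ^ q * (2 ^ (a + r)) ^ q       ≡⟨ cong (A ^ q *_) (^-*-assoc 2 (a + r) q) ⟩
  A ^ q * 2 ^ ((a + r) * q)       ≤⟨ *-monoʳ-≤ (A ^ q) (^-monoʳ-≤ 2 exponent) ⟩
  A ^ q * 2 ^ (q + L * p)         ≡⟨ cong (A ^ q *_) (trans (^-distribˡ-+-* 2 q (L * p)) (cong (2 ^ q *_) (sym (^-*-assoc 2 L p)))) ⟩
  A ^ q * (2 ^ q * (2 ^ L) ^ p)   ≤⟨ *-monoʳ-≤ (A ^ q) (*-monoʳ-≤ (2 ^ q) (^-monoˡ-≤ p 2^L≤n)) ⟩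
  A ^ q * (2 ^ q * n ^ p)         ≡⟨ *-assoc (A ^ q) (2 ^ q) (n ^ p) ⟨
  A ^ q * 2 ^ q * n ^ p           ≡⟨ cong (_* n ^ p) (^-distribʳ-* A 2 q) ⟨
  (A * 2) ^ q * n ^ p             ∎
  where
  open ≤-Reasoning
  a = L / E
  L≤ : L ≤ a * E + E
  L≤ = ≤-trans (≤-reflexive (trans (m≡m%n+[m/n]*n L E) (+-comm (L % E) (a * E)))) (+-monoʳ-≤ (a * E) (<⇒≤ (m%n<n L E)))
  exponent : (a + r) * q ≤ q + L * p
  -- Multiplying by `E` and adding `L * q` to both sides removes the fraction `1 / E` and the
  -- subtraction.
  exponent = *-cancelʳ-≤ ((a + r) * q) (q + L * p) E (+-cancelʳ-≤ (L * q) ((a + r) * q * E) ((q + L * p) * E) (begin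
    (a + r) * q * E + L * q                ≤⟨ +-monoʳ-≤ ((a + r) * q * E) (*-monoˡ-≤ q L≤) ⟩
    (a + r) * q * E + (a * E + E) * q      ≡⟨ collect a r q E ⟩
    q * E + (r + 2 * a) * (q * E)          ≡⟨ cong (λ z → q * E + z * (q * E)) L≡ ⟩
    q * E + L * (q * E)                    ≤⟨ +-monoʳ-≤ (q * E) (*-monoʳ-≤ L qE≤) ⟩
    q * E + L * (p * E + q)                ≡⟨ expand q E L p ⟩
    (q + L * p) * E + L * q                ∎))
    where
    collect : ∀ a r q E → (a + r) * q * E + (a * E + E) * q ≡ q * E + (r + 2 * a) * (q * E)
    collect = solve-∀
    expand : ∀ q E L p → q * E + L * (p * E + q) ≡ (q + L * p) * E + L * q
    expand = solve-∀

-- For t = 2 ⌊L / E⌋ and E ≥ 2 j F, both i / F and j t are at most L / F, and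
-- 2 L / F = L / 2^κ.
lightCount-root : ∀ κ E .{{_ : NonZero E}} → 2 * ((κ + 2) * 2 ^ suc κ) ≤ E → ∀ {L i} → i ≤ L →
                  lightCount i (2 * (L / E)) ^ (2 ^ κ) ≤ 2 ^ L
lightCount-root κ E E≥ {L} {i} i≤L = ^-cancelˡ-≤ 2 (begin
  (c ^ G) ^ 2                                       ≡⟨ trans (^-*-assoc c G 2) (cong (c ^_) (*-comm G 2)) ⟩
  c ^ (2 * G)                                       ≤⟨ lightCount-power (κ + 2) (2 * G) X≡ i (2 * a) ⟩
  2 ^ i * 2 ^ ((κ + 2) * (2 * a * (2 * G)))         ≤⟨ *-mono-≤ (^-monoʳ-≤ 2 i≤L) (^-monoʳ-≤ 2 exponent) ⟩
  2 ^ L * 2 ^ L                                     ≡⟨ cong (2 ^ L *_) (*-identityʳ (2 ^ L)) ⟨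
  (2 ^ L) ^ 2                                       ∎)
  where
  open ≤-Reasoning
  a = L / E
  G = 2 ^ κ
  c = lightCount i (2 * a)
  X≡ : 2 * (2 * G) ≡ 2 ^ (κ + 2)
  X≡ = cong (2 ^_) (+-comm 2 κ)
  exponent : (κ + 2) * (2 * a * (2 * G)) ≤ L
  exponent = begin
    (κ + 2) * (2 * a * (2 * G))      ≡⟨ reorder (κ + 2) a (2 * G) ⟩
    a * (2 * ((κ + 2) * (2 * G)))    ≤⟨ *-monoʳ-≤ a E≥ ⟩
    a * E                            ≤⟨ m/n*n≤m L E ⟩
    L                                ∎
    where
    reorder : ∀ j a F → j * (2 * a * F) ≡ a * (2 * (j * F))
    reorder = solve-∀

-- Rational exponents as pairs of natural numbers

module Fractions where

  open import Data.Integer.Base using (+_; -[1+_]; ∣_∣)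

  -- x = p / (1 + k), in terms of natural numbers only.
  Frac : ℚ → ℕ → ℕ → Set
  Frac x p k = ℚ.toℚᵘ x ℚᵘ.≃ mkℚᵘ (+ p) k

  frac-≤⁺ : ∀ {x y p a r b} → Frac x p a → Frac y r b → p ℕ.* suc b ℕ.≤ r ℕ.* suc a → x ℚ.≤ y
  frac-≤⁺ {p = p} {a} {r} {b} x≃ y≃ p≤r = ℚ.toℚᵘ-cancel-≤
    (ℚᵘ.≤-respˡ-≃ (ℚᵘ.≃-sym x≃) (ℚᵘ.≤-respʳ-≃ (ℚᵘ.≃-sym y≃)
      (*≤* (subst₂ ℤ._≤_ (ℤ.pos-* p (suc b)) (ℤ.pos-* r (suc a)) (ℤ.+≤+ p≤r)))))

  frac-≤⁻ : ∀ {x y p a r b} → Frac x p a → Frac y r b → x ℚ.≤ y → p ℕ.* suc b ℕ.≤ r ℕ.* suc a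
  frac-≤⁻ {p = p} {a} {r} {b} x≃ y≃ x≤y
    with ℚᵘ.≤-respˡ-≃ x≃ (ℚᵘ.≤-respʳ-≃ y≃ (ℚ.toℚᵘ-mono-≤ x≤y))
  ... | *≤* p≤r = ℤ.drop‿+≤+ (subst₂ ℤ._≤_ (sym (ℤ.pos-* p (suc b))) (sym (ℤ.pos-* r (suc a))) p≤r)

  frac-≡⁻ : ∀ {x y p a r b} → Frac x p a → Frac y r b → x ≡ y → p ℕ.* suc b ≡ r ℕ.* suc a
  frac-≡⁻ x≃ y≃ x≡y = ℕ.≤-antisym (frac-≤⁻ x≃ y≃ (ℚ.≤-reflexive x≡y)) (frac-≤⁻ y≃ x≃ (ℚ.≤-reflexive (sym x≡y)))

  frac-+ : ∀ {x y p a r b} → Frac x p a → Frac y r b →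
           Frac (x ℚ.+ y) (p ℕ.* suc b ℕ.+ r ℕ.* suc a) (pred (suc a ℕ.* suc b))
  frac-+ {x} {y} {p} {a} {r} {b} x≃ y≃ =
    ℚᵘ.≃-trans (ℚ.toℚᵘ-homo-+ x y) (ℚᵘ.≃-trans (ℚᵘ.+-cong x≃ y≃) (ℚᵘ.≃-reflexive
      (cong (λ z → mkℚᵘ z (pred (suc a ℕ.* suc b)))
        (trans (cong₂ ℤ._+_ (sym (ℤ.pos-* p (suc b))) (sym (ℤ.pos-* r (suc a)))) (sym (ℤ.pos-+ (p ℕ.* suc b) (r ℕ.* suc a)))))))

  frac-* : ∀ {x y p a r b} → Frac x p a → Frac y r b → Frac (x ℚ.* y) (p ℕ.* r) (pred (suc a ℕ.* suc b))
  frac-* {x} {y} {p} {a} {r} {b} x≃ y≃ =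
    ℚᵘ.≃-trans (ℚ.toℚᵘ-homo-* x y) (ℚᵘ.≃-trans (ℚᵘ.*-cong x≃ y≃) (ℚᵘ.≃-reflexive
      (cong (λ z → mkℚᵘ z (pred (suc a ℕ.* suc b))) (sym (ℤ.pos-* p r)))))

  frac-/ : ∀ m k → Frac (+ m ℚ./ suc k) m k
  frac-/ m k = ℚ.toℚᵘ-fromℚᵘ (mkℚᵘ (+ m) k)

  frac-fromℕ : ∀ m → Frac (fromℕ m) m 0
  frac-fromℕ m = frac-/ m 0

  frac-½^ : ∀ κ {g} → suc g ≡ 2 ℕ.^ κ → Frac (½ ^ℚ κ) 1 g
  frac-½^ zero    refl = ℚᵘ.≃-refl
  frac-½^ (suc κ) {g} e = subst (Frac (½ ^ℚ suc κ) 1) (cong pred (trans (cong (2 ℕ.*_) sg′) (sym e)))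
                            (frac-* {½} {½ ^ℚ κ} {1} {1} {1} {pred (2 ℕ.^ κ)} ℚᵘ.≃-refl (frac-½^ κ sg′))
    where
    sg′ : suc (pred (2 ℕ.^ κ)) ≡ 2 ℕ.^ κ
    sg′ = ℕ.suc-pred (2 ℕ.^ κ) {{ℕ.m^n≢0 2 κ}}

  nonNeg-frac : ∀ s → 0ℚ ℚ.≤ s → ∃[ p ] ∃[ k ] ↥ s ≡ + p × ↧ₙ s ≡ suc k × Frac s p k
  nonNeg-frac (mkℚ (+ p)    k _) _ = p , k , refl , refl , ℚᵘ.≃-refl
  nonNeg-frac (mkℚ -[1+ p ] k _) (ℚ.*≤* ())

  fromℕ-mono : ∀ {m n} → m ℕ.≤ n → fromℕ m ℚ.≤ fromℕ n
  fromℕ-mono {m} {n} m≤n = frac-≤⁺ (frac-fromℕ m) (frac-fromℕ n) (ℕ.*-monoˡ-≤ 1 m≤n)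

  fromℕ-cancel : ∀ {m n} → fromℕ m ℚ.≤ fromℕ n → m ℕ.≤ n
  fromℕ-cancel {m} {n} m≤n = ℕ.*-cancelʳ-≤ m n 1 (frac-≤⁻ (frac-fromℕ m) (frac-fromℕ n) m≤n)

  fromℕ-* : ∀ m n → fromℕ (m ℕ.* n) ≡ fromℕ m ℚ.* fromℕ n
  fromℕ-* m n = ℚ.toℚᵘ-injective
    (ℚᵘ.≃-trans (frac-fromℕ (m ℕ.* n)) (ℚᵘ.≃-sym (frac-* {fromℕ m} {fromℕ n} (frac-fromℕ m) (frac-fromℕ n))))

  fromℕ-^ : ∀ m k → fromℕ (m ℕ.^ k) ≡ fromℕ m ^ℚ k
  fromℕ-^ m zero    = refl
  fromℕ-^ m (suc k) = trans (fromℕ-* m (m ℕ.^ k)) (cong (fromℕ m ℚ.*_) (fromℕ-^ m k))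

  ^ℚ-nonNeg : ∀ {x} → 0ℚ ℚ.≤ x → ∀ k → 0ℚ ℚ.≤ x ^ℚ k
  ^ℚ-nonNeg 0≤x zero    = ℚ.nonNegative⁻¹ 1ℚ
  ^ℚ-nonNeg {x} 0≤x (suc k) = ℚ.nonNegative⁻¹ (x ℚ.* x ^ℚ k)
    {{ℚ.nonNeg*nonNeg⇒nonNeg x {{ℚ.nonNegative 0≤x}} (x ^ℚ k) {{ℚ.nonNegative (^ℚ-nonNeg 0≤x k)}}}}

  ^ℚ-mono : ∀ {x y} → 0ℚ ℚ.≤ x → x ℚ.≤ y → ∀ k → x ^ℚ k ℚ.≤ y ^ℚ k
  ^ℚ-mono 0≤x x≤y zero    = ℚ.≤-refl
  ^ℚ-mono {x} {y} 0≤x x≤y (suc k) = ℚ.≤-trans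
    (ℚ.*-monoˡ-≤-nonNeg x {{ℚ.nonNegative 0≤x}} (^ℚ-mono 0≤x x≤y k))
    (ℚ.*-monoʳ-≤-nonNeg (y ^ℚ k) {{ℚ.nonNegative (^ℚ-nonNeg (ℚ.≤-trans 0≤x x≤y) k)}} x≤y)

  power-bound : ∀ {x B C n p q} → 0ℚ ℚ.≤ x → x ℚ.≤ fromℕ B → B ℕ.^ q ℕ.≤ C ℕ.^ q ℕ.* n ℕ.^ p →
                x ^ℚ q ℚ.≤ fromℕ C ^ℚ q ℚ.* fromℕ n ^ℚ p
  power-bound {x} {B} {C} {n} {p} {q} 0≤x x≤B B^q≤ = begin
    x ^ℚ q                                 ≤⟨ ^ℚ-mono 0≤x x≤B q ⟩
    fromℕ B ^ℚ q                           ≡⟨ fromℕ-^ B q ⟨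
    fromℕ (B ℕ.^ q)                        ≤⟨ fromℕ-mono B^q≤ ⟩
    fromℕ (C ℕ.^ q ℕ.* n ℕ.^ p)            ≡⟨ fromℕ-* (C ℕ.^ q) (n ℕ.^ p) ⟩
    fromℕ (C ℕ.^ q) ℚ.* fromℕ (n ℕ.^ p)    ≡⟨ cong₂ ℚ._*_ (fromℕ-^ C q) (fromℕ-^ n p) ⟩
    fromℕ C ^ℚ q ℚ.* fromℕ n ^ℚ p          ∎
    where open ℚ.≤-Reasoning

  power-bound⁻ : ∀ {m C n p q} → fromℕ m ^ℚ q ℚ.≤ fromℕ C ^ℚ q ℚ.* fromℕ n ^ℚ p →
                 m ℕ.^ q ℕ.≤ C ℕ.^ q ℕ.* n ℕ.^ p
  power-bound⁻ {m} {C} {n} {p} {q} h = fromℕ-cancel (begin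
    fromℕ (m ℕ.^ q)                        ≡⟨ fromℕ-^ m q ⟩
    fromℕ m ^ℚ q                           ≤⟨ h ⟩
    fromℕ C ^ℚ q ℚ.* fromℕ n ^ℚ p          ≡⟨ cong₂ ℚ._*_ (fromℕ-^ C q) (fromℕ-^ n p) ⟨
    fromℕ (C ℕ.^ q) ℚ.* fromℕ (n ℕ.^ p)    ≡⟨ fromℕ-* (C ℕ.^ q) (n ℕ.^ p) ⟨
    fromℕ (C ℕ.^ q ℕ.* n ℕ.^ p)            ∎)
    where open ℚ.≤-Reasoning

  fraction-nonNeg : ∀ s m .{{_ : NonZero m}} → 0ℚ ℚ.≤ + s ℚ./ m
  fraction-nonNeg s (suc m) = frac-≤⁺ {0ℚ} {p = 0} {0} ℚᵘ.≃-refl (frac-/ s m) z≤n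

  fraction≤ : ∀ s m .{{_ : NonZero m}} {B} → s ℕ.≤ B ℕ.* m → + s ℚ./ m ℚ.≤ fromℕ B
  fraction≤ s (suc m) {B} s≤ =
    frac-≤⁺ (frac-/ s m) (frac-fromℕ B) (ℕ.≤-trans (ℕ.≤-reflexive (ℕ.*-identityʳ s)) s≤)

  ½^-pos : ∀ k → 0ℚ ℚ.< ½ ^ℚ k
  ½^-pos zero    = ℚ.positive⁻¹ 1ℚ
  ½^-pos (suc k) = ℚ.≤-<-trans (ℚ.≤-reflexive (sym (ℚ.*-zeroʳ ½))) (ℚ.*-monoʳ-<-pos ½ (½^-pos k))

  ½^-double : ∀ k → ½ ^ℚ k ≡ ½ ^ℚ suc k ℚ.+ ½ ^ℚ suc k
  ½^-double k = sym (trans (sym (ℚ.*-distribʳ-+ (½ ^ℚ k) ½ ½)) (ℚ.*-identityˡ (½ ^ℚ k)))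

  -- The slack w makes linear consequences of A < B provable by a ring identity.
  linear-< : ∀ {A B} x y w → A ℚ.< B → 0ℚ ℚ.≤ w → (x ℚ.+ B) ℚ.+ w ≡ y ℚ.+ A → x ℚ.< y
  linear-< {A} {B} x y w A<B 0≤w e = subst₂ ℚ._<_ (cancel x A) (cancel y A)
    (ℚ.+-monoˡ-< (ℚ.- A) (ℚ.<-≤-trans (ℚ.+-monoʳ-< x A<B)
      (ℚ.≤-trans (ℚ.≤-reflexive (sym (ℚ.+-identityʳ (x ℚ.+ B))))
      (ℚ.≤-trans (ℚ.+-monoʳ-≤ (x ℚ.+ B) 0≤w) (ℚ.≤-reflexive e)))))
    where
    cancel : ∀ x a → (x ℚ.+ a) ℚ.+ ℚ.- a ≡ x
    cancel = solve 2 (λ x a → (x :+ a) :+ (:- a) := x) refl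
      where open +-*-Solver

  approx-close : ∀ x m n → approx x m ℚ.- approx x n ℚ.≤ ½ ^ℚ m ℚ.+ ½ ^ℚ n
  approx-close x m n = ℚ.≤-trans (p≤∣p∣ (approx x m ℚ.- approx x n)) (regular x m n)
    where
    p≤∣p∣ : ∀ p → p ℚ.≤ ℚ.∣ p ∣
    p≤∣p∣ (mkℚ (+ p)    k c) = ℚ.≤-refl
    p≤∣p∣ (mkℚ -[1+ p ] k c) = ℚ.*≤* ℤ.-≤+

  numerator≥ : ∀ q → q ℚ.≤ fromℕ ∣ ↥ q ∣
  numerator≥ (mkℚ (+ p)    k c) = frac-≤⁺ {p = p} {k} ℚᵘ.≃-refl (frac-fromℕ p) (ℕ.*-monoʳ-≤ p (s≤s z≤n))
  numerator≥ (mkℚ -[1+ p ] k c) = ℚ.≤-trans (ℚ.*≤* ℤ.-≤+) (fraction-nonNeg (suc p) 1)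

  integer-above : ∀ c → ∃[ m ] c <ᵣ fromℚ (fromℕ m)
  -- At index 0 the strict order demands a gap of more than `1 + 1`, hence 3.
  integer-above c = m ℕ.+ 3 , 0 ,
    ℚ.≤-<-trans (ℚ.+-monoˡ-≤ (fromℕ 2) (numerator≥ (approx c 0))) (ℚ.<-≤-trans (ℚ.+-monoʳ-< (fromℕ m) 2<3)
      (frac-≤⁺ (frac-+ {fromℕ m} {fromℕ 3} (frac-fromℕ m) (frac-fromℕ 3)) (frac-fromℕ (m ℕ.+ 3))
        (ℕ.≤-reflexive (identity m))))
    where
    m = ∣ ↥ approx c 0 ∣
    2<3 : fromℕ 2 ℚ.< fromℕ 3
    2<3 = ℚ.*<* (ℤ.+<+ (s≤s (s≤s (s≤s z≤n))))
    identity : ∀ m → (m ℕ.* 1 ℕ.+ 3) ℕ.* 1 ≡ (m ℕ.+ 3) ℕ.* 1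
    identity = solve-∀

  module _ {c ε : ℝ} {κ κ′ : ℕ}
           (2h<ε : 0ℚ ℚ.+ (½ ^ℚ κ ℚ.+ ½ ^ℚ κ) ℚ.< approx ε κ)
           (2h<c : 1ℚ ℚ.+ (½ ^ℚ κ′ ℚ.+ ½ ^ℚ κ′) ℚ.< approx c κ′)
           {s : ℚ} (<s : (c -ᵣ 1ᵣ) +ᵣ ε <ᵣ fromℚ s) where

    private
      k = proj₁ <s
      c₂ = approx c (2 ℕ.+ k)
      ε₁ = approx ε (1 ℕ.+ k)
      h h′ h₂ : ℚ
      h  = ½ ^ℚ κ
      h′ = ½ ^ℚ κ′
      h₂ = ½ ^ℚ (2 ℕ.+ k)

      h₁≡ : ½ ^ℚ (1 ℕ.+ k) ≡ h₂ ℚ.+ h₂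
      h₁≡ = ½^-double (1 ℕ.+ k)

      h₀≡ : ½ ^ℚ k ≡ (h₂ ℚ.+ h₂) ℚ.+ (h₂ ℚ.+ h₂)
      h₀≡ = trans (½^-double k) (cong₂ ℚ._+_ h₁≡ h₁≡)

      0≤h₂ : 0ℚ ℚ.≤ h₂
      0≤h₂ = ℚ.<⇒≤ (½^-pos (2 ℕ.+ k))

      0≤h′ : 0ℚ ℚ.≤ h′
      0≤h′ = ℚ.<⇒≤ (½^-pos κ′)

      ε-bound : approx ε κ ℚ.- ε₁ ℚ.≤ h ℚ.+ (h₂ ℚ.+ h₂)
      ε-bound = subst (λ z → approx ε κ ℚ.- ε₁ ℚ.≤ h ℚ.+ z) h₁≡ (approx-close ε κ (1 ℕ.+ k))

      s-bound : ((c₂ ℚ.+ ℚ.- 1ℚ) ℚ.+ ε₁) ℚ.+ (((h₂ ℚ.+ h₂) ℚ.+ (h₂ ℚ.+ h₂)) ℚ.+ ((h₂ ℚ.+ h₂) ℚ.+ (h₂ ℚ.+ h₂))) ℚ.< s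
      s-bound = subst (λ z → ((c₂ ℚ.+ ℚ.- 1ℚ) ℚ.+ ε₁) ℚ.+ (z ℚ.+ z) ℚ.< s) h₀≡ (proj₂ <s)

      together : (approx ε κ ℚ.- ε₁) ℚ.+ ((0ℚ ℚ.+ (h ℚ.+ h)) ℚ.+
                   (((c₂ ℚ.+ ℚ.- 1ℚ) ℚ.+ ε₁) ℚ.+ (((h₂ ℚ.+ h₂) ℚ.+ (h₂ ℚ.+ h₂)) ℚ.+ ((h₂ ℚ.+ h₂) ℚ.+ (h₂ ℚ.+ h₂)))))
                 ℚ.< (h ℚ.+ (h₂ ℚ.+ h₂)) ℚ.+ (approx ε κ ℚ.+ s)
      together = ℚ.+-mono-≤-< ε-bound (ℚ.+-mono-< 2h<ε s-bound)

    -- From `s > c - 1 + ε` and `ε > ½ ^ κ`. The index is `2 + k` because two nested additions make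
    -- the `k`-th term of the sum use that approximation of `c`; all errors are then multiples of
    -- `h₂`.
    exponent-above : c <ᵣ fromℚ ((s ℚ.+ 1ℚ) ℚ.- ½ ^ℚ κ)
    exponent-above = 2 ℕ.+ k ,
      linear-< (c₂ ℚ.+ (h₂ ℚ.+ h₂)) ((s ℚ.+ 1ℚ) ℚ.- h) ((h₂ ℚ.+ h₂) ℚ.+ (h₂ ℚ.+ h₂))
        together (ℚ.+-mono-≤ 0≤2h₂ 0≤2h₂) (identity c₂ h₂ s h (approx ε κ) ε₁)
      where
      0≤2h₂ : 0ℚ ℚ.≤ h₂ ℚ.+ h₂
      0≤2h₂ = ℚ.+-mono-≤ 0≤h₂ 0≤h₂
      identity : ∀ c₂ h₂ s h ε ε₁ →
        ((c₂ ℚ.+ (h₂ ℚ.+ h₂)) ℚ.+ ((h ℚ.+ (h₂ ℚ.+ h₂)) ℚ.+ (ε ℚ.+ s))) ℚ.+ ((h₂ ℚ.+ h₂) ℚ.+ (h₂ ℚ.+ h₂))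
        ≡ ((s ℚ.+ 1ℚ) ℚ.- h) ℚ.+ ((ε ℚ.- ε₁) ℚ.+ ((0ℚ ℚ.+ (h ℚ.+ h)) ℚ.+
           (((c₂ ℚ.+ ℚ.- 1ℚ) ℚ.+ ε₁) ℚ.+ (((h₂ ℚ.+ h₂) ℚ.+ (h₂ ℚ.+ h₂)) ℚ.+ ((h₂ ℚ.+ h₂) ℚ.+ (h₂ ℚ.+ h₂))))))
      identity = solve 6 (λ c₂ h₂ s h ε ε₁ →
        ((c₂ :+ (h₂ :+ h₂)) :+ ((h :+ (h₂ :+ h₂)) :+ (ε :+ s))) :+ ((h₂ :+ h₂) :+ (h₂ :+ h₂))
        := ((s :+ con 1ℚ) :- h) :+ ((ε :- ε₁) :+ ((con 0ℚ :+ (h :+ h)) :+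
           (((c₂ :+ :- con 1ℚ) :+ ε₁) :+ (((h₂ :+ h₂) :+ (h₂ :+ h₂)) :+ ((h₂ :+ h₂) :+ (h₂ :+ h₂))))))) refl
        where open +-*-Solver

    -- Here `c > 1` enters. The conclusion makes the numerator of `s` a natural number and is the
    -- hypothesis `q≤pG` of `Space`.
    exponent-large : ½ ^ℚ κ ℚ.≤ s
    exponent-large = ℚ.<⇒≤ (linear-< h s (((h₂ ℚ.+ h₂) ℚ.+ (h₂ ℚ.+ h₂)) ℚ.+ (h₂ ℚ.+ h′))
      (ℚ.+-mono-<-≤ (ℚ.+-mono-< together 2h<c) (approx-close c κ′ (2 ℕ.+ k)))
      (ℚ.+-mono-≤ (ℚ.+-mono-≤ (ℚ.+-mono-≤ 0≤h₂ 0≤h₂) (ℚ.+-mono-≤ 0≤h₂ 0≤h₂)) (ℚ.+-mono-≤ 0≤h₂ 0≤h′))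
      (identity c₂ h₂ s h (approx ε κ) ε₁ h′ (approx c κ′)))
      where
      identity : ∀ c₂ h₂ s h ε ε₁ h′ c′ →
        (h ℚ.+ ((((h ℚ.+ (h₂ ℚ.+ h₂)) ℚ.+ (ε ℚ.+ s)) ℚ.+ c′) ℚ.+ (h′ ℚ.+ h₂))) ℚ.+ (((h₂ ℚ.+ h₂) ℚ.+ (h₂ ℚ.+ h₂)) ℚ.+ (h₂ ℚ.+ h′))
        ≡ s ℚ.+ ((((ε ℚ.- ε₁) ℚ.+ ((0ℚ ℚ.+ (h ℚ.+ h)) ℚ.+
           (((c₂ ℚ.+ ℚ.- 1ℚ) ℚ.+ ε₁) ℚ.+ (((h₂ ℚ.+ h₂) ℚ.+ (h₂ ℚ.+ h₂)) ℚ.+ ((h₂ ℚ.+ h₂) ℚ.+ (h₂ ℚ.+ h₂))))))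
           ℚ.+ (1ℚ ℚ.+ (h′ ℚ.+ h′))) ℚ.+ (c′ ℚ.- c₂))
      identity = solve 8 (λ c₂ h₂ s h ε ε₁ h′ c′ →
        (h :+ ((((h :+ (h₂ :+ h₂)) :+ (ε :+ s)) :+ c′) :+ (h′ :+ h₂))) :+ (((h₂ :+ h₂) :+ (h₂ :+ h₂)) :+ (h₂ :+ h′))
        := s :+ ((((ε :- ε₁) :+ ((con 0ℚ :+ (h :+ h)) :+
           (((c₂ :+ :- con 1ℚ) :+ ε₁) :+ (((h₂ :+ h₂) :+ (h₂ :+ h₂)) :+ ((h₂ :+ h₂) :+ (h₂ :+ h₂))))))
           :+ (con 1ℚ :+ (h′ :+ h′))) :+ (c′ :- c₂))) refl
        where open +-*-Solver

open Fractions

-- Bounds with real exponents and the choice of the parameters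

2^-cancel-≤ : ∀ {k l} → 2 ^ k ≤ 2 ^ l → k ≤ l
2^-cancel-≤ {k} {l} 2^k≤2^l with k ≤? l
... | yes k≤l = k≤l
... | no  k≰l = contradiction (^-monoʳ-< 2 (s≤s (s≤s z≤n)) (≰⇒> k≰l)) (≤⇒≯ 2^k≤2^l)

-- A real exponent is tested at the fractions above it; once these are nonnegative, both numerator
-- and denominator are natural numbers and no rational power remains.
≤·^ᵣ-intro : ∀ {x B C n r} .{{_ : NonZero n}} → 0ℚ ℚ.≤ x → x ℚ.≤ fromℕ B →
  (∀ {s} → r <ᵣ fromℚ s → 0ℚ ℚ.≤ s) →
  (∀ {s p k} → r <ᵣ fromℚ s → Frac s p k → B ^ suc k ≤ C ^ suc k * n ^ p) →
  x ≤ C · n ^ᵣ r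
≤·^ᵣ-intro {x} {B} {C} {n} 0≤x x≤B nonNeg bound s r<s with nonNeg-frac s (nonNeg r<s)
... | p , k , num , den , frac =
  subst₂ (λ q z → x ^ℚ q ℚ.≤ fromℕ C ^ℚ q ℚ.* n ^ℤ z) (sym den) (sym num)
         (power-bound {x} {B} {C} {n} {p} {suc k} 0≤x x≤B (bound r<s frac))

≤·^ᵣ-elim : ∀ {m C n r} .{{_ : NonZero n}} → fromℕ m ≤ C · n ^ᵣ r → ∀ {s} → r <ᵣ fromℚ s → 0ℚ ℚ.≤ s →
  ∃[ p ] ∃[ k ] Frac s p k × m ^ suc k ≤ C ^ suc k * n ^ p
≤·^ᵣ-elim {m} {C} {n} m≤ {s} r<s 0≤s with nonNeg-frac s 0≤s
... | p , k , num , den , frac =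
  p , k , frac , power-bound⁻ {m} {C} {n} {p} {suc k}
    (subst₂ (λ q z → fromℕ m ^ℚ q ℚ.≤ fromℕ C ^ℚ q ℚ.* n ^ℤ z) den num (m≤ s r<s))

-- Testing `d ≈ c log₂ n` at the integer `K` gives `2 ^ d ≤ 2 * n ^ K`. The leading 2 makes the
-- coefficient `suc K`, with which the structure is instantiated.
dimension≤ : ∀ {c K n d} .{{_ : NonZero n}} → c <ᵣ fromℚ (fromℕ K) → d ≈ c log₂ n →
             d ≤ suc K * suc ⌊log₂ n ⌋
dimension≤ {c} {K} {n} {d} c<K (2^d≤ , _) = conclude (≤·^ᵣ-elim {2 ^ d} {2} {n} {c} 2^d≤ c<K (fraction-nonNeg K 1))
  where
  open ≤-Reasoning
  L = ⌊log₂ n ⌋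
  conclude : ∃[ p ] ∃[ k ] Frac (fromℕ K) p k × (2 ^ d) ^ suc k ≤ 2 ^ suc k * n ^ p → d ≤ suc K * suc L
  conclude (p , k , frac , h) = ≤-trans (2^-cancel-≤ (begin
    2 ^ d                          ≤⟨ ^-cancelˡ-≤ (suc k) root ⟩
    2 * n ^ K                      ≤⟨ *-monoʳ-≤ 2 (^-monoˡ-≤ K (<⇒≤ (n<2^[1+⌊log₂n⌋] n))) ⟩
    2 * (2 ^ suc L) ^ K            ≡⟨ cong (2 *_) (^-*-assoc 2 (suc L) K) ⟩
    2 ^ suc (suc L * K)            ∎)) (s≤s (≤-trans (≤-reflexive (*-comm (suc L) K)) (m≤n+m (K * suc L) L)))
    where
    p≡ : p ≡ K * suc k
    p≡ = trans (sym (*-identityʳ p)) (frac-≡⁻ frac (frac-fromℕ K) refl)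
    root : (2 ^ d) ^ suc k ≤ (2 * n ^ K) ^ suc k
    root = begin
      (2 ^ d) ^ suc k              ≤⟨ h ⟩
      2 ^ suc k * n ^ p            ≡⟨ cong (λ z → 2 ^ suc k * n ^ z) p≡ ⟩
      2 ^ suc k * n ^ (K * suc k)  ≡⟨ cong (2 ^ suc k *_) (^-*-assoc n K (suc k)) ⟨
      2 ^ suc k * (n ^ K) ^ suc k  ≡⟨ ^-distribʳ-* 2 (n ^ K) (suc k) ⟨
      (2 * n ^ K) ^ suc k          ∎

½^≤1 : ∀ κ → ½ ^ℚ κ ℚ.≤ 1ℚ
½^≤1 κ = frac-≤⁺ (frac-½^ κ {pred (2 ^ κ)} (suc-pred (2 ^ κ) {{m^n≢0 2 κ}})) (frac-fromℕ 1) (s≤s z≤n)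

module Sublinear (K η : ℕ) (2≤E : 2 ≤ 2 ^ η) where

  E : ℕ
  E = 2 ^ η

  instance
    E≢0 : NonZero E
    E≢0 = m^n≢0 2 η

  open Structure K E
  open ExpectedTime K E 2≤E

  δ : ℝ
  δ = fromℚ (½ ^ℚ η)

  δ>0 : 0ᵣ <ᵣ δ
  -- At index `2 + η` the required gap is `½ ^ (1 + η)`, half of `δ`.
  δ>0 = 2 + η , subst₂ ℚ._<_ (trans (½^-double (1 + η)) (sym (ℚ.+-identityˡ _))) (sym (½^-double η))
                  (ℚ.≤-<-trans (ℚ.≤-reflexive (sym (ℚ.+-identityʳ _))) (ℚ.+-monoʳ-< (½ ^ℚ suc η) (½^-pos (suc η))))

  exponent≥ : ∀ {s} → 1ᵣ -ᵣ δ <ᵣ fromℚ s → 1ℚ ℚ.- ½ ^ℚ η ℚ.≤ s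
  exponent≥ {s} (k , <s) = ℚ.<⇒≤ (ℚ.≤-<-trans
    (ℚ.≤-trans (ℚ.≤-reflexive (sym (ℚ.+-identityʳ _)))
               (ℚ.+-monoʳ-≤ (1ℚ ℚ.- ½ ^ℚ η) (ℚ.+-mono-≤ (ℚ.<⇒≤ (½^-pos k)) (ℚ.<⇒≤ (½^-pos k))))) <s)

  expectedTime : ∀ {c} → (∀ n d .{{_ : NonZero n}} → d ≈ c log₂ n → Admissible n d) →
                 ExpectedTimeO time c (1ᵣ -ᵣ δ)
  expectedTime admissible = factor * 2 , 0 , λ n d _ d≈ v →
    ≤·^ᵣ-intro {𝔼 n d (λ S → time n d S v)} {factor * 2 ^ (gain n + remaining n)} {factor * 2} {n} {1ᵣ -ᵣ δ}
      (fraction-nonNeg (sumOver (λ S → time n d S v) (allInputs n d)) (2 ^ (d * n)) {{m^n≢0 2 (d * n)}})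
      (fraction≤ (sumOver (λ S → time n d S v) (allInputs n d)) (2 ^ (d * n)) {{m^n≢0 2 (d * n)}} {factor * 2 ^ (gain n + remaining n)} (sum-time n d (admissible n d d≈) v))
      (λ {s} <s → ℚ.≤-trans (ℚ.≤-trans (ℚ.≤-reflexive (sym (ℚ.+-inverseʳ (½ ^ℚ η)))) (ℚ.+-monoˡ-≤ (ℚ.- (½ ^ℚ η)) (½^≤1 η)))
                        (exponent≥ {s} <s))
      (λ {s} {p} {k} <s frac → saved-power E {n} {⌊log₂ n ⌋} {remaining n} {p} {suc k} {factor}
        (split-log n) (2^⌊log₂n⌋≤n n) (fractions {s} frac (exponent≥ {s} <s)))
    where
    g = pred E
    sg≡E : suc g ≡ E
    sg≡E = suc-pred E
    fractions : ∀ {s p k} → Frac s p k → 1ℚ ℚ.- ½ ^ℚ η ℚ.≤ s → suc k * E ≤ p * E + suc k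
    fractions {s} {p} {k} frac 1-u≤s = subst (λ E → suc k * E ≤ p * E + suc k) sg≡E (begin
      suc k * suc g                     ≡⟨ +-identityʳ (suc k * suc g) ⟨
      1 * suc (pred (suc k * suc g))    ≤⟨ frac-≤⁻ (frac-fromℕ 1) (frac-+ {s} {½ ^ℚ η} frac (frac-½^ η sg≡E)) 1≤s+u ⟩
      (p * suc g + 1 * suc k) * 1       ≡⟨ simplify p (suc g) (suc k) ⟩
      p * suc g + suc k                 ∎)
      where
      open ≤-Reasoning
      simplify : ∀ p g k → (p * g + 1 * k) * 1 ≡ p * g + k
      simplify = solve-∀
      1≤s+u : 1ℚ ℚ.≤ s ℚ.+ ½ ^ℚ η
      1≤s+u = ℚ.≤-trans (ℚ.≤-reflexive (cancel 1ℚ (½ ^ℚ η))) (ℚ.+-monoˡ-≤ (½ ^ℚ η) 1-u≤s)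
        where
        cancel : ∀ a u → a ≡ (a ℚ.- u) ℚ.+ u
        cancel = solve 2 (λ a u → a := (a :- u) :+ u) refl
          where open +-*-Solver

  space≡ : ∀ n d (S : Input n d) →
           space index S ≡ 2 + 2 ^ lowBits n d * lightCount (highBits n d) (threshold n)
  space≡ n d S = trans (length-map _ (auxiliaryWords n d S))
    (cong (2 +_) (trans (length-map _ (lights (lowBits n d) (highBits n d) (threshold n)))
                        (length-lights (lowBits n d) (highBits n d) (threshold n))))

  spaceBound : ∀ c ε κ κ′ →
    0ℚ ℚ.+ (½ ^ℚ κ ℚ.+ ½ ^ℚ κ) ℚ.< approx ε κ → 1ℚ ℚ.+ (½ ^ℚ κ′ ℚ.+ ½ ^ℚ κ′) ℚ.< approx c κ′ →
    2 * ((κ + 2) * 2 ^ suc κ) ≤ E → SpaceO index c ((c -ᵣ 1ᵣ) +ᵣ ε)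
  spaceBound c ε κ κ′ ε> c> E≥ = 12 , 0 , λ n d _ d≈ S →
    ≤·^ᵣ-intro {fromℕ (space index S)} {space index S} {12} {n} {(c -ᵣ 1ᵣ) +ᵣ ε} (fraction-nonNeg (space index S) 1) ℚ.≤-refl
      (λ {s} <s → ℚ.≤-trans (ℚ.<⇒≤ (½^-pos κ)) (exponent-large {c} {ε} {κ} {κ′} ε> c> {s} <s))
      (λ {s} {p} {k} <s frac → subst (λ z → z ^ suc k ≤ 12 ^ suc k * n ^ p) (sym (space≡ n d S))
        (bounded n d d≈ {s} frac (exponent-above {c} {ε} {κ} {κ′} ε> c> {s} <s) (exponent-large {c} {ε} {κ} {κ′} ε> c> {s} <s)))
    where
    g = pred (2 ^ κ)
    sg≡G : suc g ≡ 2 ^ κ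
    sg≡G = suc-pred (2 ^ κ) {{m^n≢0 2 κ}}

    bounded : ∀ n d .{{_ : NonZero n}} → d ≈ c log₂ n → ∀ {s p k} → Frac s p k →
      c <ᵣ fromℚ ((s ℚ.+ 1ℚ) ℚ.- ½ ^ℚ κ) → ½ ^ℚ κ ℚ.≤ s →
      (2 + 2 ^ lowBits n d * lightCount (highBits n d) (threshold n)) ^ suc k ≤ 12 ^ suc k * n ^ p
    bounded n d (2^d≤ , _) {s} {p} {k} frac c<s′ h≤s = conclude (≤·^ᵣ-elim {2 ^ d} {2} {n} {c} 2^d≤ c<s′ 0≤s′)
      where
      -- The assumption on `d` is used at this fraction above `c`: less 1 for the low bits and plus
      -- `½ ^ κ` for the light prefixes, it is `s` again.
      s′ = (s ℚ.+ 1ℚ) ℚ.- ½ ^ℚ κ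
      cnt = lightCount (highBits n d) (threshold n)

      0≤s′ : 0ℚ ℚ.≤ s′
      0≤s′ = ℚ.≤-trans (ℚ.≤-reflexive (sym (ℚ.+-inverseʳ (½ ^ℚ κ))))
               (ℚ.+-monoˡ-≤ (ℚ.- (½ ^ℚ κ)) (ℚ.≤-trans h≤s (ℚ.≤-trans (ℚ.≤-reflexive (sym (ℚ.+-identityʳ s)))
                 (ℚ.+-monoʳ-≤ s (fraction-nonNeg 1 1)))))

      cancel : ∀ s h → ((s ℚ.+ 1ℚ) ℚ.- h) ℚ.+ h ≡ s ℚ.+ 1ℚ
      cancel = solve 2 (λ s h → ((s :+ con 1ℚ) :- h) :+ h := s :+ con 1ℚ) refl
        where open +-*-Solver

      ratio : ∀ {p′ k′} → Frac s′ p′ k′ → (p′ * suc g + suc k′) * suc k ≡ (p + suc k) * (suc k′ * suc g)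
      ratio {p′} {k′} frac′ = begin
        (p′ * suc g + suc k′) * suc k                   ≡⟨ left p′ (suc g) (suc k′) (suc k) ⟩
        (p′ * suc g + 1 * suc k′) * (suc k * 1)         ≡⟨ frac-≡⁻ (frac-+ {s′} {½ ^ℚ κ} frac′ (frac-½^ κ sg≡G))
                                                                   (frac-+ {s} {1ℚ} frac (frac-fromℕ 1)) (cancel s (½ ^ℚ κ)) ⟩
        (p * 1 + 1 * suc k) * (suc k′ * suc g)          ≡⟨ right p (suc k) (suc k′ * suc g) ⟩
        (p + suc k) * (suc k′ * suc g)                  ∎
        where
        open ≡-Reasoning
        left : ∀ p g q k → (p * g + q) * k ≡ (p * g + 1 * q) * (k * 1)
        left = solve-∀
        right : ∀ p k r → (p * 1 + 1 * k) * r ≡ (p + k) * r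
        right = solve-∀

      conclude : ∃[ p′ ] ∃[ k′ ] Frac s′ p′ k′ × (2 ^ d) ^ suc k′ ≤ 2 ^ suc k′ * n ^ p′ →
                 (2 + 2 ^ lowBits n d * cnt) ^ suc k ≤ 12 ^ suc k * n ^ p
      conclude (p′ , k′ , frac′ , 2^d≤′) =
        Space.bound {n} {d} {⌊log₂ n ⌋} {2 ^ κ} {cnt} {p} {suc k} {p′} {suc k′}
          {{m^n≢0 2 κ}} (lightCount-root κ E E≥ (highBits≤ n d)) (2^⌊log₂n⌋≤n n) (n<2^[1+⌊log₂n⌋] n) 2^d≤′
          (subst (λ G → (p′ * G + suc k′) * suc k ≡ (p + suc k) * (suc k′ * G)) sg≡G (ratio frac′))
          (subst (λ G → suc k ≤ p * G) sg≡G
            (≤-trans (≤-reflexive (sym (+-identityʳ (suc k)))) (frac-≤⁻ (frac-½^ κ sg≡G) frac h≤s)))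

theorem11 : ∀ (c ε : ℝ) → 1ᵣ <ᵣ c → 0ᵣ <ᵣ ε →
    ∃[ D ] ∃[ T ]
    Solves D c T ×
    TrulySublinearExpected T c ×
    SpaceO D c ((c -ᵣ 1ᵣ) +ᵣ ε)
theorem11 c ε (κ′ , c>) (κ , ε>) =
  index , time ,
  (λ n d d≈ S v → time-answers (dimension≤ {c} {K} {n} {d} c<K d≈) S v) ,
  (δ , δ>0 , expectedTime {c} (λ n d d≈ → dimension≤ {c} {K} {n} {d} c<K d≈)) ,
  spaceBound c ε κ κ′ ε> c> E≥
  where
  K = proj₁ (integer-above c)
  c<K = proj₂ (integer-above c)
  -- `κ` comes from the proof of `0ᵣ <ᵣ ε`, and `½ ^ κ` is below `ε`. `E` must reach
  -- `(κ + 2) * 2 ^ (κ + 2)`, and `κ + 2` is itself below `2 ^ (κ + 2)`. A power of two makes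
  -- `δ = 1 / E` a power of `½`.
  η = (κ + 2) + (κ + 2)

  E≥ : 2 * ((κ + 2) * 2 ^ suc κ) ≤ 2 ^ η
  E≥ = begin
    2 * ((κ + 2) * 2 ^ suc κ)    ≡⟨ swap (κ + 2) (2 ^ suc κ) ⟩
    (κ + 2) * 2 ^ (2 + κ)        ≤⟨ *-mono-≤ (<⇒≤ (n<2^n (κ + 2))) (≤-reflexive (cong (2 ^_) (+-comm 2 κ))) ⟩
    2 ^ (κ + 2) * 2 ^ (κ + 2)    ≡⟨ ^-distribˡ-+-* 2 (κ + 2) (κ + 2) ⟨
    2 ^ η                        ∎
    where
    open ≤-Reasoning
    swap : ∀ a b → 2 * (a * b) ≡ a * (2 * b)
    swap = solve-∀

  2≤E : 2 ≤ 2 ^ η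
  2≤E = ≤-trans (≤-trans (m≤n+m 2 κ) (m≤m+n (κ + 2) (κ + 2))) (<⇒≤ (n<2^n η))

  open Sublinear (suc K) η 2≤E
  open Structure (suc K) (2 ^ η) {{m^n≢0 2 η}}
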